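{- Let $0<\epsilon<1$. There is a deterministic $(1+\epsilon,\beta)$-approximation algorithm for all-pairs shortest paths in unweighted undirected $n$-vertex graphs in the Congested Clique model that takes $O\!\left(\frac{\log^2\beta}{\epsilon}+(\log\log n)^4\right)$ rounds, where $\beta=O\!\left(\frac{\log\log n}{\epsilon}\right)^{\log\log n}$.
   Context: Congested Clique model: the $n$ vertices communicate in synchronous rounds; each pair of vertices may exchange $O(\log n)$ bits per round; initially each vertex knows only its incident edges. A $(1+\epsilon,\beta)$-approximation for all-pairs shortest paths means every vertex $u$ computes for every $v$ an estimate $\delta(u,v)$ with $d_G(u,v)\le\delta(u,v)\le(1+\epsilon)d_G(u,v)+\beta$. -}

module Defs where

open import Data.Bool using (Bool; true; false)
open import Data.Nat as ℕ using (ℕ; zero; suc)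
open import Data.Fin using (Fin)
open import Data.Vec using (Vec)
open import Data.Maybe using (Maybe; just; nothing)
open import Data.Product using (Σ; ∃; _×_; _,_)
open import Data.Integer using (+_)
open import Data.Rational using (ℚ; 1ℚ; _*_; _+_; _/_; _≤_)
open import Data.Nat.Logarithm using (⌈log₂_⌉)
open import Relation.Binary.PropositionalEquality using (_≡_)
open import Relation.Nullary using (¬_)

ℕ→ℚ : ℕ → ℚ
ℕ→ℚ n = + n / 1

_^ℚ_ : ℚ → ℕ → ℚ
q ^ℚ zero  = 1ℚ
q ^ℚ suc k = q * (q ^ℚ k)

lg : ℕ → ℕ
lg n = ⌈log₂ n ⌉

lglg : ℕ → ℕ
lglg n = lg (lg n)

record Graph (n : ℕ) : Set where
  field
    adj   : Fin n → Fin n → Bool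
    sym   : ∀ u v → adj u v ≡ adj v u
    irrefl : ∀ u → adj u u ≡ false
open Graph public

data Walk {n : ℕ} (G : Graph n) : Fin n → Fin n → ℕ → Set where
  here : ∀ {u} → Walk G u u zero
  step : ∀ {u w v k} → adj G u w ≡ true → Walk G w v k → Walk G u v (suc k)

IsDist : {n : ℕ} → Graph n → Fin n → Fin n → ℕ → Set
IsDist G u v d = Walk G u v d × (∀ k → Walk G u v k → d ℕ.≤ k)

Connected : {n : ℕ} → Graph n → Fin n → Fin n → Set
Connected G u v = ∃ λ k → Walk G u v k

-- An estimate δ ∈ ℕ ∪ {∞} (nothing = ∞) is a (1+ε, β)-approximation of
-- d_G(u,v) ∈ ℕ ∪ {∞}:  d_G(u,v) ≤ δ ≤ (1+ε) d_G(u,v) + β.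
-- If u,v are disconnected, d_G(u,v) = ∞ forces δ = ∞.
ApproxEstimate : {n : ℕ} → Graph n → ℚ → ℕ → Fin n → Fin n → Maybe ℕ → Set
ApproxEstimate G ε β u v δ =
  (∀ d → IsDist G u v d →
     Σ ℕ λ m → δ ≡ just m × d ℕ.≤ m ×
       ℕ→ℚ m ≤ (1ℚ + ε) * ℕ→ℚ d + ℕ→ℚ β)
  × (¬ Connected G u v → δ ≡ nothing)

-- Deterministic algorithms in the Congested Clique model.
-- n vertices with identifiers Fin n; in each synchronous round every
-- vertex sends to every vertex a message of exactly B bits (Vec Bool B),
-- computed deterministically from its local state, and then updates its
-- state deterministically from the messages it received.  Initially,
-- vertex v knows its identifier v (and n, and the parameters, on which
-- the algorithm may depend) and its incident edges (row v of adjacency).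
-- Local computation is unrestricted.

record CCAlgorithm (n B : ℕ) : Set₁ where
  field
    State  : Set
    init   : Fin n → (Fin n → Bool) → State
    send   : State → Fin n → Vec Bool B          -- message to given recipient
    update : State → (Fin n → Vec Bool B) → State -- messages indexed by sender
    output : State → Fin n → Maybe ℕ              -- estimate δ(v, ·), nothing = ∞
open CCAlgorithm public

stateAfter : {n B : ℕ} → (A : CCAlgorithm n B) → Graph n → ℕ → Fin n → State A
stateAfter A G zero    v = init A v (adj G v)
stateAfter A G (suc t) v =
  update A (stateAfter A G t v) (λ u → send A (stateAfter A G t u) v)

estimate : {n B : ℕ} → CCAlgorithm n B → ℕ → Graph n → Fin n → Fin n → Maybe ℕ
estimate A R G u v = output A (stateAfter A G R u) v

SolvesApproxAPSP : {n B : ℕ} → CCAlgorithm n B → ℕ → ℚ → ℕ → Set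
SolvesApproxAPSP {n} A R ε β =
  (G : Graph n) (u v : Fin n) → ApproxEstimate G ε β u v (estimate A R G u v)

{-# OPTIONS --safe #-}
-- Write L for lglg n and e for the integer part of 1 / ε plus one.  A node is light if its ball of
-- radius ρ = 2 ^ τ, ρ about (e L) ^ L, contains fewer than K nodes, K about √n; the balls of light nodes
-- are found exactly by τ squarings of sparse distance matrices, each a truncated min-plus product
-- computable in O(1) rounds.  Since balls of heavy nodes are large, at most O(√n) disjoint ones exist,
-- and a net of O(√n) heavy nodes within distance O(ρ) of all others is found deterministically in O(1)
-- rounds by greedy choices made from lists of conflicting nodes.  Doing this at every scale 2 ^ t yields
-- a hopset: distances to the net of scale t + 1 are explored with O(e τ) hops, which jump over light
-- stretches through known balls and over heavy stretches through the net of scale t; the relative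
-- errors of the τ scales add up to O(1 / e), and the hops to O(e τ ^ 2) rounds.
-- Light nodes are treated by a Thorup-Zwick style hierarchy of L levels with radii growing by a factor
-- O(e L).  At level i, where N centers are left, each center lists up to n / N centers nearby; these
-- O(n) entries become known to all nodes, so that the choice of the next centers needs no randomness.
-- Centers with full lists are merged, which squares the ratio n / N, and the others keep their lists
-- as edges of an emulator.  Together with the distances within the net, the emulator is known to
-- everybody, and its metric is the estimate.

module Submission where

open import Defs hiding (sym; step)
import Data.Bool
open import Data.Bool using (Bool; true; false; if_then_else_; _xor_; _∧_; _∨_)
open import Data.Empty using (⊥; ⊥-elim)
open import Data.Fin as Fin using (Fin; zero; suc; toℕ; fromℕ<)
open import Data.Fin.Properties using (toℕ<n; toℕ-fromℕ<; toℕ-injective; pigeonhole; fromℕ<-injective)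
open import Data.Integer as ℤ using ()
import Data.Integer.Properties as ℤP
open import Data.List as List using (List; []; _∷_; _++_; length; concatMap; filter; take; drop)
open import Data.List.Properties using (length-map; length-++; length-tabulate; length-upTo; length-filter; take-map; take-all; concatMap-cong)
import Data.List.Membership.DecPropositional as DecMem
open import Data.List.Membership.Propositional using (_∈_; find; lose)
open import Data.List.Membership.Propositional.Properties
open import Data.List.Relation.Binary.Disjoint.Propositional using (Disjoint)
open import Data.List.Relation.Unary.All as All using ([]; _∷_)
open import Data.List.Relation.Unary.AllPairs using (AllPairs; []; _∷_)
import Data.List.Relation.Unary.AllPairs.Properties as APP
open import Data.List.Relation.Unary.Any as Any using (Any; here; there)
open import Data.List.Relation.Unary.Unique.Propositional using (Unique)
import Data.List.Relation.Unary.Unique.Propositional.Properties as UP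
open import Data.Maybe as Maybe using (Maybe; just; nothing)
open import Data.Nat
open import Data.Nat.DivMod using (_/_; _%_; m≡m%n+[m/n]*n; m%n<n; m<n*o⇒m/o<n; m/n*n≤m)
open import Data.Nat.Induction using (<-rec)
open import Data.Nat.Logarithm using (⌈log₂⌉-mono-≤; ⌈log₂⌈n/2⌉⌉≡⌈log₂n⌉∸1; ⌈log₂2^n⌉≡n)
open import Data.Nat.Properties
open import Data.Nat.Tactic.RingSolver using (solve-∀)
open import Data.Product
open import Data.Product.Properties using () renaming (≡-dec to ×-≡-dec)
open import Data.Rational as ℚ using (ℚ; 0ℚ; 1ℚ; mkℚ)
import Data.Rational.Properties as ℚP
open import Data.Rational.Solver using (module +-*-Solver)
import Data.Rational.Unnormalised as ℚᵘ
import Data.Rational.Unnormalised.Properties as ℚᵘP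
open import Data.Sum as Sum using (_⊎_; inj₁; inj₂; [_,_]′)
open import Data.Unit using (⊤; tt)
open import Data.Vec as Vec using (Vec; []; _∷_; tabulate; lookup)
open import Data.Vec.Properties using (≡-dec; lookup∘tabulate; tabulate-cong; tabulate-∘; ++-injective; take++drop≡id)
open import Function using (_∘_; id)
open import Relation.Binary.PropositionalEquality
open import Relation.Nullary
open import Relation.Nullary.Decidable using (_×-dec_)

-- Binary notation

-- Every list is cut off at a fixed length, and correctness rests on one alternative: a list below
-- its bound has lost nothing, and a full one has enough entries for a packing argument. The other
-- constraint is that a node can receive only O(`D`) entries in O(1) rounds, where `D` = 2 ^ (4 k)
-- is the number of simulated nodes. Conflict lists of 2 ^ k entries for all `D` nodes are too many,
-- so the net is chosen in two passes: inside 2 ^ k groups of D / 2 ^ k nodes each, then among the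
-- at most 2 D / 2 ^ k survivors. In the hierarchy the same budget is an invariant: the number of
-- centers times `κ i` never exceeds z D, because the centers drop by a factor of at least `κ i`
-- when `κ i` is squared. Since `κ m` exceeds `K`, nothing is popular at level m. The stretch 1 + 1
-- / e is made of two losses of 1 / (2 e). One is paid to the levels on light sections and to the
-- hopset on hub sections, never twice on the same section. The other comes from cutting the path
-- into blocks of length 160 e ρ, so that the additive error 80 ρ is paid only once.

val : ∀ {w} → Vec Bool w → ℕ
val [] = 0
val {suc w} (b ∷ v) = (if b then 2 ^ w else 0) + val v

enc : ∀ w → ℕ → Vec Bool w
enc zero m = []
enc (suc w) m with m <? 2 ^ w
... | yes _ = false ∷ enc w m
... | no _ = true ∷ enc w (m ∸ 2 ^ w)

2^suc : ∀ w → 2 ^ suc w ≡ 2 ^ w + 2 ^ w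
2^suc w = cong (2 ^ w +_) (+-identityʳ (2 ^ w))

val<2^ : ∀ {w} (v : Vec Bool w) → val v < 2 ^ w
val<2^ [] = s≤s z≤n
val<2^ {suc w} (false ∷ v) = <-≤-trans (val<2^ v) (≤-trans (m≤m+n _ _) (≤-reflexive (sym (2^suc w))))
val<2^ {suc w} (true ∷ v) = <-≤-trans (+-monoʳ-< (2 ^ w) (val<2^ v)) (≤-reflexive (sym (2^suc w)))

val-enc : ∀ w {m} → m < 2 ^ w → val (enc w m) ≡ m
val-enc zero {zero} _ = refl
val-enc zero {suc m} (s≤s ())
val-enc (suc w) {m} m< with m <? 2 ^ w
... | yes p = val-enc w p
... | no p = trans (cong (2 ^ w +_) (val-enc w (+-cancelˡ-< (2 ^ w) _ _
      (subst₂ _<_ (sym (m+[n∸m]≡n (≮⇒≥ p))) (2^suc w) m<)))) (m+[n∸m]≡n (≮⇒≥ p))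

enc-val : ∀ {w} (v : Vec Bool w) → enc w (val v) ≡ v
enc-val [] = refl
enc-val {suc w} (false ∷ v) with val v <? 2 ^ w
... | yes _ = cong (false ∷_) (enc-val v)
... | no p = ⊥-elim (p (val<2^ v))
enc-val {suc w} (true ∷ v) with 2 ^ w + val v <? 2 ^ w
... | yes p = ⊥-elim (<⇒≱ p (m≤m+n _ _))
... | no p = cong (true ∷_) (trans (cong (enc w) (m+n∸m≡n (2 ^ w) (val v))) (enc-val v))

infixl 6 _⊕_
-- Exclusive or serves as a Latin square: in `rowK` the relay between source `b` and target `c` is
-- `b ⊕ c`, and any two of the three determine the third, so that each link carries one message per
-- round.
_⊕_ : ∀ {w} → Vec Bool w → Vec Bool w → Vec Bool w
_⊕_ = Vec.zipWith _xor_

xor-cancelˡ : ∀ a b → a xor (a xor b) ≡ b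
xor-cancelˡ true true = refl
xor-cancelˡ true false = refl
xor-cancelˡ false b = refl

xor-cancelʳ : ∀ a b → (a xor b) xor b ≡ a
xor-cancelʳ true true = refl
xor-cancelʳ true false = refl
xor-cancelʳ false true = refl
xor-cancelʳ false false = refl

⊕-cancelˡ : ∀ {w} (u v : Vec Bool w) → u ⊕ (u ⊕ v) ≡ v
⊕-cancelˡ [] [] = refl
⊕-cancelˡ (a ∷ u) (b ∷ v) = cong₂ _∷_ (xor-cancelˡ a b) (⊕-cancelˡ u v)

⊕-cancelʳ : ∀ {w} (u v : Vec Bool w) → (u ⊕ v) ⊕ v ≡ u
⊕-cancelʳ [] [] = refl
⊕-cancelʳ (a ∷ u) (b ∷ v) = cong₂ _∷_ (xor-cancelʳ a b) (⊕-cancelʳ u v)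

_≟ᵇ_ : ∀ {w} (u v : Vec Bool w) → Dec (u ≡ v)
_≟ᵇ_ = ≡-dec Data.Bool._≟_

allBits : ∀ w → List (Vec Bool w)
allBits zero = [] ∷ []
allBits (suc w) = List.map (false ∷_) (allBits w) ++ List.map (true ∷_) (allBits w)

∈-allBits : ∀ {w} (v : Vec Bool w) → v ∈ allBits w
∈-allBits [] = here refl
∈-allBits (false ∷ v) = ∈-++⁺ˡ (∈-map⁺ (false ∷_) (∈-allBits v))
∈-allBits {suc w} (true ∷ v) = ∈-++⁺ʳ (List.map (false ∷_) (allBits w)) (∈-map⁺ (true ∷_) (∈-allBits v))

length-allBits : ∀ w → length (allBits w) ≡ 2 ^ w
length-allBits zero = refl
length-allBits (suc w) = trans (length-++ (List.map (false ∷_) (allBits w)))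
  (trans (cong₂ _+_ (trans (length-map _ (allBits w)) (length-allBits w)) (trans (length-map _ (allBits w)) (length-allBits w)))
  (sym (2^suc w)))

allBits-unique : ∀ w → Unique (allBits w)
allBits-unique zero = [] ∷ []
allBits-unique (suc w) = UP.++⁺ (UP.map⁺ inj (allBits-unique w)) (UP.map⁺ inj (allBits-unique w)) dis
  where
  inj : ∀ {b} {u v : Vec Bool w} → _≡_ {A = Vec Bool (suc w)} (b ∷ u) (b ∷ v) → u ≡ v
  inj refl = refl
  dis : Disjoint (List.map (false ∷_) (allBits w)) (List.map (true ∷_) (allBits w))
  dis (p , q) with ∈-map⁻ _ p | ∈-map⁻ _ q
  ... | _ , _ , refl | _ , _ , ()

-- Tables indexed by bit strings: equality of tables is propositional, unlike that of functions.

BT : ℕ → Set → Set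
BT zero X = X
BT (suc w) X = BT w X × BT w X

btab : ∀ w {X : Set} → (Vec Bool w → X) → BT w X
btab zero f = f []
btab (suc w) f = btab w (f ∘ (false ∷_)) , btab w (f ∘ (true ∷_))

blook : ∀ {w} {X : Set} → BT w X → Vec Bool w → X
blook t [] = t
blook (t , _) (false ∷ v) = blook t v
blook (_ , t) (true ∷ v) = blook t v

blook-btab : ∀ {w} {X : Set} (f : Vec Bool w → X) v → blook (btab w f) v ≡ f v
blook-btab f [] = refl
blook-btab f (false ∷ v) = blook-btab (f ∘ (false ∷_)) v
blook-btab f (true ∷ v) = blook-btab (f ∘ (true ∷_)) v

btab-cong : ∀ w {X : Set} {f g : Vec Bool w → X} → (∀ v → f v ≡ g v) → btab w f ≡ btab w g
btab-cong zero e = e []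
btab-cong (suc w) e = cong₂ _,_ (btab-cong w (e ∘ (false ∷_))) (btab-cong w (e ∘ (true ∷_)))

-- Finite sets as lists

module _ {A : Set} where

  remove-∈ : ∀ {x : A} {ys} → x ∈ ys → ∃ λ zs → length ys ≡ suc (length zs) × (∀ {y} → y ≢ x → y ∈ ys → y ∈ zs)
  remove-∈ {ys = y ∷ ys} (here refl) = ys , refl , λ { ne (here e) → ⊥-elim (ne e) ; ne (there p) → p }
  remove-∈ {ys = y ∷ ys} (there p) with remove-∈ p
  ... | zs , e , f = y ∷ zs , cong suc e , λ { ne (here e) → here e ; ne (there q) → there (f ne q) }

  unique-⊆-length : ∀ {xs ys : List A} → Unique xs → (∀ {x} → x ∈ xs → x ∈ ys) → length xs ≤ length ys
  unique-⊆-length {[]} _ _ = z≤n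
  unique-⊆-length {x ∷ xs} (x∉ ∷ u) sub with remove-∈ (sub (here refl))
  ... | zs , e , f = subst (suc (length xs) ≤_) (sym e)
        (s≤s (unique-⊆-length u (λ p → f (λ { refl → All.lookup x∉ p refl }) (sub (there p)))))

  ∈-take⁻ : ∀ K {x : A} (xs : List A) → x ∈ take K xs → x ∈ xs
  ∈-take⁻ (suc K) (y ∷ xs) (here e) = here e
  ∈-take⁻ (suc K) (y ∷ xs) (there p) = there (∈-take⁻ K xs p)

  take-full : ∀ K (xs : List A) → (length (take K xs) ≡ K) ⊎ (take K xs ≡ xs × length xs < K)
  take-full zero xs = inj₁ refl
  take-full (suc K) [] = inj₂ (refl , s≤s z≤n)
  take-full (suc K) (x ∷ xs) with take-full K xs
  ... | inj₁ e = inj₁ (cong suc e)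
  ... | inj₂ (e , l) = inj₂ (cong (x ∷_) e , s≤s l)

  length-take≤ : ∀ K (xs : List A) → length (take K xs) ≤ K
  length-take≤ zero xs = z≤n
  length-take≤ (suc K) [] = z≤n
  length-take≤ (suc K) (x ∷ xs) = s≤s (length-take≤ K xs)

module _ {A B : Set} where

  length-concatMap≤ : ∀ (f : A → List B) {k} xs → (∀ {x} → x ∈ xs → length (f x) ≤ k) → length (concatMap f xs) ≤ length xs * k
  length-concatMap≤ f [] h = z≤n
  length-concatMap≤ f (x ∷ xs) h = ≤-trans (≤-reflexive (length-++ (f x)))
    (+-mono-≤ (h (here refl)) (length-concatMap≤ f xs (h ∘ there)))

  length-concatMap≥ : ∀ (f : A → List B) {k} xs → (∀ {x} → x ∈ xs → k ≤ length (f x)) → length xs * k ≤ length (concatMap f xs)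
  length-concatMap≥ f [] h = z≤n
  length-concatMap≥ f (x ∷ xs) h = ≤-trans
    (+-mono-≤ (h (here refl)) (length-concatMap≥ f xs (h ∘ there))) (≤-reflexive (sym (length-++ (f x))))

  ∈-cM⁺ : ∀ (f : A → List B) xs {x y} → x ∈ xs → y ∈ f x → y ∈ concatMap f xs
  ∈-cM⁺ f xs x∈ y∈ = ∈-concat⁺′ y∈ (∈-map⁺ f x∈)

  ∈-cM⁻ : ∀ (f : A → List B) xs {y} → y ∈ concatMap f xs → ∃ λ x → x ∈ xs × y ∈ f x
  ∈-cM⁻ f xs p with ∈-concat⁻′ (List.map f xs) p
  ... | ys , y∈ , ys∈ with ∈-map⁻ f ys∈
  ... | x , x∈ , refl = x , x∈ , y∈

  -- This packing bound is behind the size estimates for the nets and for the centers of every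
  -- level.
  disjoint-count : ∀ (f : A → List B) {k} {xs : List A} {U : List B} →
    AllPairs (λ x y → Disjoint (f x) (f y)) xs → (∀ {x} → x ∈ xs → Unique (f x)) →
    (∀ {x} → x ∈ xs → k ≤ length (f x)) → (∀ {x y} → x ∈ xs → y ∈ f x → y ∈ U) →
    length xs * k ≤ length U
  disjoint-count f {k} {xs} dis uf kf sub =
    ≤-trans (length-concatMap≥ f xs kf) (unique-⊆-length (uq dis uf) λ p → let (x , x∈ , y∈) = ∈-cM⁻ f xs p in sub x∈ y∈)
    where
    uq : ∀ {xs} → AllPairs (λ x y → Disjoint (f x) (f y)) xs → (∀ {x} → x ∈ xs → Unique (f x)) → Unique (concatMap f xs)
    uq [] h = []
    uq {_ ∷ xs} (d ∷ ds) h = UP.++⁺ (h (here refl)) (uq ds (h ∘ there))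
      (λ (p , q) → let (y , y∈ , z∈) = ∈-cM⁻ f xs q in All.lookup d y∈ (p , z∈))

-- Greedy maximal families of pairwise disjoint sets

module Greedy {A B : Set} (_≟_ : (x y : B) → Dec (x ≡ y)) (f : A → List B) where

  meets? : ∀ x y → Dec (∃ λ z → z ∈ f x × z ∈ f y)
  meets? x y with Any.any? (λ z → Any.any? (z ≟_) (f y)) (f x)
  ... | yes p = let (z , z∈ , q) = find p in yes (z , z∈ , q)
  ... | no p = no λ (z , z∈ , q) → p (lose z∈ q)

  hit? : ∀ x ys → Dec (Any (λ y → ∃ λ z → z ∈ f x × z ∈ f y) ys)
  hit? x ys = Any.any? (meets? x) ys

  greedy : List A → List A
  greedy [] = []
  greedy (x ∷ xs) with hit? x (greedy xs)
  ... | yes _ = greedy xs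
  ... | no _ = x ∷ greedy xs

  greedy⊆ : ∀ xs {x} → x ∈ greedy xs → x ∈ xs
  greedy⊆ (y ∷ xs) p with hit? y (greedy xs)
  greedy⊆ (y ∷ xs) p | yes _ = there (greedy⊆ xs p)
  greedy⊆ (y ∷ xs) (here e) | no _ = here e
  greedy⊆ (y ∷ xs) (there p) | no _ = there (greedy⊆ xs p)

  greedy-disjoint : ∀ xs → AllPairs (λ x y → Disjoint (f x) (f y)) (greedy xs)
  greedy-disjoint [] = []
  greedy-disjoint (x ∷ xs) with hit? x (greedy xs)
  ... | yes _ = greedy-disjoint xs
  ... | no p = All.tabulate (λ y∈ (a , b) → p (lose y∈ (_ , a , b))) ∷ greedy-disjoint xs

  greedy-maximal : ∀ xs {x z} → x ∈ xs → z ∈ f x → ∃ λ y → y ∈ greedy xs × ∃ λ z → z ∈ f x × z ∈ f y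
  greedy-maximal (y ∷ xs) p z∈ with hit? y (greedy xs)
  greedy-maximal (y ∷ xs) (here refl) z∈ | yes h = find h
  greedy-maximal (y ∷ xs) (there p) z∈ | yes h = greedy-maximal xs p z∈
  greedy-maximal (y ∷ xs) (here refl) z∈ | no h = y , here refl , _ , z∈ , z∈
  greedy-maximal (y ∷ xs) (there p) z∈ | no h = let (a , b , c) = greedy-maximal xs p z∈ in a , there b , c

AllPairs-filter : ∀ {A : Set} {R : A → A → Set} {P : A → Set} (P? : ∀ x → Dec (P x)) {xs} → AllPairs R xs → AllPairs R (filter P? xs)
AllPairs-filter P? = APP.filter⁺ P?

length-filter-split : ∀ {A : Set} {P : A → Set} (P? : ∀ x → Dec (P x)) xs →
  length xs ≡ length (filter P? xs) + length (filter (¬? ∘ P?) xs)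
length-filter-split P? [] = refl
length-filter-split P? (x ∷ xs) with P? x
... | yes _ = cong suc (length-filter-split P? xs)
... | no _ = trans (cong suc (length-filter-split P? xs)) (sym (+-suc _ _))

minL : List ℕ → Maybe ℕ
minL [] = nothing
minL (x ∷ xs) with minL xs
... | nothing = just x
... | just m = just (x ⊓ m)

minL-∈ : ∀ xs {m} → minL xs ≡ just m → m ∈ xs
minL-∈ (x ∷ xs) e with minL xs in eq
minL-∈ (x ∷ xs) refl | nothing = here refl
minL-∈ (x ∷ xs) refl | just m with ≤-total x m
... | inj₁ p = here (m≤n⇒m⊓n≡m p)
... | inj₂ p = there (subst (_∈ xs) (sym (m≥n⇒m⊓n≡n p)) (minL-∈ xs eq))

minL-≤ : ∀ {x} xs → x ∈ xs → ∃ λ m → minL xs ≡ just m × m ≤ x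
minL-≤ (y ∷ xs) p with minL xs in eq
minL-≤ (y ∷ xs) (here refl) | nothing = y , refl , ≤-refl
minL-≤ (y ∷ xs) (here refl) | just m = y ⊓ m , refl , m⊓n≤m y m
minL-≤ (y ∷ xs) (there p) | nothing with minL-≤ xs p
... | _ , e , _ = ⊥-elim (case e)
  where case : minL xs ≡ just _ → ⊥
        case e' with trans (sym eq) e'
        ... | ()
minL-≤ (y ∷ xs) (there p) | just m with minL-≤ xs p
... | m' , e , l with trans (sym eq) e
... | refl = y ⊓ m , refl , ≤-trans (m⊓n≤n y m) l

-- Encoding of messages as bit strings

record Codec (w : ℕ) (X : Set) : Set where
  field
    encode : X → Vec Bool w
    decode : Vec Bool w → X
    decode-encode : ∀ x → decode (encode x) ≡ x
open Codec

bitsC : ∀ w → Codec w (Vec Bool w)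
bitsC w = record { encode = id ; decode = id ; decode-encode = λ _ → refl }

pairC : ∀ {v w X Y} → Codec v X → Codec w Y → Codec (v + w) (X × Y)
pairC {v} c d .encode (x , y) = encode c x Vec.++ encode d y
pairC {v} c d .decode u = decode c (Vec.take v u) , decode d (Vec.drop v u)
pairC {v} {w} c d .decode-encode (x , y) = cong₂ _,_
  (trans (cong (decode c) (take-++ v _ _)) (decode-encode c x))
  (trans (cong (decode d) (drop-++ v _ _)) (decode-encode d y))
  where
  take-++ : ∀ {A : Set} m {k} (xs : Vec A m) (ys : Vec A k) → Vec.take m (xs Vec.++ ys) ≡ xs
  take-++ zero [] ys = refl
  take-++ (suc m) (x ∷ xs) ys = cong (x ∷_) (take-++ m xs ys)
  drop-++ : ∀ {A : Set} m {k} (xs : Vec A m) (ys : Vec A k) → Vec.drop m (xs Vec.++ ys) ≡ ys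
  drop-++ zero [] ys = refl
  drop-++ (suc m) (x ∷ xs) ys = drop-++ m xs ys

maybeC : ∀ {w X} → X → Codec w X → Codec (suc w) (Maybe X)
maybeC x₀ c .encode nothing = false ∷ encode c x₀
maybeC x₀ c .encode (just x) = true ∷ encode c x
maybeC x₀ c .decode (b ∷ u) = if b then just (decode c u) else nothing
maybeC x₀ c .decode-encode nothing = refl
maybeC x₀ c .decode-encode (just x) = cong just (decode-encode c x)

vecC : ∀ {w X} m → Codec w X → Codec (m * w) (Vec X m)
vecC zero c .encode [] = []
vecC zero c .decode _ = []
vecC zero c .decode-encode [] = refl
vecC (suc m) c .encode (x ∷ xs) = encode (pairC c (vecC m c)) (x , xs)
vecC (suc m) c .decode u = let (x , xs) = decode (pairC c (vecC m c)) u in x ∷ xs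
vecC (suc m) c .decode-encode (x ∷ xs) = cong (λ (y , ys) → y ∷ ys) (decode-encode (pairC c (vecC m c)) (x , xs))

finC : ∀ w {D} → D < 2 ^ w → Codec w (Fin (suc D))
finC w D< .encode i = enc w (toℕ i)
finC w {D} D< .decode u with val u <? suc D
... | yes p = fromℕ< p
... | no _ = zero
finC w {D} D< .decode-encode i with val (enc w (toℕ i)) <? suc D
... | yes p = toℕ-injective (trans (toℕ-fromℕ< p) (val-enc w (≤-trans (toℕ<n i) D<)))
... | no p = ⊥-elim (p (subst (_< suc D) (sym (val-enc w (≤-trans (toℕ<n i) D<))) (toℕ<n i)))

padC : ∀ {v w X} → v ≤ w → Codec v X → Codec w X
padC {v} {w} v≤w c = subst (λ w → Codec w _) (m+[n∸m]≡n v≤w)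
  (record { encode = λ x → encode (pairC c unitC) (x , Vec.replicate _ false)
          ; decode = λ u → proj₁ (decode (pairC c unitC) u)
          ; decode-encode = λ x → cong proj₁ (decode-encode (pairC c unitC) (x , Vec.replicate _ false)) })
  where
  unitC = bitsC (w ∸ v)

-- Algorithms on the real clique and their composition

module Real (n B : ℕ) where

  -- Adjacency rows and received messages are vectors here, so that equality of two executions
  -- follows from `tabulate-cong` without function extensionality. `toCC` returns to functions at
  -- the very end.
  record Machine (Y : Set) : Set₁ where
    field
      St : Set
      ini : Fin n → Vec Bool n → St
      snd : St → Fin n → Vec Bool B
      upd : St → Vec (Vec Bool B) n → St
      out : St → Y
    st : Graph n → ℕ → Fin n → St
    st G zero v = ini v (tabulate (adj G v))
    st G (suc t) v = upd (st G t v) (tabulate (λ u → snd (st G t u) v))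
  open Machine

  -- After T rounds vertex v knows F G v.
  record RAlg (T : ℕ) {Y : Set} (F : Graph n → Fin n → Y) : Set₁ where
    field
      machine : Machine Y
      correct : ∀ G v → out machine (st machine G T v) ≡ F G v
  open RAlg

  initR : RAlg 0 (λ G v → v , tabulate (adj G v))
  initR = record
    { machine = record { St = Fin n × Vec Bool n ; ini = _,_ ; snd = λ _ _ → Vec.replicate _ false
                       ; upd = λ s _ → s ; out = id }
    ; correct = λ _ _ → refl }

  mapR : ∀ {T Y Z} {F : Graph n → Fin n → Y} (g : Y → Z) → RAlg T F → RAlg T (λ G v → g (F G v))
  mapR {T} g A = record
    { machine = M'
    ; correct = λ G v → cong g (trans (cong (out M) (same G T v)) (correct A G v)) }
    where
    M = machine A
    M' : Machine _
    M' = record { St = St M ; ini = ini M ; snd = snd M ; upd = upd M ; out = g ∘ out M }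
    same : ∀ G t v → st M' G t v ≡ st M G t v
    same G zero v = refl
    same G (suc t) v = cong₂ (upd M) (same G t v) (tabulate-cong λ u → cong (λ s → snd M s v) (same G t u))

  eqR : ∀ {T Y} {F F' : Graph n → Fin n → Y} → (∀ G v → F G v ≡ F' G v) → RAlg T F → RAlg T F'
  eqR e A = record { machine = machine A ; correct = λ G v → trans (correct A G v) (e G v) }

  -- The new state carries a countdown from `T`. All vertices therefore leave the given algorithm in
  -- the same round, and the extra message is computed from its final output.
  commR : ∀ {T Y X} {F : Graph n → Fin n → Y} (c : Codec B X) (m : Y → Fin n → X) →
          RAlg T F → RAlg (suc T) (λ G v → F G v , tabulate (λ u → m (F G u) v))
  commR {T} {Y} {X} {F} c m A = record { machine = M' ; correct = λ G v → cong out' (end G v) }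
    where
    M = machine A
    St' : Set
    St' = (ℕ × St M) ⊎ (Y × Vec X n)
    snd' : St' → Fin n → Vec Bool B
    snd' (inj₁ (suc _ , s)) w = snd M s w
    snd' (inj₁ (zero , s)) w = encode c (m (out M s) w)
    snd' (inj₂ _) w = Vec.replicate _ false
    upd' : St' → Vec (Vec Bool B) n → St'
    upd' (inj₁ (suc k , s)) r = inj₁ (k , upd M s r)
    upd' (inj₁ (zero , s)) r = inj₂ (out M s , Vec.map (decode c) r)
    upd' (inj₂ s) r = inj₂ s
    -- the first case never occurs after T + 1 rounds
    out' : St' → Y × Vec X n
    out' (inj₁ (_ , s)) = out M s , tabulate (m (out M s))
    out' (inj₂ p) = p
    M' : Machine (Y × Vec X n)
    M' = record { St = St' ; ini = λ v r → inj₁ (T , ini M v r) ; snd = snd' ; upd = upd' ; out = out' }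
    before : ∀ G t k → k + t ≡ T → ∀ v → st M' G t v ≡ inj₁ (k , st M G t v)
    before G zero k e v = cong (λ k → inj₁ (k , _)) (trans (sym e) (+-identityʳ k))
    before G (suc t) k e v = cong₂ upd' (ih v) (tabulate-cong λ u → cong (λ s → snd' s v) (ih u))
      where ih = before G t (suc k) (trans (sym (+-suc k t)) e)
    end : ∀ G v → st M' G (suc T) v ≡ inj₂ (F G v , tabulate (λ u → m (F G u) v))
    end G v = trans
      (cong₂ upd' (before G T 0 refl v) (tabulate-cong λ u → cong (λ s → snd' s v) (before G T 0 refl u)))
      (cong inj₂ (cong₂ _,_ (correct A G v) (trans (sym (tabulate-∘ (decode c) _))
        (tabulate-cong λ u → trans (decode-encode c _) (cong (λ y → m y v) (correct A G u))))))

  toCC : ∀ {T} {F : Graph n → Fin n → Vec (Maybe ℕ) n} → RAlg T F →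
         Σ (CCAlgorithm n B) λ C → ∀ G u v → estimate C T G u v ≡ lookup (F G u) v
  toCC {T} A = C , λ G u v → cong (λ r → lookup r v) (trans (cong (out M) (same G T u)) (correct A G u))
    where
    M = machine A
    C : CCAlgorithm n B
    C = record { State = St M ; init = λ v r → ini M v (tabulate r) ; send = snd M
               ; update = λ s r → upd M s (tabulate r) ; output = λ s → lookup (out M s) }
    same : ∀ G t v → stateAfter C G t v ≡ st M G t v
    same G zero v = refl
    same G (suc t) v = cong₂ (upd M) (same G t v) (tabulate-cong λ u → cong (λ s → snd M s v) (same G t u))

-- The clique is simulated on 2 ^ (4 k) virtual nodes, named by pairs of bit strings; rows, columns
-- and groups of nodes then have sizes that are exact powers of two.

module Virt (k z : ℕ) where

  h : ℕ
  h = k + k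

  S N Wt It Msg : Set
  D : ℕ
  S = Vec Bool h
  N = S × S
  D = 2 ^ (h + h)
  Wt = Fin (suc D)
  It = N × Wt
  Msg = Vec (Maybe It) z

  _≟N_ : (a b : N) → Dec (a ≡ b)
  _≟N_ = ×-≡-dec _≟ᵇ_ _≟ᵇ_

  Tab : Set → Set
  Tab X = BT h (BT h X)

  infixl 9 _!_

  opaque
    tab : ∀ {X} → (N → X) → Tab X
    tab f = btab h λ a → btab h λ b → f (a , b)

    _!_ : ∀ {X} → Tab X → N → X
    t ! (a , b) = blook (blook t a) b

    tab-! : ∀ {X} (f : N → X) a → tab f ! a ≡ f a
    tab-! f (a , b) = trans (cong (λ t → blook t b) (blook-btab _ a)) (blook-btab _ b)

    tab-cong : ∀ {X} {f g : N → X} → (∀ a → f a ≡ g a) → tab f ≡ tab g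
    tab-cong e = btab-cong h λ a → btab-cong h λ b → e (a , b)

  idx : N → ℕ
  idx (a , b) = val (a Vec.++ b)

  node : ℕ → N
  node m = Vec.take h (enc (h + h) m) , Vec.drop h (enc (h + h) m)

  idx<D : ∀ a → idx a < D
  idx<D (a , b) = val<2^ (a Vec.++ b)

  idx-node : ∀ {m} → m < D → idx (node m) ≡ m
  idx-node {m} m< = trans (cong val (take++drop≡id h (enc (h + h) m))) (val-enc (h + h) m<)

  node-idx : ∀ a → node (idx a) ≡ a
  node-idx (a , b) = cong₂ _,_ (proj₁ eq) (proj₂ eq)
    where
    eq : Vec.take h (enc (h + h) (val (a Vec.++ b))) ≡ a × Vec.drop h (enc (h + h) (val (a Vec.++ b))) ≡ b
    eq = ++-injective _ _ (trans (take++drop≡id h _) (enc-val (a Vec.++ b)))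

  msgWidth : ℕ
  msgWidth = z * suc ((h + h) + suc (h + h))

  msgC : Codec msgWidth Msg
  msgC = vecC z (maybeC (node 0 , zero) (pairC nodeC (finC (suc (h + h)) D<)))
    where
    open Codec
    D< : D < 2 ^ suc (h + h)
    D< = ≤-trans (+-monoˡ-≤ D (m^n>0 2 (h + h))) (≤-reflexive (sym (2^suc (h + h))))
    nodeC : Codec (h + h) N
    nodeC = pairC (bitsC h) (bitsC h)

-- Simulation of the virtual clique by the real one

module Sim (n k z B c : ℕ) .{{_ : NonZero n}} (n≤D : n ≤ Virt.D k z) (D≤ : Virt.D k z ≤ suc c * n)
           (fits : suc c * (suc c * Virt.msgWidth k z) ≤ B) where

  open Virt k z
  open Real n B

  private
    -- One real message bundles the messages between all pairs of virtual nodes hosted at its two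
    -- ends.
    W = Vec (Vec Msg (suc c)) (suc c)

    wC : Codec B W
    wC = padC fits (vecC (suc c) (vecC (suc c) msgC))

  host : N → Fin n
  host a = fromℕ< (m%n<n (idx a) n)

  slot : N → Fin (suc c)
  slot a = fromℕ< (m<n*o⇒m/o<n {idx a} {suc c} {n} (<-≤-trans (idx<D a) D≤))

  virt : Fin n → Fin (suc c) → N
  virt v κ with toℕ κ * n + toℕ v <? D
  ... | yes _ = node (toℕ κ * n + toℕ v)
  -- A surplus slot repeats the first node of its host. `host` and `slot` never point to it, so
  -- nothing is read from it.
  ... | no _ = node (toℕ v)

  index-eq : ∀ a → toℕ (slot a) * n + toℕ (host a) ≡ idx a
  index-eq a = begin
    toℕ (slot a) * n + toℕ (host a) ≡⟨ cong (λ x → x * n + toℕ (host a)) (toℕ-fromℕ< (m<n*o⇒m/o<n {idx a} {suc c} {n} (<-≤-trans (idx<D a) D≤))) ⟩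
    idx a / n * n + toℕ (host a)    ≡⟨ cong (λ y → idx a / n * n + y) (toℕ-fromℕ< (m%n<n (idx a) n)) ⟩
    idx a / n * n + idx a % n       ≡⟨ +-comm (idx a / n * n) (idx a % n) ⟩
    idx a % n + idx a / n * n       ≡⟨ sym (m≡m%n+[m/n]*n (idx a) n) ⟩
    idx a                           ∎
    where open ≡-Reasoning

  virt-host : ∀ a → virt (host a) (slot a) ≡ a
  virt-host a with toℕ (slot a) * n + toℕ (host a) <? D
  ... | yes _ = trans (cong node (index-eq a)) (node-idx a)
  ... | no p = ⊥-elim (p (subst (_< D) (sym (index-eq a)) (idx<D a)))

  emb : Fin n → N
  emb v = node (toℕ v)

  virt-zero : ∀ v → virt v zero ≡ emb v
  virt-zero v with toℕ v <? D
  ... | yes _ = refl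
  ... | no _ = refl

  idx-emb : ∀ v → idx (emb v) ≡ toℕ v
  idx-emb v = idx-node (<-≤-trans (toℕ<n v) n≤D)

  -- A virtual node that stands for a vertex of the graph is hosted by that very vertex, hence its
  -- adjacency row is available before any communication.
  idx-virt : ∀ v κ → idx (virt v κ) < n → idx (virt v κ) ≡ toℕ v
  idx-virt v κ p with toℕ κ * n + toℕ v <? D
  idx-virt v zero p | yes q = idx-node q
  idx-virt v (suc κ) p | yes q = ⊥-elim (<⇒≱ (subst (_< n) (idx-node q) p)
    (≤-trans (m≤m+n n (toℕ κ * n)) (m≤m+n _ (toℕ v))))
  idx-virt v κ p | no q = idx-emb v

  Adj : Graph n → N → N → Bool
  Adj G a b with idx a <? n | idx b <? n
  ... | yes p | yes q = adj G (fromℕ< p) (fromℕ< q)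
  ... | _ | _ = false

  -- The function `f` is a specification that mentions no rounds. Statements about distances are
  -- proved for `f` alone, while the index `T` keeps the count.
  record Know (T : ℕ) {X : Set} (f : (N → N → Bool) → N → X) : Set₁ where
    constructor know
    field
      alg : RAlg T (λ G v → v , tabulate (λ κ → f (Adj G) (virt v κ)))
  open Know

  initK : Know 0 (λ A a → tab (A a))
  initK = know (eqR (λ G v → cong (v ,_) (tabulate-cong λ κ → tab-cong λ b → lemma G v (virt v κ) b (idx-virt v κ)))
    (mapR (λ (v , r) → v , tabulate (λ κ → tab (rowA r (virt v κ)))) initR))
    where
    rowA : Vec Bool n → N → N → Bool
    rowA r a b with idx a <? n | idx b <? n
    ... | yes p | yes q = lookup r (fromℕ< q)
    ... | _ | _ = false
    lemma : ∀ G v a b → (idx a < n → idx a ≡ toℕ v) → rowA (tabulate (adj G v)) a b ≡ Adj G a b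
    lemma G v a b e with idx a <? n | idx b <? n
    ... | yes p | yes q = trans (lookup∘tabulate _ (fromℕ< q))
          (cong (λ u → adj G u (fromℕ< q)) (toℕ-injective (trans (sym (e p)) (sym (toℕ-fromℕ< p)))))
    ... | yes p | no _ = refl
    ... | no _ | _ = refl

  mapK : ∀ {T X Y} {f : (N → N → Bool) → N → X} (g : N → X → Y) → Know T f → Know T (λ A a → g a (f A a))
  mapK {X = X} {Y} {f} g K = know (eqR eq (mapR gs (alg K)))
    where
    gs : Fin n × Vec X (suc c) → Fin n × Vec Y (suc c)
    gs (v , xs) = v , tabulate (λ κ → g (virt v κ) (lookup xs κ))
    eq : ∀ G v → gs (v , tabulate (λ κ → f (Adj G) (virt v κ))) ≡ (v , tabulate (λ κ → g (virt v κ) (f (Adj G) (virt v κ))))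
    eq G v = cong (v ,_) (tabulate-cong λ κ → cong (g (virt v κ)) (lookup∘tabulate (λ κ → f (Adj G) (virt v κ)) κ))

  eqK : ∀ {T X} {f f' : (N → N → Bool) → N → X} → (∀ A a → f A a ≡ f' A a) → Know T f → Know T f'
  eqK e K = know (eqR (λ G v → cong (v ,_) (tabulate-cong λ κ → e (Adj G) (virt v κ))) (alg K))

  commK : ∀ {T X} {f : (N → N → Bool) → N → X} (m : N → X → N → Msg) → Know T f →
          Know (suc T) (λ A a → f A a , tab (λ b → m b (f A b) a))
  commK {X = X} {f} m K = know (eqR eq (mapR collect (commR wC msg (alg K))))
    where
    msg : Fin n × Vec X (suc c) → Fin n → W
    msg (v , xs) w = tabulate λ κ → tabulate λ κ' → m (virt v κ) (lookup xs κ) (virt w κ')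
    collect : (Fin n × Vec X (suc c)) × Vec W n → Fin n × Vec (X × Tab Msg) (suc c)
    collect ((v , xs) , r) = v , tabulate λ κ → lookup xs κ ,
      tab (λ b → lookup (lookup (lookup r (host b)) (slot b)) κ)
    F : Graph n → Fin n → Fin n × Vec X (suc c)
    F G v = v , tabulate (λ κ → f (Adj G) (virt v κ))
    eq-msg : ∀ G v κ b → lookup (lookup (lookup (tabulate (λ u → msg (F G u) v)) (host b)) (slot b)) κ ≡ m b (f (Adj G) b) (virt v κ)
    eq-msg G v κ b = begin
      lookup (lookup (lookup (tabulate (λ u → msg (F G u) v)) (host b)) (slot b)) κ
        ≡⟨ cong (λ r → lookup (lookup r (slot b)) κ) (lookup∘tabulate (λ u → msg (F G u) v) (host b)) ⟩
      lookup (lookup (msg (F G (host b)) v) (slot b)) κ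
        ≡⟨ cong (λ r → lookup r κ) (lookup∘tabulate (λ κ₁ → tabulate λ κ' → m (virt (host b) κ₁) (lookup (proj₂ (F G (host b))) κ₁) (virt v κ')) (slot b)) ⟩
      lookup (tabulate λ κ' → m (virt (host b) (slot b)) (lookup (proj₂ (F G (host b))) (slot b)) (virt v κ')) κ
        ≡⟨ lookup∘tabulate (λ κ' → m (virt (host b) (slot b)) (lookup (proj₂ (F G (host b))) (slot b)) (virt v κ')) κ ⟩
      m (virt (host b) (slot b)) (lookup (proj₂ (F G (host b))) (slot b)) (virt v κ)
        ≡⟨ cong (λ x → m (virt (host b) (slot b)) x (virt v κ)) (lookup∘tabulate (λ κ → f (Adj G) (virt (host b) κ)) (slot b)) ⟩
      m (virt (host b) (slot b)) (f (Adj G) (virt (host b) (slot b))) (virt v κ)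
        ≡⟨ cong (λ b → m b (f (Adj G) b) (virt v κ)) (virt-host b) ⟩
      m b (f (Adj G) b) (virt v κ) ∎
      where open ≡-Reasoning
    eq : ∀ G v → collect (F G v , tabulate (λ u → msg (F G u) v))
         ≡ (v , tabulate (λ κ → f (Adj G) (virt v κ) , tab (λ b → m b (f (Adj G) b) (virt v κ))))
    eq G v = cong (v ,_) (tabulate-cong λ κ →
      cong₂ _,_ (lookup∘tabulate (λ κ → f (Adj G) (virt v κ)) κ) (tab-cong (eq-msg G v κ)))

  finish : ∀ {T} {f : (N → N → Bool) → N → Tab (Maybe ℕ)} → Know T f →
           Σ (CCAlgorithm n B) λ C → ∀ G u v → estimate C T G u v ≡ f (Adj G) (emb u) ! emb v
  finish {T} {f} K = let (C , e) = toCC (mapR (λ (v , xs) → tabulate (λ u → lookup xs zero ! emb u)) (alg K)) in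
    C , λ G u v → trans (e G u v) (trans (lookup∘tabulate _ v)
      (cong (λ a → f (Adj G) a ! emb v) (virt-zero u)))

-- Truncated lists and their min-plus product

take-take : ∀ {A : Set} m (l : List A) → take m (take m l) ≡ take m l
take-take zero l = refl
take-take (suc m) [] = refl
take-take (suc m) (x ∷ l) = cong (x ∷_) (take-take m l)

module Sparse (k z : ℕ) where

  open Virt k z public

  -- The length of a list that fits into 2 ^ h messages of `z` entries: through `rowK` a node sends
  -- a separate list of this length to every node of its row in two rounds.
  K : ℕ
  K = z * 2 ^ h

  allN : List N
  allN = List.cartesianProduct (allBits h) (allBits h)

  ∈-allN : ∀ a → a ∈ allN
  ∈-allN (a , b) = ∈-cartesianProduct⁺ (∈-allBits a) (∈-allBits b)

  allN-unique : Unique allN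
  allN-unique = UP.cartesianProduct⁺ (allBits-unique h) (allBits-unique h)

  length-allN : length allN ≡ 2 ^ h * 2 ^ h
  length-allN = trans (go (allBits h)) (cong (_* 2 ^ h) (length-allBits h))
    where
    go : ∀ (xs : List S) → length (List.cartesianProduct xs (allBits h)) ≡ length xs * 2 ^ h
    go [] = refl
    go (x ∷ xs) = trans (length-++ (List.map (x ,_) (allBits h)))
      (cong₂ _+_ (trans (length-map _ (allBits h)) (length-allBits h)) (go xs))

  opaque
    -- Weights are clamped at `D` to fit into O(log n) bits. Distances stay below the clamp, and by
    -- `ok-clamp` a clamped weight is still an upper bound of the distance.
    mkW : ℕ → Wt
    mkW m = fromℕ< (s≤s (m⊓n≤n m D))

    toℕ-mkW : ∀ m → toℕ (mkW m) ≡ m ⊓ D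
    toℕ-mkW m = toℕ-fromℕ< _

    mkW≤ : ∀ m → toℕ (mkW m) ≤ m
    mkW≤ m = ≤-trans (≤-reflexive (toℕ-mkW m)) (m⊓n≤m m D)

    mkW-toℕ : ∀ w → mkW (toℕ w) ≡ w
    mkW-toℕ w = toℕ-injective (trans (toℕ-mkW _) (m≤n⇒m⊓n≡m (≤-pred (toℕ<n w))))

  keys : List It → List N
  keys = List.map proj₁

  UK : List It → Set
  UK l = Unique (keys l)

  ∈-keys : ∀ {c w} {l : List It} → (c , w) ∈ l → c ∈ keys l
  ∈-keys p = ∈-map⁺ proj₁ p

  ∈-keys⁻ : ∀ {c} {l : List It} → c ∈ keys l → ∃ λ w → (c , w) ∈ l
  ∈-keys⁻ p with ∈-map⁻ proj₁ p
  ... | (c , w) , q , refl = w , q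

  UK-length : ∀ {l l'} → UK l → (∀ {c w} → (c , w) ∈ l → ∃ λ w' → (c , w') ∈ l') → length l ≤ length l'
  UK-length {l} {l'} u sub = subst₂ _≤_ (length-map proj₁ l) (length-map proj₁ l')
    (unique-⊆-length u λ p → let (w , q) = ∈-keys⁻ p ; (w' , r) = sub q in ∈-keys r)

  UK-take : ∀ m {l} → UK l → UK (take m l)
  UK-take m {l} u = subst Unique (take-map m l) (UP.take⁺ m u)

  UK-filter : ∀ {P : It → Set} (P? : ∀ i → Dec (P i)) {l} → UK l → UK (filter P? l)
  UK-filter P? {[]} u = []
  UK-filter P? {i ∷ l} (p ∷ u) with P? i
  ... | yes _ = All.tabulate (λ c∈ e → let (w , q) = ∈-keys⁻ c∈ in
                  All.lookup p (∈-keys (proj₁ (∈-filter⁻ P? q))) e) ∷ UK-filter P? u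
  ... | no _ = UK-filter P? u

  weights : N → List It → List ℕ
  weights c [] = []
  weights c ((c' , w) ∷ l) with c ≟N c'
  ... | yes _ = toℕ w ∷ weights c l
  ... | no _ = weights c l

  ∈-weights⁺ : ∀ {c w l} → (c , w) ∈ l → toℕ w ∈ weights c l
  ∈-weights⁺ {c} {w} {(c' , w') ∷ l} p with c ≟N c'
  ∈-weights⁺ (here refl) | yes _ = here refl
  ∈-weights⁺ (there p) | yes _ = there (∈-weights⁺ p)
  ∈-weights⁺ (here refl) | no ne = ⊥-elim (ne refl)
  ∈-weights⁺ (there p) | no _ = ∈-weights⁺ p

  ∈-weights⁻ : ∀ {c m} l → m ∈ weights c l → ∃ λ w → toℕ w ≡ m × (c , w) ∈ l
  ∈-weights⁻ {c} ((c' , w') ∷ l) p with c ≟N c'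
  ∈-weights⁻ ((c' , w') ∷ l) (here refl) | yes refl = w' , refl , here refl
  ∈-weights⁻ ((c' , w') ∷ l) (there p) | yes refl = let (w , e , q) = ∈-weights⁻ l p in w , e , there q
  ∈-weights⁻ ((c' , w') ∷ l) p | no _ = let (w , e , q) = ∈-weights⁻ l p in w , e , there q

  least : N → List It → Maybe ℕ
  least c l = minL (weights c l)

  entry : N → Maybe ℕ → List It
  entry c nothing = []
  entry c (just m) = (c , mkW m) ∷ []

  normOn : List N → List It → List It
  normOn [] l = []
  normOn (c ∷ cs) l = entry c (least c l) ++ normOn cs l

  norm : List It → List It
  norm = normOn allN

  entry-∈ : ∀ {c c' w} l → (c' , w) ∈ entry c (least c l) → c' ≡ c × (c' , w) ∈ l
  entry-∈ {c} l p with least c l in eq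
  entry-∈ {c} l (here refl) | just m with ∈-weights⁻ l (minL-∈ (weights c l) eq)
  ... | w , refl , q = refl , subst (λ w → (c , w) ∈ l) (sym (mkW-toℕ w)) q

  normOn-∈ : ∀ cs {c w} l → (c , w) ∈ normOn cs l → c ∈ cs × (c , w) ∈ l
  normOn-∈ (c' ∷ cs) l p with ∈-++⁻ (entry c' (least c' l)) p
  ... | inj₁ q = let (e , r) = entry-∈ l q in here e , r
  ... | inj₂ q = let (a , b) = normOn-∈ cs l q in there a , b

  norm-∈ : ∀ {c w} l → (c , w) ∈ norm l → (c , w) ∈ l
  norm-∈ l p = proj₂ (normOn-∈ allN l p)

  normOn-≤ : ∀ {cs c w} l → c ∈ cs → (c , w) ∈ l → ∃ λ w' → (c , w') ∈ normOn cs l × toℕ w' ≤ toℕ w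
  normOn-≤ {c' ∷ cs} {c} l (here refl) p with least c l | minL-≤ (weights c l) (∈-weights⁺ p)
  ... | _ | m , refl , le = mkW m , here refl , ≤-trans (mkW≤ m) le
  normOn-≤ {c' ∷ cs} {c} l (there c∈) p = let (w' , q , le) = normOn-≤ l c∈ p in w' , ∈-++⁺ʳ (entry c' (least c' l)) q , le

  norm-≤ : ∀ {c w} l → (c , w) ∈ l → ∃ λ w' → (c , w') ∈ norm l × toℕ w' ≤ toℕ w
  norm-≤ {c} l p = normOn-≤ l (∈-allN c) p

  normOn-UK : ∀ {cs} l → Unique cs → UK (normOn cs l)
  normOn-UK {[]} l u = []
  normOn-UK {c ∷ cs} l (c∉ ∷ u) with least c l
  ... | nothing = normOn-UK l u
  ... | just m = All.tabulate (λ p e → let (w , q) = ∈-keys⁻ p in All.lookup c∉ (proj₁ (normOn-∈ cs l q)) e) ∷ normOn-UK l u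

  norm-UK : ∀ l → UK (norm l)
  norm-UK l = normOn-UK l allN-unique

  Covers : List It → List It → Set
  Covers l' l = ∀ {c w} → (c , w) ∈ l → ∃ λ w' → (c , w') ∈ l' × toℕ w' ≤ toℕ w

  opaque
    -- The entries kept are the first in the order of the nodes, not the nearest ones. All that
    -- matters is the alternative of `trunc-full`: the list is full, or it covers everything.
    trunc : List It → List It
    trunc l = take K (norm l)

    trunc-∈ : ∀ {c w} l → (c , w) ∈ trunc l → (c , w) ∈ l
    trunc-∈ l p = norm-∈ l (∈-take⁻ K (norm l) p)

    trunc-full : ∀ l → (length (trunc l) ≡ K) ⊎ (length (trunc l) < K × Covers (trunc l) l)
    trunc-full l with take-full K (norm l)
    ... | inj₁ e = inj₁ e
    ... | inj₂ (e , lt) = inj₂ (subst (λ l → length l < K) (sym e) lt , λ p → let (w' , q , le) = norm-≤ l p in w' , subst ((_ , w') ∈_) (sym e) q , le)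

    trunc-UK : ∀ l → UK (trunc l)
    trunc-UK l = UK-take K (norm-UK l)

    trunc-length : ∀ l → length (trunc l) ≤ K
    trunc-length l = length-take≤ K (norm l)

    take-trunc : ∀ l → take K (trunc l) ≡ trunc l
    take-trunc l = take-take K (norm l)

  shift : (N → Bool) → Wt → List It → List It
  shift p a [] = []
  shift p a ((c , b) ∷ l) = if p c then (c , mkW (toℕ a + toℕ b)) ∷ shift p a l else shift p a l

  shift-∈ : ∀ {p a c m} l → (c , m) ∈ shift p a l → ∃ λ b → (c , b) ∈ l × p c ≡ true × m ≡ mkW (toℕ a + toℕ b)
  shift-∈ {p} ((c , b) ∷ l) q with p c in eq
  shift-∈ ((c , b) ∷ l) (here refl) | true = b , here refl , eq , refl
  shift-∈ ((c , b) ∷ l) (there q) | true = let (b , r , t) = shift-∈ l q in b , there r , t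
  shift-∈ ((c , b) ∷ l) q | false = let (b , r , t) = shift-∈ l q in b , there r , t

  ∈-shift : ∀ {p a c b} l → (c , b) ∈ l → p c ≡ true → (c , mkW (toℕ a + toℕ b)) ∈ shift p a l
  ∈-shift {p} ((c , b) ∷ l) q e with p c in eq
  ∈-shift ((c , b) ∷ l) (here refl) e | true = here refl
  ∈-shift ((c , b) ∷ l) (there q) e | true = there (∈-shift l q e)
  ∈-shift ((c , b) ∷ l) (here refl) e | false with trans (sym e) eq
  ... | ()
  ∈-shift ((c , b) ∷ l) (there q) e | false = ∈-shift l q e

  join : (N → Bool) → Maybe Wt → List It → List It
  join p (just a) l = shift p a l
  join p nothing l = []

  module Product (W : N → N → Maybe Wt) (Λ : N → List It) (φ : N → N → Bool) where

    via : N → N → List It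
    via x y = join (φ x) (W x y) (take K (Λ y))

    opaque
      -- The contribution of one block of middle nodes is computed away from `x` and truncated by
      -- itself, because only `K` entries can be returned to `x`.
      part : N → S → List It
      part x J = trunc (concatMap (λ j → via x (J , j)) (allBits h))

      prod : N → List It
      prod x = trunc (concatMap (part x) (allBits h))

      prod-def : ∀ x → prod x ≡ trunc (concatMap (part x) (allBits h))
      prod-def x = refl

      part-def : ∀ x J → part x J ≡ trunc (concatMap (λ j → via x (J , j)) (allBits h))
      part-def x J = refl

      prod-sound : ∀ {x c m} → (c , m) ∈ prod x → ∃ λ y → ∃ λ a → ∃ λ b →
                   W x y ≡ just a × (c , b) ∈ Λ y × φ x c ≡ true × m ≡ mkW (toℕ a + toℕ b)
      prod-sound {x} p with ∈-cM⁻ (part x) (allBits h) (trunc-∈ _ p)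
      ... | J , _ , q with ∈-cM⁻ (λ j → via x (J , j)) (allBits h) (trunc-∈ _ q)
      ... | j , _ , r with W x (J , j) in eq
      ... | just a = let (b , s , t) = shift-∈ (take K (Λ (J , j))) r in (J , j) , a , b , eq , ∈-take⁻ K _ s , t

      -- If some part had been cut off, its `K` distinct keys would all survive in the union and the
      -- product would be full. A product that is not full has therefore suffered no truncation at
      -- any stage.
      prod-full : ∀ x → (length (prod x) ≡ K) ⊎
        (length (prod x) < K × (∀ {y a c b} → W x y ≡ just a → (c , b) ∈ take K (Λ y) → φ x c ≡ true →
           ∃ λ m → (c , m) ∈ prod x × toℕ m ≤ toℕ a + toℕ b))
      prod-full x with trunc-full (concatMap (part x) (allBits h))
      ... | inj₁ e = inj₁ e
      ... | inj₂ (lt , cov) = inj₂ (lt , go)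
        where
        go : ∀ {y a c b} → W x y ≡ just a → (c , b) ∈ take K (Λ y) → φ x c ≡ true →
             ∃ λ m → (c , m) ∈ prod x × toℕ m ≤ toℕ a + toℕ b
        go {J , j} {a} {c} {b} eq c∈ eφ with trunc-full (concatMap (λ j → via x (J , j)) (allBits h))
        ... | inj₁ e = ⊥-elim (<⇒≱ lt (subst (_≤ length (prod x)) e (UK-length (trunc-UK _)
                λ q → let (w' , r , _) = cov (∈-cM⁺ (part x) (allBits h) (∈-allBits J) q) in w' , r)))
        ... | inj₂ (_ , cov') with cov' (∈-cM⁺ (λ j → via x (J , j)) (allBits h) (∈-allBits j)
                (subst (λ u → (c , mkW (toℕ a + toℕ b)) ∈ join (φ x) u (take K (Λ (J , j)))) (sym eq) (∈-shift _ c∈ eφ)))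
        ... | m , q , le with cov (∈-cM⁺ (part x) (allBits h) (∈-allBits J) q)
        ... | m' , r , le' = m' , r , ≤-trans le' (≤-trans le (mkW≤ _))

      prod-UK : ∀ x → UK (prod x)
      prod-UK x = trunc-UK _

      prod-length : ∀ x → length (prod x) ≤ K
      prod-length x = trunc-length _

  toMsg : ∀ {m} → List It → Vec (Maybe It) m
  toMsg {zero} l = []
  toMsg {suc m} [] = nothing ∷ toMsg []
  toMsg {suc m} (i ∷ l) = just i ∷ toMsg l

  fromMsg : ∀ {m} → Vec (Maybe It) m → List It
  fromMsg [] = []
  fromMsg (nothing ∷ v) = fromMsg v
  fromMsg (just i ∷ v) = i ∷ fromMsg v

  from-to : ∀ m l → fromMsg (toMsg {m} l) ≡ take m l
  from-to zero l = refl
  from-to (suc m) (i ∷ l) = cong (i ∷_) (from-to m l)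
  from-to (suc m) [] = go m
    where go : ∀ m → fromMsg (toMsg {m} []) ≡ []
          go zero = refl
          go (suc m) = go m

  chunk : ∀ {w} → List It → Vec Bool w → Msg
  chunk l [] = toMsg l
  chunk {suc w} l (false ∷ v) = chunk (take (z * 2 ^ w) l) v
  chunk {suc w} l (true ∷ v) = chunk (drop (z * 2 ^ w) l) v

  unchunk : ∀ w → (Vec Bool w → Msg) → List It
  unchunk zero f = fromMsg (f [])
  unchunk (suc w) f = unchunk w (f ∘ (false ∷_)) ++ unchunk w (f ∘ (true ∷_))

  unchunk-cong : ∀ w {f g : Vec Bool w → Msg} → (∀ v → f v ≡ g v) → unchunk w f ≡ unchunk w g
  unchunk-cong zero e = cong fromMsg (e [])
  unchunk-cong (suc w) e = cong₂ _++_ (unchunk-cong w (e ∘ (false ∷_))) (unchunk-cong w (e ∘ (true ∷_)))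

  take-split : ∀ {A : Set} m k (l : List A) → take m (take m l) ++ take k (drop m l) ≡ take (m + k) l
  take-split zero k l = refl
  take-split (suc m) zero [] = refl
  take-split (suc m) (suc k) [] = refl
  take-split (suc m) k (x ∷ l) = cong (x ∷_) (take-split m k l)

  unchunk-chunk : ∀ w l → unchunk w (chunk l) ≡ take (z * 2 ^ w) l
  unchunk-chunk zero l = trans (from-to z l) (cong (λ m → take m l) (sym (*-identityʳ z)))
  unchunk-chunk (suc w) l = trans (cong₂ _++_ (unchunk-chunk w _) (unchunk-chunk w _))
    (trans (take-split (z * 2 ^ w) (z * 2 ^ w) l)
      (cong (λ m → take m l) (sym (trans (cong (z *_) (2^suc w)) (*-distribˡ-+ z (2 ^ w) (2 ^ w))))))

-- Collecting the lists of all active nodes of a group: the entries are spread evenly over relay nodes.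

module Collect (k z : ℕ) where

  open Sparse k z public

  Slot : Set
  Slot = N × Fin z

  slots : List Slot
  slots = List.cartesianProduct allN (List.allFin z)

  slots-unique : Unique slots
  slots-unique = UP.cartesianProduct⁺ allN-unique (UP.allFin⁺ z)

  length-slots : length slots ≡ 2 ^ h * 2 ^ h * z
  length-slots = trans (go allN) (cong (_* z) length-allN)
    where
    lf : length (List.allFin z) ≡ z
    lf = length-tabulate id
    go : ∀ (xs : List N) → length (List.cartesianProduct xs (List.allFin z)) ≡ length xs * z
    go [] = refl
    go (x ∷ xs) = trans (length-++ (List.map (x ,_) (List.allFin z)))
      (cong₂ _+_ (trans (length-map _ (List.allFin z)) lf) (go xs))

  _≟S_ : (s t : Slot) → Dec (s ≡ t)
  _≟S_ = ×-≡-dec _≟N_ Fin._≟_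

  owner : ∀ {P : Set} → List Slot → List P → Slot → Maybe P
  owner [] _ s = nothing
  owner (_ ∷ _) [] s = nothing
  owner (t ∷ ts) (p ∷ ps) s with s ≟S t
  ... | yes _ = just p
  ... | no _ = owner ts ps s

  owner-∈ : ∀ {P : Set} ts (ps : List P) {s p} → owner ts ps s ≡ just p → p ∈ ps
  owner-∈ (t ∷ ts) (p ∷ ps) {s} e with s ≟S t
  owner-∈ (t ∷ ts) (p ∷ ps) refl | yes _ = here refl
  owner-∈ (t ∷ ts) (p ∷ ps) e | no _ = there (owner-∈ ts ps e)

  owner-onto : ∀ {P : Set} {ts} {ps : List P} {p} → Unique ts → length ps ≤ length ts → p ∈ ps →
               ∃ λ s → s ∈ ts × owner ts ps s ≡ just p
  owner-onto {ts = t ∷ ts} {p ∷ ps} u le (here refl) with t ≟S t in eq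
  ... | yes _ = t , here refl , lemma eq
    where lemma : ∀ {d} → (t ≟S t) ≡ yes d → owner (t ∷ ts) (p ∷ ps) t ≡ just p
          lemma e rewrite e = refl
  ... | no ne = ⊥-elim (ne refl)
  owner-onto {ts = t ∷ ts} {q ∷ ps} (t∉ ∷ u) (s≤s le) (there p∈) with owner-onto u le p∈
  ... | s , s∈ , e = s , there s∈ , lemma
    where lemma : owner (t ∷ ts) (q ∷ ps) s ≡ just _
          lemma with s ≟S t
          ... | yes refl = ⊥-elim (All.lookup t∉ s∈ refl)
          ... | no _ = e

  at : List It → ℕ → Maybe It
  at [] _ = nothing
  at (i ∷ l) zero = just i
  at (i ∷ l) (suc j) = at l j

  at-∈ : ∀ l {j i} → at l j ≡ just i → i ∈ l
  at-∈ (i ∷ l) {zero} refl = here refl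
  at-∈ (i ∷ l) {suc j} e = there (at-∈ l e)

  ∈-at : ∀ {l i} → i ∈ l → ∃ λ j → j < length l × at l j ≡ just i
  ∈-at (here refl) = 0 , s≤s z≤n , refl
  ∈-at (there p) = let (j , lt , e) = ∈-at p in suc j , s≤s lt , e

  optional : Maybe It → List It
  optional nothing = []
  optional (just i) = i ∷ []

  module Group {Γ : Set} (_≟Γ_ : (x y : Γ) → Dec (x ≡ y)) (grp : N → Γ) (act : List N) (κ : ℕ) where

    members : Γ → List N
    members γ = filter (λ x → grp x ≟Γ γ) act

    pairs : Γ → List (N × ℕ)
    pairs γ = concatMap (λ x → List.map (x ,_) (List.upTo κ)) (members γ)

    -- The assignment of list positions to relay slots depends only on `act` and `κ`, which all
    -- nodes know, so senders, relays and receivers agree on it without communication. Different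
    -- groups share the slots: a relay answers each receiver according to the group of the receiver.
    own : Γ → Slot → Maybe (N × ℕ)
    own γ = owner slots (pairs γ)

    own-group : ∀ {γ s x j} → own γ s ≡ just (x , j) → grp x ≡ γ
    own-group {γ} {x = x} e with ∈-cM⁻ (λ x → List.map (x ,_) (List.upTo κ)) (members γ) (owner-∈ slots (pairs γ) e)
    ... | x' , x∈ , p with ∈-map⁻ (x' ,_) p
    ... | _ , _ , refl = proj₂ (∈-filter⁻ (λ x → grp x ≟Γ γ) {xs = act} x∈)

    length-pairs : ∀ γ → length (pairs γ) ≤ length (members γ) * κ
    length-pairs γ = length-concatMap≤ _ (members γ) λ _ → ≤-reflexive (trans (length-map _ (List.upTo κ)) (length-upTo κ))

    pick : N → Maybe (N × ℕ) → Maybe It → List It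
    pick x nothing i = []
    pick x (just (x' , _)) i with x' ≟N x
    ... | yes _ = optional i
    ... | no _ = []

    module _ (L : N → List It) where

      content : Maybe (N × ℕ) → Maybe It
      content nothing = nothing
      content (just (x , j)) = at (L x) j

      opaque
        gather : Γ → N → List It
        gather γ x = concatMap (λ s → pick x (own γ s) (content (own γ s))) slots

        gather-def : ∀ γ x → gather γ x ≡ concatMap (λ s → pick x (own γ s) (content (own γ s))) slots
        gather-def γ x = refl

        gather-∈ : ∀ {γ x i} → i ∈ gather γ x → i ∈ L x
        gather-∈ {γ} {x} p with ∈-cM⁻ (λ s → pick x (own γ s) (content (own γ s))) slots p
        ... | s , _ , q with own γ s
        ... | just (x' , j) with x' ≟N x
        ... | yes refl with at (L x') j in eq
        gather-∈ p | s , _ , here refl | just (x' , j) | yes refl | just i = at-∈ (L x') eq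

        ∈-gather : ∀ {γ x i} → x ∈ act → grp x ≡ γ → length (members γ) * κ ≤ length slots →
                   length (L x) ≤ κ → i ∈ L x → i ∈ gather γ x
        ∈-gather {γ} {x} {i} x∈ e le lx i∈ with ∈-at i∈
        ... | j , j< , e' with owner-onto slots-unique (≤-trans (length-pairs γ) le)
                (∈-cM⁺ (λ x → List.map (x ,_) (List.upTo κ)) (members γ) (∈-filter⁺ (λ x → grp x ≟Γ γ) x∈ e)
                  (∈-map⁺ (x ,_) (∈-upTo⁺ (<-≤-trans j< lx))))
        ... | s , s∈ , eo = ∈-cM⁺ (λ s → pick x (own γ s) (content (own γ s))) slots s∈
                (subst (λ o → i ∈ pick x o (content o)) (sym eo) lemma)
          where
          lemma : i ∈ pick x (just (x , j)) (at (L x) j)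
          lemma with x ≟N x
          ... | yes _ = subst (λ o → i ∈ optional o) (sym e') (here refl)
          ... | no ne = ⊥-elim (ne refl)

-- Communication primitives that take O(1) rounds

module Rounds (n k z B c : ℕ) .{{nz : NonZero n}} (n≤D : n ≤ Virt.D k z) (D≤ : Virt.D k z ≤ suc c * n)
              (fits : suc c * (suc c * Virt.msgWidth k z) ≤ B) (1≤z : 1 ≤ z) where

  open Collect k z public
  open Sim n k z B c n≤D D≤ fits public

  -- Node (a , b) has a message m c d for each node (a , c); it travels through the relay (b ⊕ c , d).
  rowK : ∀ {T X} {f : (N → N → Bool) → N → X} (π : N → N) (m : N → X → S → S → Msg) → Know T f →
         Know (2 + T) (λ A v → f A v , tab (λ (b , d) →
           m (proj₁ (π v) , b) (f A (proj₁ (π v) , b)) (proj₂ (π v)) d))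
  rowK {X = X} {f} π m K₀ = eqK eq (mapK final (commK m₂ (commK m₁ K₀)))
    where
    m₁ : N → X → N → Msg
    m₁ (a , b) x (r , d) = m (a , b) x (b ⊕ r) d
    m₂ : N → X × Tab Msg → N → Msg
    m₂ (r , d) (_ , t) v = t ! (proj₁ (π v) , r ⊕ proj₂ (π v))
    final : N → (X × Tab Msg) × Tab Msg → X × Tab Msg
    final v ((x , _) , t) = x , tab (λ (b , d) → t ! (b ⊕ proj₂ (π v) , d))
    t₁ : (N → N → Bool) → N → Tab Msg
    t₁ A v = tab (λ b → m₁ b (f A b) v)
    eq : ∀ A v → final v ((f A v , t₁ A v) , tab (λ b → m₂ b (f A b , t₁ A b) v)) ≡ _
    eq A v = cong (f A v ,_) (tab-cong λ (b , d) → let a = proj₁ (π v) ; c = proj₂ (π v) in begin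
      tab (λ b → m₂ b (f A b , t₁ A b) v) ! (b ⊕ c , d)
        ≡⟨ tab-! (λ b → m₂ b (f A b , t₁ A b) v) (b ⊕ c , d) ⟩
      t₁ A (b ⊕ c , d) ! (a , (b ⊕ c) ⊕ c)
        ≡⟨ tab-! (λ b' → m₁ b' (f A b') (b ⊕ c , d)) (a , (b ⊕ c) ⊕ c) ⟩
      m (a , (b ⊕ c) ⊕ c) (f A (a , (b ⊕ c) ⊕ c)) (((b ⊕ c) ⊕ c) ⊕ (b ⊕ c)) d
        ≡⟨ cong (λ b' → m (a , b') (f A (a , b')) (b' ⊕ (b ⊕ c)) d) (⊕-cancelʳ b c) ⟩
      m (a , b) (f A (a , b)) (b ⊕ (b ⊕ c)) d
        ≡⟨ cong (λ c → m (a , b) (f A (a , b)) c d) (⊕-cancelˡ b c) ⟩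
      m (a , b) (f A (a , b)) c d ∎)
      where open ≡-Reasoning

  wMsg : Maybe Wt → Msg
  wMsg nothing = toMsg []
  wMsg (just a) = toMsg ((node 0 , a) ∷ [])

  readW : Msg → Maybe Wt
  readW m = Maybe.map proj₂ (List.head (fromMsg m))

  readW-wMsg : ∀ w → readW (wMsg w) ≡ w
  readW-wMsg nothing = trans (cong (Maybe.map proj₂ ∘ List.head) (from-to z [])) (go z)
    where go : ∀ z → Maybe.map proj₂ (List.head {A = It} (take z [])) ≡ nothing
          go zero = refl
          go (suc _) = refl
  readW-wMsg (just a) = trans (cong (Maybe.map proj₂ ∘ List.head) (from-to z ((node 0 , a) ∷ []))) (go z 1≤z)
    where go : ∀ z → 1 ≤ z → Maybe.map proj₂ (List.head {A = It} (take z ((node 0 , a) ∷ []))) ≡ just a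
          go (suc _) _ = refl

  -- Node (I , J) multiplies the block I × J of W by the lists of the nodes (J , j).
  prodK : ∀ {T X} {f : (N → N → Bool) → N → X} (W : N → X → N → Maybe Wt) (Λ : N → X → List It) (φ : N → N → Bool) →
          Know T f → Know (6 + T) (λ A a → f A a ,
            Product.prod (λ x → W x (f A x)) (λ y → Λ y (f A y)) φ a)
  prodK {X = X} {f} W Λ φ K₀ = eqK eq (mapK merge (rowK id sendΠ (rowK swap sendΛ (rowK id sendW K₀))))
    where
    sendW : N → X → S → S → Msg
    sendW x s J j = wMsg (W x s (J , j))
    sendΛ : N → X × Tab Msg → S → S → Msg
    sendΛ y (s , _) _ d = chunk (Λ y s) d
    block : N → Tab Msg → Tab Msg → S → List It
    block (I , J) tW tΛ i = trunc (concatMap (λ j →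
      join (φ (I , i)) (readW (tW ! (i , j))) (unchunk h (λ d → tΛ ! (j , d)))) (allBits h))
    sendΠ : N → (X × Tab Msg) × Tab Msg → S → S → Msg
    sendΠ v ((_ , tW) , tΛ) i d = chunk (block v tW tΛ i) d
    merge : N → ((X × Tab Msg) × Tab Msg) × Tab Msg → X × List It
    merge x (((s , _) , _) , t) = s , trunc (concatMap (λ J → unchunk h (λ d → t ! (J , d))) (allBits h))
    TW TΛ : (N → N → Bool) → N → Tab Msg
    TW A v = tab (λ (b , d) → sendW (proj₁ v , b) (f A (proj₁ v , b)) (proj₂ v) d)
    TΛ A v = tab (λ (b , d) → sendΛ (proj₂ v , b) (f A (proj₂ v , b) , TW A (proj₂ v , b)) (proj₁ v) d)
    module P A = Product (λ x → W x (f A x)) (λ y → Λ y (f A y)) φ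
    block-eq : ∀ A I J i → block (I , J) (TW A (I , J)) (TΛ A (I , J)) i ≡ P.part A (I , i) J
    block-eq A I J i = trans (cong trunc (concatMap-cong (λ j → cong₂ (join (φ (I , i)))
      (trans (cong readW (tab-! _ (i , j))) (readW-wMsg (W (I , i) (f A (I , i)) (J , j))))
      (trans (unchunk-cong h (λ d → tab-! (λ (b , d) → sendΛ (J , b) (f A (J , b) , TW A (J , b)) I d) (j , d)))
             (unchunk-chunk h (Λ (J , j) (f A (J , j)))))) (allBits h)))
      (sym (P.part-def A (I , i) J))
    eq : ∀ A x → merge x (((f A x , TW A x) , TΛ A x) , tab (λ (b , d) →
           sendΠ (proj₁ x , b) ((f A (proj₁ x , b) , TW A (proj₁ x , b)) , TΛ A (proj₁ x , b)) (proj₂ x) d))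
         ≡ (f A x , P.prod A x)
    eq A x@(I , i) = cong (f A x ,_) (trans (cong trunc (concatMap-cong (λ J →
      trans (unchunk-cong h (λ d → tab-! (λ (b , d) →
               sendΠ (I , b) ((f A (I , b) , TW A (I , b)) , TΛ A (I , b)) i d) (J , d)))
      (trans (unchunk-chunk h (block (I , J) (TW A (I , J)) (TΛ A (I , J)) i))
      (trans (take-trunc _) (block-eq A I J i)))) (allBits h)))
      (sym (P.prod-def A x)))

  gatherK : ∀ {T G L} {g : (N → N → Bool) → G} {l : (N → N → Bool) → N → L}
            {Γ : Set} (_≟Γ_ : (x y : Γ) → Dec (x ≡ y)) (grp : N → Γ) (act : G → List N) (κ : G → ℕ)
            (items : N → G → L → List It) → Know T (λ A a → g A , l A a) →
            Know (2 + T) (λ A v → (g A , l A v) ,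
              tab (Group.gather _≟Γ_ grp (act (g A)) (κ (g A)) (λ x → items x (g A) (l A x)) (grp v)))
  gatherK {G = G} {L} {g} {l} _≟Γ_ grp act κ items K₀ = eqK eq (mapK final (commK m₂ (commK m₁ K₀)))
    where
    module C (γ : G) = Group _≟Γ_ grp (act γ) (κ γ)
    offer : N → List It → Maybe (N × ℕ) → Maybe It
    offer x i nothing = nothing
    offer x i (just (x' , j)) with x' ≟N x
    ... | yes _ = at i j
    ... | no _ = nothing
    relayed : Tab Msg → Fin z → Maybe (N × ℕ) → Maybe It
    relayed t i nothing = nothing
    relayed t i (just (x , _)) = lookup (t ! x) i
    m₁ : N → G × L → N → Msg
    m₁ x (γ , s) r = tabulate λ i → offer x (items x γ s) (C.own γ (grp x) (r , i))
    m₂ : N → (G × L) × Tab Msg → N → Msg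
    m₂ r ((γ , _) , t) v = tabulate λ i → relayed t i (C.own γ (grp v) (r , i))
    final : N → ((G × L) × Tab Msg) × Tab Msg → (G × L) × Tab (List It)
    final v (((γ , s) , _) , t) = (γ , s) , tab λ x →
      concatMap (λ (r , i) → C.pick γ x (C.own γ (grp v) (r , i)) (lookup (t ! r) i)) slots
    T₁ : (N → N → Bool) → N → Tab Msg
    T₁ A v = tab (λ x → m₁ x (g A , l A x) v)
    T₂ : (N → N → Bool) → N → Tab Msg
    T₂ A v = tab (λ r → m₂ r ((g A , l A r) , T₁ A r) v)
    msg-eq : ∀ A v r i → lookup (T₂ A v ! r) i ≡
             C.content (g A) (λ x → items x (g A) (l A x)) (C.own (g A) (grp v) (r , i))
    msg-eq A v r i = trans (cong (λ m → lookup m i) (tab-! (λ r → m₂ r ((g A , l A r) , T₁ A r) v) r))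
      (trans (lookup∘tabulate (λ i → relayed (T₁ A r) i (C.own (g A) (grp v) (r , i))) i)
      (go (C.own (g A) (grp v) (r , i)) refl))
      where
      go : ∀ o → C.own (g A) (grp v) (r , i) ≡ o →
           relayed (T₁ A r) i o ≡ C.content (g A) (λ x → items x (g A) (l A x)) o
      go nothing e = refl
      -- The sender consults `own` for its own group and the receiver for its own. By `own-group` an
      -- occupied slot belongs to a sender of the receiver's group, so the two agree.
      go (just (x , j)) e = trans (cong (λ m → lookup m i) (tab-! (λ x → m₁ x (g A , l A x) r) x))
        (trans (lookup∘tabulate (λ i → offer x (items x (g A) (l A x)) (C.own (g A) (grp x) (r , i))) i)
        (trans (cong (offer x (items x (g A) (l A x))) (trans (cong (λ γ → C.own (g A) γ (r , i)) (C.own-group (g A) e)) e)) self))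
        where
        self : offer x (items x (g A) (l A x)) (just (x , j)) ≡ at (items x (g A) (l A x)) j
        self with x ≟N x
        ... | yes _ = refl
        ... | no ne = ⊥-elim (ne refl)
    eq : ∀ A v → final v (((g A , l A v) , T₁ A v) , T₂ A v) ≡ _
    eq A v = cong ((g A , l A v) ,_) (tab-cong λ x → trans (concatMap-cong
      (λ (r , i) → cong (C.pick (g A) x (C.own (g A) (grp v) (r , i))) (msg-eq A v r i)) slots)
      (sym (C.gather-def (g A) (λ x → items x (g A) (l A x)) (grp v) x)))

-- Weighted walks: Walks R j x y w is a walk of at most j steps and total weight w.

module WeightedWalks {V : Set} where

  data Walks (R : V → V → ℕ → Set) : ℕ → V → V → ℕ → Set where
    nil : ∀ {j x} → Walks R j x x 0
    cons : ∀ {j x y u a b} → R x y a → Walks R j y u b → Walks R (suc j) x u (a + b)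

  module _ {R : V → V → ℕ → Set} where

    walks-mono : ∀ {i j x y w} → i ≤ j → Walks R i x y w → Walks R j x y w
    walks-mono le nil = nil
    walks-mono (s≤s le) (cons e p) = cons e (walks-mono le p)

    walks-++ : ∀ {i j x y u a b} → Walks R i x y a → Walks R j y u b → Walks R (i + j) x u (a + b)
    walks-++ {i} {j} nil q = walks-mono (m≤n+m j i) q
    walks-++ {suc i} {j} {x} {u = u} (cons {a = a} {b} e p) q = subst (Walks R (suc i + j) x u) (sym (+-assoc a b _)) (cons e (walks-++ p q))

    one : ∀ {x y a} → R x y a → Walks R 1 x y a
    one {x} {y} {a} e = subst (Walks R 1 x y) (+-identityʳ a) (cons e nil)

    private
      at : ∀ {j x y w} → Walks R j x y w → Fin (suc j) → V
      at {x = x} nil i = x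
      at {x = x} (cons e p) zero = x
      at (cons e p) (suc i) = at p i

      after : ∀ {j x y w} (p : Walks R j x y w) (i : Fin (suc j)) →
              ∃ λ w' → w' ≤ w × Walks R (j ∸ toℕ i) (at p i) y w'
      after nil i = 0 , z≤n , nil
      after {w = w} p@(cons e q) zero = w , ≤-refl , p
      after (cons {a = a} {b} e q) (suc i) = let (w' , le , r) = after q i in w' , ≤-trans le (m≤n+m b a) , r

      cut : ∀ {j x y w} (p : Walks R j x y w) (i i' : Fin (suc j)) → i Fin.< i' → at p i ≡ at p i' →
            ∃ λ w' → ∃ λ j' → w' ≤ w × j' < j × Walks R j' x y w'
      cut {j} {w = w} nil i i' lt e = w , 0 , ≤-refl , <-≤-trans lt' (≤-pred (toℕ<n i')) , nil
        where lt' : 0 < toℕ i'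
              lt' = ≤-trans (s≤s z≤n) lt
      cut {suc j} {y = y} p@(cons _ _) zero i' lt e =
        let (w' , le , r) = after p i' in w' , suc j ∸ toℕ i' , le ,
          ∸-monoʳ-< {m = suc j} {o = 0} lt (≤-pred (toℕ<n i')) , subst (λ v → Walks R _ v y w') (sym e) r
      cut (cons {a = a} e p) (suc i) (suc i') (s≤s lt) eq = let (w' , j' , le , lt' , r) = cut p i i' lt eq in
        a + w' , suc j' , +-monoʳ-≤ a le , s≤s lt' , cons e r

    -- A walk with more than `m` steps repeats a vertex by the pigeonhole principle, and removing
    -- the loop does not raise the weight. This bounds distances by `D`, and it lets `D` relaxation
    -- steps find the estimates.
    shorten : ∀ {m} (f : V → Fin m) → (∀ {u v} → f u ≡ f v → u ≡ v) → ∀ {j x y w} → Walks R j x y w →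
              ∃ λ w' → w' ≤ w × Walks R m x y w'
    shorten {m} f inj {j} p = go j ≤-refl p
      where
      go : ∀ b {j x y w} → j ≤ b → Walks R j x y w → ∃ λ w' → w' ≤ w × Walks R m x y w'
      go b {j} {w = w} le p with j ≤? m
      ... | yes q = w , ≤-refl , walks-mono q p
      go zero le p | no q = ⊥-elim (q (≤-trans le z≤n))
      go (suc b) le p | no q with pigeonhole (≤-trans (≰⇒> q) (n≤1+n _)) (f ∘ at p)
      ... | i , i' , lt , e with cut p i i' lt (inj e)
      ... | w' , j' , le' , lt' , r with go b (≤-pred (≤-trans lt' le)) r
      ... | w'' , le'' , r' = w'' , ≤-trans le'' le' , r'

-- Unweighted paths: Path P x y d has length d, and all its vertices except possibly the last satisfy P.

module Paths {V : Set} (A : V → V → Bool) where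

  open WeightedWalks {V} public

  data Path (P : V → Set) : V → V → ℕ → Set where
    nil : ∀ {x} → Path P x x 0
    cons : ∀ {x y u d} → P x → A x y ≡ true → Path P y u d → Path P x u (suc d)

  Always : V → Set
  Always _ = ⊤

  Reach : ℕ → V → V → Set
  Reach r x y = ∃ λ d → d ≤ r × Path Always x y d

  path-++ : ∀ {P x y u a b} → Path P x y a → Path P y u b → Path P x u (a + b)
  path-++ nil q = q
  path-++ (cons p e r) q = cons p e (path-++ r q)

  forget : ∀ {P x y d} → Path P x y d → Path Always x y d
  forget nil = nil
  forget (cons _ e r) = cons tt e (forget r)

  edge : ∀ {x y} → A x y ≡ true → Path Always x y 1
  edge e = cons tt e nil

  split : ∀ {P x y} a {b} → Path P x y (a + b) → ∃ λ u → Path P x u a × Path P u y b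
  split zero p = _ , nil , p
  split (suc a) (cons p e r) = let (u , q , s) = split a r in u , cons p e q , s

  split-at : ∀ {P x y d} a → a ≤ d → P y → Path P x y d → ∃ λ u → P u × Path P x u a × Path P u y (d ∸ a)
  split-at {P} {x} {y} {d} a le py p with split {P} a (subst (Path P x y) (sym (m+[n∸m]≡n le)) p)
  ... | u , q , s = u , start s py , q , s
    where start : ∀ {u b} → Path P u y b → P y → P u
          start nil py = py
          start (cons p _ _) _ = p

  reach-refl : ∀ {r x} → Reach r x x
  reach-refl = 0 , z≤n , nil

  reach-++ : ∀ {x y u a b} → Reach a x y → Reach b y u → Reach (a + b) x u
  reach-++ (d , le , p) (d' , le' , p') = d + d' , +-mono-≤ le le' , path-++ p p'

  reach-mono : ∀ {x y a b} → a ≤ b → Reach a x y → Reach b x y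
  reach-mono le (d , le' , p) = d , ≤-trans le' le , p

  path-reach : ∀ {P x y d} → Path P x y d → Reach d x y
  path-reach p = _ , ≤-refl , forget p

  module Symmetric (A-sym : ∀ u v → A u v ≡ A v u) where

    path-sym : ∀ {x y d} → Path Always x y d → Path Always y x d
    path-sym nil = nil
    path-sym {x} (cons {y = y} {d = d} _ e r) = subst (Path Always _ _) (+-comm d 1)
      (path-++ (path-sym r) (edge (trans (A-sym y x) e)))

    reach-sym : ∀ {x y r} → Reach r x y → Reach r y x
    reach-sym (d , le , p) = d , le , path-sym p

  reach-shorten : ∀ {m} (f : V → Fin m) → (∀ {u v} → f u ≡ f v → u ≡ v) → ∀ {r x y} → Reach r x y → Reach (r ⊓ m) x y
  reach-shorten {m} f inj {r} (d , le , p) with shorten f inj (toW p)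
    where
    R : V → V → ℕ → Set
    R x y a = A x y ≡ true × a ≡ 1
    toW : ∀ {x y d} → Path Always x y d → Walks R d x y d
    toW nil = nil
    toW (cons _ e r) = cons (e , refl) (toW r)
  ... | w , le' , q = w , ⊓-glb (≤-trans le' le) (len q) , fromW q
    where
    R : V → V → ℕ → Set
    R x y a = A x y ≡ true × a ≡ 1
    len : ∀ {j x y w} → Walks R j x y w → w ≤ j
    len nil = z≤n
    len (cons (_ , refl) q) = s≤s (len q)
    fromW : ∀ {j x y w} → Walks R j x y w → Path Always x y w
    fromW nil = nil
    fromW (cons (e , refl) q) = cons tt e (fromW q)

  Before After : (V → Set) → V → V → ℕ → Set
  Before Q x u p = (x ≡ u × p ≡ 0) ⊎ (∃ λ u' → ∃ λ p' → p ≡ suc p' × Path Q x u' p' × Q u' × A u' u ≡ true)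
  After Q w y q = (w ≡ y × q ≡ 0) ⊎ (∃ λ w' → ∃ λ q' → q ≡ suc q' × A w w' ≡ true × Path Q w' y q' × Q y)

  record Sections (Q H : V → Set) (x y : V) (d : ℕ) : Set where
    constructor sections
    field
      first last : V
      p m q : ℕ
      total : p + (m + q) ≡ d
      before : Before Q x first p
      at-first : H first
      between : Path Always first last m
      at-last : H last
      after : After Q last y q

  -- Only the first and the last `H` vertex are marked. Whatever the path meets between them will be
  -- bypassed by a single shortcut, which is why one detour per section suffices.
  scan : ∀ {P Q H : V → Set} → (∀ {x} → P x → Q x ⊎ H x) → ∀ {x y d} → Path P x y d → P y →
         (Path Q x y d × Q y) ⊎ Sections Q H x y d
  scan cl nil py with cl py
  ... | inj₁ q = inj₁ (nil , q)
  ... | inj₂ hy = inj₂ (sections _ _ 0 0 0 refl (inj₁ (refl , refl)) hy nil hy (inj₁ (refl , refl)))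
  scan cl (cons px e r) py with scan cl r py | cl px
  ... | inj₁ (r' , qy) | inj₁ qx = inj₁ (cons qx e r' , qy)
  ... | inj₁ (r' , qy) | inj₂ hx = inj₂ (sections _ _ 0 0 _ refl (inj₁ (refl , refl)) hx nil hx (inj₂ (_ , _ , refl , e , r' , qy)))
  ... | inj₂ (sections f l p m q t b hf mid hl a) | inj₁ qx = inj₂ (sections f l (suc p) m q (cong suc t) (ext b) hf mid hl a)
    where
    ext : Before _ _ f p → Before _ _ f (suc p)
    ext (inj₁ (refl , refl)) = inj₂ (_ , 0 , refl , nil , qx , e)
    ext (inj₂ (u' , p' , refl , r' , qu , e')) = inj₂ (u' , suc p' , refl , cons qx e r' , qu , e')
  ... | inj₂ (sections f l p m q t b hf mid hl a) | inj₂ hx =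
    inj₂ (sections _ l 0 (suc (p + m)) q (cong suc (trans (+-assoc p m q) t)) (inj₁ (refl , refl)) hx
      (cons tt e (path-++ (toPath b) mid)) hl a)
    where
    toPath : ∀ {Q x p} → Before Q x f p → Path Always x f p
    toPath (inj₁ (refl , refl)) = nil
    toPath (inj₂ (u' , p' , refl , r' , qu , e')) = subst (Path Always _ _) (+-comm p' 1) (path-++ (forget r') (edge e'))

AllPairs-map∈ : ∀ {A : Set} {R R' : A → A → Set} {xs} → (∀ {x y} → x ∈ xs → y ∈ xs → R x y → R' x y) → AllPairs R xs → AllPairs R' xs
AllPairs-map∈ f [] = []
AllPairs-map∈ f (r ∷ rs) = All.tabulate (λ p → f (here refl) (there p) (All.lookup r p)) ∷ AllPairs-map∈ (λ p q → f (there p) (there q)) rs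

∧-true⁻ : ∀ {a b} → (a ∧ b) ≡ true → a ≡ true × b ≡ true
∧-true⁻ {true} {true} _ = refl , refl

∧-true⁺ : ∀ {a b} → a ≡ true → b ≡ true → (a ∧ b) ≡ true
∧-true⁺ refl refl = refl

does-true : ∀ {P : Set} (d : Dec P) → P → does d ≡ true
does-true (yes _) _ = refl
does-true (no n) p = ⊥-elim (n p)

does-true⁻ : ∀ {P : Set} (d : Dec P) → does d ≡ true → P
does-true⁻ (yes p) _ = p

module Lookup (k z : ℕ) where

  open Collect k z public

  opaque
    findW : N → List It → Maybe Wt
    findW y l = Maybe.map mkW (least y l)

    findW-∈ : ∀ {y a} l → findW y l ≡ just a → (y , a) ∈ l
    findW-∈ {y} l e with least y l in eq
    findW-∈ {y} l refl | just m with ∈-weights⁻ l (minL-∈ (weights y l) eq)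
    ... | w , refl , q = subst (λ w → (y , w) ∈ l) (sym (mkW-toℕ w)) q

    ∈-findW : ∀ {y a} l → (y , a) ∈ l → ∃ λ a' → findW y l ≡ just a' × toℕ a' ≤ toℕ a
    ∈-findW {y} l p with least y l | minL-≤ (weights y l) (∈-weights⁺ p)
    ... | _ | m , refl , le = mkW m , refl , ≤-trans (mkW≤ m) le

  everything : N → N → Bool
  everything _ _ = true

  selfW : N → List It → N → Maybe Wt
  selfW x l y = findW y ((x , mkW 0) ∷ l)

  entryTo : ℕ → Maybe N → List It
  entryTo d nothing = []
  entryTo d (just y) = (y , mkW d) ∷ []

  entryTo-∈ : ∀ {d m y w} → (y , w) ∈ entryTo d m → m ≡ just y × w ≡ mkW d
  entryTo-∈ {m = just _} (here refl) = refl , refl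

  ∈-entryTo : ∀ {d m y} → m ≡ just y → (y , mkW d) ∈ entryTo d m
  ∈-entryTo refl = here refl

-- Balls of radius 2 ^ t by repeated squaring

module Balls (k z : ℕ) (A : Virt.N k z → Virt.N k z → Bool) where

  open Lookup k z public
  open Paths A public

  -- The soundness invariant of all stored entries: a weight is never smaller than the distance.
  Ok : N → N → Wt → Set
  Ok x y w = Reach (toℕ w) x y

  ok-clamp : ∀ {r x y} → Reach r x y → Ok x y (mkW r)
  ok-clamp {r} {x} {y} p = subst (λ r → Reach r x y) (sym (toℕ-mkW r)) (reach-shorten f inj p)
    where
    f : N → Fin D
    f a = fromℕ< (idx<D a)
    inj : ∀ {u v} → f u ≡ f v → u ≡ v
    inj {u} {v} e = trans (sym (node-idx u)) (trans (cong node (fromℕ<-injective _ _ _ _ e)) (node-idx v))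

  opaque
    nbrs : N → List It
    nbrs x = concatMap (λ c → if A x c then (c , mkW 1) ∷ [] else []) allN

    nbrs-∈ : ∀ {x c w} → (c , w) ∈ nbrs x → A x c ≡ true × w ≡ mkW 1
    nbrs-∈ {x} p with ∈-cM⁻ (λ c → if A x c then (c , mkW 1) ∷ [] else []) allN p
    ... | c , _ , q with A x c in eq
    nbrs-∈ p | c , _ , here refl | true = eq , refl

    nbrs-def : ∀ x → nbrs x ≡ concatMap (λ c → if A x c then (c , mkW 1) ∷ [] else []) allN
    nbrs-def x = refl

    ∈-nbrs : ∀ {x c} → A x c ≡ true → (c , mkW 1) ∈ nbrs x
    ∈-nbrs {x} {c} e = ∈-cM⁺ (λ c → if A x c then (c , mkW 1) ∷ [] else []) allN (∈-allN c)
      (subst (λ b → (c , mkW 1) ∈ (if b then (c , mkW 1) ∷ [] else [])) (sym e) (here refl))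

  base : N → List It
  base x = (x , mkW 0) ∷ nbrs x

  base-ok : ∀ {x c w} → (c , w) ∈ base x → Ok x c w × toℕ w ≤ 1
  base-ok (here refl) = ok-clamp reach-refl , ≤-trans (mkW≤ 0) z≤n
  base-ok {x} (there p) with nbrs-∈ p
  ... | e , refl = ok-clamp (path-reach (edge e)) , mkW≤ 1

  M : ℕ → N → List It
  M zero x = trunc (base x)
  M (suc t) = Product.prod (λ x → selfW x (M t x)) (M t) everything

  module Step (t : ℕ) = Product (λ x → selfW x (M t x)) (M t) everything

  M-UK : ∀ t x → UK (M t x)
  M-UK zero x = trunc-UK _
  M-UK (suc t) x = Step.prod-UK t x

  M-length : ∀ t x → length (M t x) ≤ K
  M-length zero x = trunc-length _
  M-length (suc t) x = Step.prod-length t x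

  Light : ℕ → N → Set
  Light t x = length (M t x) < K

  Heavy : ℕ → N → Set
  Heavy t x = K ≤ length (M t x)

  M-ok : ∀ t {x y w} → (y , w) ∈ M t x → Ok x y w × toℕ w ≤ 2 ^ t
  M-ok zero p = base-ok (trunc-∈ _ p)
  M-ok (suc t) {x} p with Step.prod-sound t p
  ... | y , a , b , e , q , _ , refl with findW-∈ ((x , mkW 0) ∷ M t x) e | M-ok t q
  ... | here refl | ok , le = ok-clamp (reach-++ reach-refl ok) ,
        ≤-trans (mkW≤ _) (≤-trans (+-mono-≤ (≤-trans (mkW≤ 0) z≤n) le) (≤-trans (m≤m+n (2 ^ t) (2 ^ t)) (≤-reflexive (sym (2^suc t)))))
  ... | there r | ok , le = let (ok' , le') = M-ok t r in ok-clamp (reach-++ ok' ok) ,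
        ≤-trans (mkW≤ _) (≤-trans (+-mono-≤ le' le) (≤-reflexive (sym (2^suc t))))

  -- If the doubled list of `x` is not full, every middle node is light at scale `t`, because its
  -- whole list passes into the product. The entry of weight 0 added by `selfW` makes `x` one of the
  -- middle nodes. So both halves of a path, split at distance at most 2 ^ t, are found by
  -- induction.
  M-exact : ∀ t {x y r} → Light t x → r ≤ 2 ^ t → Reach r x y → ∃ λ w → (y , w) ∈ M t x × toℕ w ≤ r
  M-exact zero {x} li le p with trunc-full (base x)
  ... | inj₁ e = ⊥-elim (<-irrefl e li)
  ... | inj₂ (_ , cov) with p
  ... | zero , _ , nil = let (w , q , le') = cov (here refl) in w , q , ≤-trans le' (≤-trans (mkW≤ 0) z≤n)
  ... | suc zero , le₁ , cons _ e nil = let (w , q , le') = cov (there (∈-nbrs e)) in w , q , ≤-trans le' (≤-trans (mkW≤ 1) le₁)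
  ... | suc (suc d) , le₁ , _ with ≤-trans le₁ le
  ... | s≤s ()
  M-exact (suc t) {x} {y} {r} li le (d , d≤ , p) with Step.prod-full t x
  ... | inj₁ e = ⊥-elim (<-irrefl e li)
  ... | inj₂ (lt , full) = result
    where
    whole : ∀ {y c b} → (c , b) ∈ M t y → (c , b) ∈ take K (M t y)
    whole {y} = subst (_ ∈_) (sym (take-all K (M t y) (M-length t y)))
    via-light : ∀ {u a} → selfW x (M t x) u ≡ just a → Light t u
    via-light e = ≤-<-trans (UK-length (M-UK t _) (λ q → let (m , s , _) = full e (whole q) refl in m , s)) lt
    self : ∃ λ a → selfW x (M t x) x ≡ just a × toℕ a ≤ 0
    self = let (a , e , le) = ∈-findW ((x , mkW 0) ∷ M t x) (here refl) in a , e , ≤-trans le (mkW≤ 0)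
    x-light : Light t x
    x-light = via-light (proj₁ (proj₂ self))
    half : ∃ λ u → Reach (d ⊓ 2 ^ t) x u × Reach (d ∸ (d ⊓ 2 ^ t)) u y
    half = let (u , _ , q , s) = split-at {Always} (d ⊓ 2 ^ t) (m⊓n≤m d _) tt p in u , path-reach q , path-reach s
    rest : d ∸ (d ⊓ 2 ^ t) ≤ 2 ^ t
    rest = m≤n+o⇒m∸n≤o d (d ⊓ 2 ^ t) lemma
      where
      d≤2 : d ≤ 2 ^ t + 2 ^ t
      d≤2 = ≤-trans d≤ (≤-trans le (≤-reflexive (2^suc t)))
      lemma : d ≤ (d ⊓ 2 ^ t) + 2 ^ t
      lemma with ≤-total d (2 ^ t)
      ... | inj₁ q = subst (λ m → d ≤ m + 2 ^ t) (sym (m≤n⇒m⊓n≡m q)) (m≤m+n d _)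
      ... | inj₂ q = subst (λ m → d ≤ m + 2 ^ t) (sym (m≥n⇒m⊓n≡n q)) d≤2
    result : ∃ λ w → (y , w) ∈ M (suc t) x × toℕ w ≤ r
    result with half
    ... | u , xu , uy with M-exact t x-light (m⊓n≤n d _) xu
    ... | a , a∈ , a≤ with ∈-findW ((x , mkW 0) ∷ M t x) (there a∈)
    ... | a' , e , a'≤ with M-exact t (via-light e) rest uy
    ... | b , b∈ , b≤ with full e (whole b∈) refl
    ... | m , m∈ , m≤ = m , m∈ , ≤-trans m≤ (≤-trans (+-mono-≤ (≤-trans a'≤ a≤) b≤)
          (≤-trans (≤-reflexive (m+[n∸m]≡n (m⊓n≤m d (2 ^ t)))) d≤))

if-∈ : ∀ {X : Set} {b : Bool} {x y : X} → y ∈ (if b then x ∷ [] else []) → b ≡ true × y ≡ x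
if-∈ {b = true} (here e) = refl , e

∈-if : ∀ {X : Set} {b : Bool} {x : X} → b ≡ true → x ∈ (if b then x ∷ [] else [])
∈-if refl = here refl

-- Ruling sets of heavy nodes

module Offers (k z : ℕ) {j : ℕ} (grp : Virt.N k z → Vec Bool j) (ρ : Virt.Wt k z) where

  open Collect k z

  entryΛ : Tab Bool → Vec Bool j → N → List It
  entryΛ v γ x = if v ! x ∧ does (grp x ≟ᵇ γ) then (x , ρ) ∷ [] else []

  slice : Tab Bool → Vec Bool j → List It
  slice v γ = concatMap (entryΛ v γ) allN

  opaque
    -- A node offers at most 2 ^ k of the nodes touching it to each group, to stay within `K`
    -- entries. A slice that is cut off does no harm: its 2 ^ k entries already fill the conflict
    -- list of the receiver.
    offered : Tab Bool → List It
    offered v = concatMap (λ γ → take (2 ^ k) (slice v γ)) (allBits j)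

    slice-UK : ∀ v γ → UK (slice v γ)
    slice-UK v γ = go allN allN-unique
      where
      go : ∀ xs → Unique xs → UK (concatMap (entryΛ v γ) xs)
      go [] _ = []
      go (x ∷ xs) (x∉ ∷ u) with v ! x ∧ does (grp x ≟ᵇ γ)
      ... | false = go xs u
      ... | true = All.tabulate (λ p e → let (w , q) = ∈-keys⁻ p ; (y , y∈ , r) = ∈-cM⁻ (entryΛ v γ) xs q in
                     All.lookup x∉ y∈ (trans e (cong proj₁ (proj₂ (if-∈ r))))) ∷ go xs u

    ∈-slice : ∀ {v γ x} → v ! x ≡ true → grp x ≡ γ → (x , ρ) ∈ slice v γ
    ∈-slice {v} {γ} {x} e e' = ∈-cM⁺ (entryΛ v γ) allN (∈-allN x) (∈-if (∧-true⁺ e (does-true (grp x ≟ᵇ γ) e')))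

    slice-∈ : ∀ {v γ x w} → (x , w) ∈ slice v γ → v ! x ≡ true × grp x ≡ γ
    slice-∈ {v} {γ} p with ∈-cM⁻ (entryΛ v γ) allN p
    ... | y , _ , q with if-∈ q
    ... | e , refl = let (a , b) = ∧-true⁻ e in a , does-true⁻ (grp y ≟ᵇ γ) b

    offered-∈ : ∀ {v x w} → (x , w) ∈ offered v → v ! x ≡ true
    offered-∈ {v} p with ∈-cM⁻ (λ γ → take (2 ^ k) (slice v γ)) (allBits j) p
    ... | γ , _ , q = proj₁ (slice-∈ (∈-take⁻ (2 ^ k) (slice v γ) q))

    ∈-offered : ∀ {v γ i} → i ∈ take (2 ^ k) (slice v γ) → i ∈ offered v
    ∈-offered {v} {γ} p = ∈-cM⁺ (λ γ → take (2 ^ k) (slice v γ)) (allBits j) (∈-allBits γ) p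

    offered-length : ∀ v → length (offered v) ≤ 2 ^ j * 2 ^ k
    offered-length v = ≤-trans (length-concatMap≤ _ (allBits j) (λ {γ} _ → length-take≤ (2 ^ k) (slice v γ)))
      (≤-reflexive (cong (_* 2 ^ k) (length-allBits j)))

-- A maximal family of active nodes whose sets M x are disjoint, computed separately in each group.
-- When a list Λ x of conflicting nodes has reached 2 ^ k entries, disjointness of the lists limits
-- the size of the family; otherwise Λ x is complete and disjointness of the sets M x does.

module Ruling (k z : ℕ) {j : ℕ} (grp : Virt.N k z → Vec Bool j) (ρ : Virt.Wt k z)
              (Q : Virt.Tab k z Bool) (M : Virt.N k z → List (Virt.It k z)) where

  open Collect k z
  open Offers k z grp ρ
  open DecMem _≟N_ using (_∈?_)

  touch : N → N → Bool
  touch x y = Q ! x ∧ does (y ∈? keys (M x))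

  touching : N → Tab Bool
  touching y = tab (λ x → touch x y)

  Conflict : N → N → Set
  Conflict x y = ∃ λ u → u ∈ keys (M x) × u ∈ keys (M y)

  touch⁻ : ∀ {x y} → touch x y ≡ true → Q ! x ≡ true × y ∈ keys (M x)
  touch⁻ {x} {y} e = let (a , b) = ∧-true⁻ e in a , does-true⁻ (y ∈? keys (M x)) b

  touch⁺ : ∀ {x y} → Q ! x ≡ true → y ∈ keys (M x) → touch x y ≡ true
  touch⁺ {x} {y} e p = ∧-true⁺ e (does-true (y ∈? keys (M x)) p)

  W : N → N → Maybe Wt
  W x y = if touch x y then just ρ else nothing

  same : N → N → Bool
  same x c = does (grp x ≟ᵇ grp c)

  open Product W (offered ∘ touching) same public using (prod; prod-sound; prod-full; prod-UK)

  Λ : N → List It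
  Λ x = take (2 ^ k) (prod x)

  active : List N
  active = filter (λ x → Q ! x Data.Bool.≟ true) allN

  open Group _≟ᵇ_ grp active (2 ^ k) public using (members; gather; gather-∈; ∈-gather)

  lists : Vec Bool j → Tab (List It)
  lists γ = tab (gather Λ γ)

  set : Tab (List It) → N → List N
  set g x = x ∷ keys (g ! x)

  module G (g : Tab (List It)) = Greedy _≟N_ (set g)

  chosen : Vec Bool j → Tab (List It) → List N
  chosen γ g = G.greedy g (members γ)

  isNext : N → Tab (List It) → Bool
  isNext v g = Q ! v ∧ does (v ∈? chosen (grp v) g)

  next : Tab Bool
  next = tab λ v → isNext v (lists (grp v))

  dominators : Vec Bool j → Tab (List It) → Tab (Maybe N)
  dominators γ g = tab λ y → List.head (filter (G.meets? g y) (chosen γ g))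

  W⁻ : ∀ {x y a} → W x y ≡ just a → Q ! x ≡ true × y ∈ keys (M x) × a ≡ ρ
  W⁻ {x} {y} e with touch x y in eq
  W⁻ refl | true = let (a , b) = touch⁻ eq in a , b , refl

  Λ-sound : ∀ {x c w} → (c , w) ∈ Λ x → Q ! c ≡ true × grp x ≡ grp c × Conflict x c
  Λ-sound {x} {c} p with prod-sound (∈-take⁻ (2 ^ k) (prod x) p)
  ... | y , a , b , e , q , e' , _ with W⁻ e | touch⁻ (trans (sym (tab-! (λ x → touch x y) c)) (offered-∈ q))
  ... | _ , y∈ , _ | Qc , y∈' = Qc , does-true⁻ (grp x ≟ᵇ grp c) e' , y , y∈ , y∈'

  Λ-length : ∀ x → length (Λ x) ≤ 2 ^ k
  Λ-length x = length-take≤ (2 ^ k) (prod x)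

  active-∈ : ∀ {x} → x ∈ active → Q ! x ≡ true
  active-∈ p = proj₂ (∈-filter⁻ (λ x → Q ! x Data.Bool.≟ true) {xs = allN} p)

  members-∈ : ∀ {γ x} → x ∈ members γ → Q ! x ≡ true × grp x ≡ γ
  members-∈ {γ} p = let (a , b) = ∈-filter⁻ (λ x → grp x ≟ᵇ γ) {xs = active} p in active-∈ a , b

  ∈-members : ∀ {γ x} → Q ! x ≡ true → grp x ≡ γ → x ∈ members γ
  ∈-members {γ} {x} e e' = ∈-filter⁺ (λ x → grp x ≟ᵇ γ) (∈-filter⁺ (λ x → Q ! x Data.Bool.≟ true) (∈-allN x) e) e'

  Linked : N → N → Set
  Linked x u = u ≡ x ⊎ Conflict x u

  set-linked : ∀ {γ x u} → u ∈ set (lists γ) x → Linked x u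
  set-linked (here e) = inj₁ e
  set-linked {γ} {x} (there p) with ∈-keys⁻ p
  ... | w , q = inj₂ (proj₂ (proj₂ (Λ-sound (gather-∈ Λ (subst (_ ∈_) (tab-! (gather Λ γ) x) q)))))

  dominators-sound : ∀ {γ v y} → dominators γ (lists γ) ! v ≡ just y →
                     y ∈ chosen γ (lists γ) × ∃ λ u → Linked v u × Linked y u
  dominators-sound {γ} {v} {y} e = answer (filter (Gr.meets? v) ch) refl
      (trans (sym (tab-! (λ y → List.head (filter (Gr.meets? y) ch)) v)) e)
    where
    module Gr = G (lists γ)
    ch = chosen γ (lists γ)
    answer : ∀ l → filter (Gr.meets? v) ch ≡ l → List.head l ≡ just y → y ∈ ch × ∃ λ u → Linked v u × Linked y u
    answer (y ∷ l) e refl with ∈-filter⁻ (Gr.meets? v) {xs = ch} (subst (y ∈_) (sym e) (here refl))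
    ... | y∈ , u , u∈v , u∈y = y∈ , u , set-linked u∈v , set-linked u∈y

  dominated : ∀ {v} → Q ! v ≡ true → ∃ λ y → dominators (grp v) (lists (grp v)) ! v ≡ just y × next ! y ≡ true
  dominated {v} Qv = answer (filter (Gr.meets? v) ch) refl
    where
    γ = grp v
    module Gr = G (lists γ)
    ch = chosen γ (lists γ)
    answer : ∀ l → filter (Gr.meets? v) ch ≡ l → ∃ λ y → dominators γ (lists γ) ! v ≡ just y × next ! y ≡ true
    answer [] e with Gr.greedy-maximal (members γ) (∈-members Qv refl) (here {x = v} refl)
    ... | y , y∈ , m with subst (y ∈_) e (∈-filter⁺ (Gr.meets? v) y∈ m)
    ... | ()
    answer (y ∷ l) e with ∈-filter⁻ (Gr.meets? v) {xs = ch} (subst (y ∈_) (sym e) (here refl))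
    ... | y∈ , _ with members-∈ (Gr.greedy⊆ (members γ) y∈)
    ... | Qy , e' = y , trans (tab-! (λ y → List.head (filter (Gr.meets? y) ch)) v) (cong List.head e) ,
      trans (tab-! (λ v → isNext v (lists (grp v))) y)
        (∧-true⁺ Qy (does-true (y ∈? chosen (grp y) (lists (grp y))) (subst (λ γ → y ∈ chosen γ (lists γ)) (sym e') y∈)))

  next-∈ : ∀ {y} → next ! y ≡ true → Q ! y ≡ true × y ∈ chosen (grp y) (lists (grp y))
  next-∈ {y} e = let (a , b) = ∧-true⁻ (trans (sym (tab-! (λ v → isNext v (lists (grp v))) y)) e) in
    a , does-true⁻ (y ∈? chosen (grp y) (lists (grp y))) b

  module Count (M-UK : ∀ x → UK (M x)) (1≤z : 1 ≤ z)
               (room : 2 ^ j * 2 ^ k ≤ K) (Q-heavy : ∀ x → Q ! x ≡ true → K ≤ length (M x))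
               (m : ℕ) (small : ∀ γ → length (members γ) ≤ m * 2 ^ k)
               (cap : ∀ γ → length (members γ) * 2 ^ k ≤ length slots) where

    -- A list below 2 ^ k comes from a product below `K`, which is complete. What remains is to
    -- exclude that the offer of the common node `u` was cut off.
    Λ-complete : ∀ {x c} → length (Λ x) < 2 ^ k → Q ! x ≡ true → Q ! c ≡ true → grp x ≡ grp c → Conflict x c →
                 c ∈ keys (Λ x)
    Λ-complete {x} {c} lt Qx Qc e (u , u∈x , u∈c) with take-full (2 ^ k) (prod x)
    ... | inj₁ e' = ⊥-elim (<-irrefl e' lt)
    ... | inj₂ (e' , lt') with prod-full x
    ... | inj₁ e'' = ⊥-elim (<⇒≱ lt' (≤-trans (≤-trans (m≤n*m (2 ^ k) (2 ^ j) {{>-nonZero (m^n>0 2 j)}}) room) (≤-reflexive (sym e''))))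
    ... | inj₂ (_ , full) = subst (λ l → c ∈ keys l) (sym e') (let (_ , q) = found in ∈-keys q)
      where
      v = touching u
      whole : take K (offered v) ≡ offered v
      whole = take-all K (offered v) (≤-trans (offered-length v) room)
      Wxu : W x u ≡ just ρ
      Wxu = cong (λ b → if b then just ρ else nothing) (touch⁺ Qx u∈x)
      pass : ∀ {c b} → (c , b) ∈ take (2 ^ k) (slice v (grp x)) → ∃ λ m → (c , m) ∈ prod x
      pass {c} {b} q = let (_ , eγ) = slice-∈ (∈-take⁻ (2 ^ k) (slice v (grp x)) q)
                           (m , r , _) = full {u} {ρ} {c} {b} Wxu (subst ((c , b) ∈_) (sym whole) (∈-offered q))
                                           (does-true (grp x ≟ᵇ grp c) (sym eγ))
                       in m , r
      found : ∃ λ m → (c , m) ∈ prod x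
      found with take-full (2 ^ k) (slice v (grp x))
      ... | inj₂ (e₁ , _) = pass (subst ((c , ρ) ∈_) (sym e₁)
              (∈-slice (trans (tab-! (λ x → touch x u) c) (touch⁺ Qc u∈c)) (sym e)))
      -- A truncated slice would put 2 ^ k distinct nodes into the product of `x`, more than it has.
      ... | inj₁ e = ⊥-elim (<⇒≱ lt' (subst (_≤ length (prod x)) e
              (UK-length (UK-take (2 ^ k) (slice-UK v (grp x))) pass)))

    Λ⊆set : ∀ {γ x c} → x ∈ members γ → c ∈ keys (Λ x) → c ∈ set (lists γ) x
    Λ⊆set {γ} {x} x∈ p with ∈-keys⁻ p
    ... | w , q = there (∈-keys (subst ((_ , w) ∈_) (sym (tab-! (gather Λ γ) x))
            (∈-gather Λ (∈-filter⁻ (λ x → grp x ≟ᵇ γ) {xs = active} x∈ .proj₁) (members-∈ x∈ .proj₂) (cap γ) (Λ-length x) q)))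

    long? : ∀ x → Dec (2 ^ k ≤ length (Λ x))
    long? x = 2 ^ k ≤? length (Λ x)

    -- At most `m` chosen nodes have long lists, since these are disjoint, have 2 ^ k entries, and
    -- lie among at most m * 2 ^ k members. At most 2 ^ h have short ones, since their sets `M x`
    -- are disjoint, have at least 2 ^ h elements, and lie among 2 ^ h * 2 ^ h nodes.
    chosen-length : ∀ γ → length (chosen γ (lists γ)) ≤ 2 ^ h + m
    chosen-length γ = ≤-trans (≤-reflexive (length-filter-split long? ch)) (≤-trans (≤-reflexive (+-comm (length longs) (length shorts))) (+-mono-≤ short-count long-count))
      where
      module Gr = G (lists γ)
      ch = chosen γ (lists γ)
      longs = filter long? ch
      shorts = filter (¬? ∘ long?) ch
      in-long : ∀ {x} → x ∈ longs → x ∈ members γ × 2 ^ k ≤ length (Λ x)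
      in-long p = let (a , b) = ∈-filter⁻ long? {xs = ch} p in Gr.greedy⊆ (members γ) a , b
      in-short : ∀ {x} → x ∈ shorts → x ∈ members γ × length (Λ x) < 2 ^ k
      in-short p = let (a , b) = ∈-filter⁻ (¬? ∘ long?) {xs = ch} p in Gr.greedy⊆ (members γ) a , ≰⇒> b
      long-count : length longs ≤ m
      long-count = *-cancelʳ-≤ (length longs) m (2 ^ k) {{>-nonZero (m^n>0 2 k)}} (≤-trans
        (disjoint-count (keys ∘ Λ)
          (AllPairs-map∈ (λ p q dis (a , b) → dis (Λ⊆set (proj₁ (in-long p)) a , Λ⊆set (proj₁ (in-long q)) b))
            (AllPairs-filter long? (Gr.greedy-disjoint (members γ))))
          (λ {x} _ → UK-take (2 ^ k) (prod-UK x))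
          (λ {x} p → ≤-trans (proj₂ (in-long p)) (≤-reflexive (sym (length-map proj₁ (Λ x)))))
          (λ {x} p q → let (w , r) = ∈-keys⁻ q ; (Qc , e , _) = Λ-sound r in
             ∈-members Qc (trans (sym e) (proj₂ (members-∈ (proj₁ (in-long p)))))))
        (small γ))
      short-count : length shorts ≤ 2 ^ h
      short-count = *-cancelʳ-≤ (length shorts) (2 ^ h) (2 ^ h) {{>-nonZero (m^n>0 2 h)}}
        (≤-trans (*-monoʳ-≤ (length shorts) (m≤n*m (2 ^ h) z {{>-nonZero 1≤z}})) (≤-trans
        (disjoint-count (keys ∘ M)
          (AllPairs-map∈ (λ {x} {y} p q dis (a , b) →
             let (x∈ , lt) = in-short p ; (y∈ , _) = in-short q ; (Qx , ex) = members-∈ x∈ ; (Qy , ey) = members-∈ y∈ in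
             -- If the balls met, `y` would occur in the complete list of `x`, hence in the set of
             -- `x`, and it always lies in its own set.
             dis (Λ⊆set x∈ (Λ-complete lt Qx Qy (trans ex (sym ey)) (_ , a , b)) , here refl))
            (AllPairs-filter (¬? ∘ long?) (Gr.greedy-disjoint (members γ))))
          (λ {x} _ → M-UK x)
          (λ {x} p → ≤-trans (Q-heavy x (proj₁ (members-∈ (proj₁ (in-short p))))) (≤-reflexive (sym (length-map proj₁ (M x)))))
          (λ {x} {y} _ _ → ∈-allN y))
        (≤-reflexive length-allN)))

    next-length : length (filter (λ x → next ! x Data.Bool.≟ true) allN) ≤ 2 ^ j * (2 ^ h + m)
    next-length = ≤-trans (unique-⊆-length (UP.filter⁺ (λ x → next ! x Data.Bool.≟ true) allN-unique)
        (λ {x} p → ∈-cM⁺ (λ γ → chosen γ (lists γ)) (allBits j) (∈-allBits (grp x))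
          (proj₂ (next-∈ (proj₂ (∈-filter⁻ (λ x → next ! x Data.Bool.≟ true) {xs = allN} p))))))
      (≤-trans (length-concatMap≤ _ (allBits j) (λ {γ} _ → chosen-length γ)) (≤-reflexive (cong (_* (2 ^ h + m)) (length-allBits j))))

≤-by : ∀ {x y} d → y ≡ x + d → x ≤ y
≤-by {x} d refl = m≤m+n x d

-- M t x is the ball of radius 2 ^ t about x, cut off at K nodes; x is heavy if it was cut off.
-- The table net t marks a net of the heavy nodes, and E t x lists estimates of the distances from x to that
-- net, found by few hops through the lists hopEdges t of edges known from the smaller scales.

module Net (k z a : ℕ) (A : Virt.N k z → Virt.N k z → Bool) where

  open Balls k z A public

  -- Each of these 2 ^ k groups has 2 ^ (3 k) nodes, so the lists of 2 ^ k entries of one group have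
  -- 2 ^ (4 k) = `D` entries together and can be gathered.
  grp₁ : N → Vec Bool k
  grp₁ (u , _) = Vec.take k u

  grp₂ : N → Vec Bool 0
  grp₂ _ = []

  heavy : ℕ → Tab Bool
  heavy t = tab (λ x → does (K ≤? length (M t x)))

  module R₁ (t : ℕ) = Ruling k z grp₁ (mkW 0) (heavy t) (M t)
  module R₂ (t : ℕ) = Ruling k z grp₂ (mkW 0) (R₁.next t) (M t)

  net : ℕ → Tab Bool
  net t = R₂.next t

  compose : Tab (Maybe N) → Tab (Maybe N) → N → Maybe N
  compose d₁ d₂ x = Maybe.maybe (d₂ !_) nothing (d₁ ! x)

  opaque
    dom : ℕ → N → Maybe N
    dom t x = compose (R₁.dominators t (grp₁ x) (R₁.lists t (grp₁ x))) (R₂.dominators t [] (R₂.lists t [])) x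

    dom-def : ∀ t x → dom t x ≡ compose (R₁.dominators t (grp₁ x) (R₁.lists t (grp₁ x))) (R₂.dominators t [] (R₂.lists t [])) x
    dom-def t x = refl

  start : Tab Bool → N → List It
  start s x = if s ! x then (x , mkW 0) ∷ [] else []

  hops : (N → List It) → Tab Bool → ℕ → N → List It
  hops rl s zero = start s
  hops rl s (suc i) = Product.prod (λ x y → findW y (rl x)) (hops rl s i) everything

  -- Three segments of 2 a + 4 hops each, as used in `acc-suc`.
  hopCount : ℕ
  hopCount = 6 * a + 12

  fromTab : Tab (Maybe Wt) → List It
  fromTab tb = concatMap (λ y → Maybe.maybe (λ w → (y , w) ∷ []) [] (tb ! y)) allN

  reverse : (N → List It) → N → Tab (Maybe Wt)
  reverse E x = tab (λ y → findW x (E y))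

  opaque
    mutual
      -- `E t` records at each node its distances to the net, but a detour also has to leave the net
      -- again. The reversed lists provide those edges.
      hopEdges : ℕ → N → List It
      hopEdges zero x = base x
      hopEdges (suc t) x = base x ++ (M t x ++ (E t x ++ (fromTab (reverse (E t) x) ++ entryTo (8 * 2 ^ t) (dom t x))))

      E : ℕ → N → List It
      E t = hops (hopEdges t) (net t) hopCount

    hopEdges-zero : ∀ x → hopEdges zero x ≡ base x
    hopEdges-zero x = refl

    hopEdges-suc : ∀ t x → hopEdges (suc t) x ≡ base x ++ (M t x ++ (E t x ++ (fromTab (reverse (E t) x) ++ entryTo (8 * 2 ^ t) (dom t x))))
    hopEdges-suc t x = refl

    E-def : ∀ t → E t ≡ hops (hopEdges t) (net t) hopCount
    E-def t = refl

  Source : ℕ → N → Set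
  Source t σ = net t ! σ ≡ true

  heavy⁺ : ∀ {t x} → Heavy t x → heavy t ! x ≡ true
  heavy⁺ {t} {x} p = trans (tab-! (λ x → does (K ≤? length (M t x))) x) (does-true (K ≤? length (M t x)) p)

  heavy⁻ : ∀ {t x} → heavy t ! x ≡ true → Heavy t x
  heavy⁻ {t} {x} e = does-true⁻ (K ≤? length (M t x)) (trans (sym (tab-! (λ x → does (K ≤? length (M t x))) x)) e)

  module Correct (A-sym : ∀ u v → A u v ≡ A v u) where

    open Symmetric A-sym public

    ball : ∀ t {x u} → u ∈ keys (M t x) → Reach (2 ^ t) x u
    ball t p = let (w , q) = ∈-keys⁻ p ; (ok , le) = M-ok t q in reach-mono le ok

    conflict-reach : ∀ t {x y u} → u ∈ keys (M t x) → u ∈ keys (M t y) → Reach (2 * 2 ^ t) x y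
    conflict-reach t p q = reach-mono (+-monoʳ-≤ (2 ^ t) (m≤m+n (2 ^ t) 0)) (reach-++ (ball t p) (reach-sym (ball t q)))

    linked-reach : ∀ t {x y} → (y ≡ x ⊎ ∃ λ u → u ∈ keys (M t x) × u ∈ keys (M t y)) → Reach (2 * 2 ^ t) x y
    linked-reach t (inj₁ refl) = reach-refl
    linked-reach t (inj₂ (u , p , q)) = conflict-reach t p q

    common-reach : ∀ t {x y u} → (u ≡ x ⊎ ∃ λ v → v ∈ keys (M t x) × v ∈ keys (M t u)) →
                   (u ≡ y ⊎ ∃ λ v → v ∈ keys (M t y) × v ∈ keys (M t u)) → Reach (4 * 2 ^ t) x y
    common-reach t p q = reach-mono (≤-reflexive (lemma (2 ^ t))) (reach-++ (linked-reach t p) (reach-sym (linked-reach t q)))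
      where lemma : ∀ r → 2 * r + 2 * r ≡ 4 * r
            lemma = solve-∀

    compose⁻ : ∀ {d₁ d₂ x σ} → compose d₁ d₂ x ≡ just σ → ∃ λ y → d₁ ! x ≡ just y × d₂ ! y ≡ just σ
    compose⁻ {d₁} {x = x} e with d₁ ! x
    ... | just y = y , refl , e

    -- In one pass a node and its dominator are linked to a common node, and a link joins centers of
    -- meeting balls, at distance at most 2 * 2 ^ t. Each of the two passes thus costs 4 * 2 ^ t.
    dom-reach : ∀ t {x σ} → dom t x ≡ just σ → Reach (8 * 2 ^ t) x σ
    dom-reach t {x} {σ} e =
      let (y , e₁ , e₂) = compose⁻ {R₁.dominators t (grp₁ x) (R₁.lists t (grp₁ x))} {R₂.dominators t [] (R₂.lists t [])} (trans (sym (dom-def t x)) e)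
          (_ , _ , p , q) = R₁.dominators-sound t e₁
          (_ , _ , p' , q') = R₂.dominators-sound t e₂
      in reach-mono (≤-reflexive (lemma (2 ^ t))) (reach-++ (common-reach t p q) (common-reach t p' q'))
      where lemma : ∀ r → 4 * r + 4 * r ≡ 8 * r
            lemma = solve-∀

    dom-heavy : ∀ t {x} → Heavy t x → ∃ λ σ → dom t x ≡ just σ × Source t σ
    dom-heavy t {x} hx =
      let (y , e , ny) = R₁.dominated t (heavy⁺ {t} {x} hx)
          (σ , e' , nσ) = R₂.dominated t {y} ny
      in σ , trans (dom-def t x) (trans (cong (Maybe.maybe (R₂.dominators t [] (R₂.lists t []) !_) nothing) e) e') , nσ

    module Sizes (4≤z : 4 ≤ z) where

      1≤z : 1 ≤ z
      1≤z = ≤-trans (s≤s z≤n) 4≤z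

      2^h≤K : 2 ^ h ≤ K
      2^h≤K = m≤n*m (2 ^ h) z {{>-nonZero 1≤z}}

      2^h≡ : 2 ^ k * 2 ^ k ≡ 2 ^ h
      2^h≡ = sym (^-distribˡ-+-* 2 k k)

      group-size : ∀ t γ → length (R₁.members t γ) ≤ 2 ^ h * 2 ^ k
      group-size t γ = ≤-trans (unique-⊆-length (UP.filter⁺ (λ x → grp₁ x ≟ᵇ γ) (UP.filter⁺ (λ x → heavy t ! x Data.Bool.≟ true) allN-unique)) inside)
          (≤-trans (length-concatMap≤ (λ u → List.map ((γ Vec.++ u) ,_) (allBits h)) (allBits k)
              (λ _ → ≤-reflexive (trans (length-map _ (allBits h)) (length-allBits h))))
            (≤-reflexive (trans (cong (_* 2 ^ h) (length-allBits k)) (*-comm (2 ^ k) (2 ^ h)))))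
        where
        inside : ∀ {x} → x ∈ R₁.members t γ → x ∈ concatMap (λ u → List.map ((γ Vec.++ u) ,_) (allBits h)) (allBits k)
        inside {u , v} p = ∈-cM⁺ (λ u → List.map ((γ Vec.++ u) ,_) (allBits h)) (allBits k) (∈-allBits (Vec.drop k u))
          (subst (λ u' → (u , v) ∈ List.map (u' ,_) (allBits h))
            (trans (sym (take++drop≡id k u)) (cong (Vec._++ Vec.drop k u) (proj₂ (R₁.members-∈ t p))))
            (∈-map⁺ (u ,_) (∈-allBits v)))

      module C₁ (t : ℕ) = R₁.Count t (M-UK t) 1≤z (≤-trans (≤-reflexive 2^h≡) 2^h≤K) (λ x e → heavy⁻ {t} {x} e) (2 ^ h)
        (group-size t)
        (λ γ → ≤-trans (*-monoˡ-≤ (2 ^ k) (group-size t γ)) (≤-trans (≤-reflexive (trans (*-assoc (2 ^ h) _ _) (cong (2 ^ h *_) 2^h≡)))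
          (≤-trans (m≤m*n (2 ^ h * 2 ^ h) z {{>-nonZero 1≤z}}) (≤-reflexive (sym length-slots)))))

      second-size : ∀ t γ → length (R₂.members t γ) ≤ (2 * 2 ^ h) * 2 ^ k
      second-size t γ = ≤-trans (length-filter (λ x → grp₂ x ≟ᵇ γ) (R₂.active t)) (≤-trans (C₁.next-length t)
        (≤-reflexive (trans (*-comm (2 ^ k) _) (cong (λ m → (2 ^ h + m) * 2 ^ k) (sym (+-identityʳ (2 ^ h)))))))

      second-cap : ∀ t γ → length (R₂.members t γ) * 2 ^ k ≤ length slots
      second-cap t γ = ≤-trans (*-monoˡ-≤ (2 ^ k) (second-size t γ))
        (≤-trans (≤-reflexive (trans (*-assoc (2 * 2 ^ h) (2 ^ k) (2 ^ k)) (trans (cong (2 * 2 ^ h *_) 2^h≡) (lemma (2 ^ h)))))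
        (≤-trans (*-monoʳ-≤ (2 ^ h * 2 ^ h) (≤-trans (s≤s (s≤s z≤n)) 4≤z)) (≤-reflexive (sym length-slots))))
        where
        lemma : ∀ s → 2 * s * s ≡ s * s * 2
        lemma = solve-∀

      module C₂ (t : ℕ) = R₂.Count t (M-UK t) 1≤z
        (≤-trans (≤-reflexive (*-identityˡ (2 ^ k))) (≤-trans (≤-trans (m≤m*n (2 ^ k) (2 ^ k) {{>-nonZero (m^n>0 2 k)}}) (≤-reflexive 2^h≡)) 2^h≤K))
        (λ x e → heavy⁻ {t} {x} (proj₁ (R₁.next-∈ t {x} e))) (2 * 2 ^ h) (second-size t) (second-cap t)

      sources-length : ∀ t → length (filter (λ x → net t ! x Data.Bool.≟ true) allN) ≤ 3 * 2 ^ h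
      sources-length t = ≤-trans (C₂.next-length t) (≤-reflexive (lemma (2 ^ h)))
        where lemma : ∀ s → 1 * (s + 2 * s) ≡ 3 * s
              lemma = solve-∀

-- An estimate w of a distance r at scale t will satisfy a * w ≤ Err 24 a (slack t) (2 ^ t) r.  A detour
-- through one net node costs at most 48 * 2 ^ t; a path of length r > a * 2 ^ t / 2 needs up to three
-- detours, and the excess over 24 * 2 ^ (t + 1) is charged to the relative error 192 / a of the scale.

opaque

  slack : ℕ → ℕ
  slack t = 192 * t

  Err : ℕ → ℕ → ℕ → ℕ → ℕ → ℕ
  Err β a T ρ r = (a + T) * r + a * (β * ρ)

  Err-def : ∀ β a T ρ r → Err β a T ρ r ≡ (a + T) * r + a * (β * ρ)
  Err-def β a T ρ r = refl

  slack-def : ∀ t → slack t ≡ 192 * t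
  slack-def t = refl

  slack-mono : ∀ t → slack t ≤ slack (suc t)
  slack-mono t = *-monoʳ-≤ 192 (n≤1+n t)

  exact-error : ∀ {β a T ρ r w} → w ≤ r → a * w ≤ Err β a T ρ r
  exact-error {β} {a} {T} {ρ} {r} {w} le = ≤-trans (*-monoʳ-≤ a le) (≤-trans (*-monoˡ-≤ r (m≤m+n a T)) (m≤m+n ((a + T) * r) (a * (β * ρ))))

  Err-mono : ∀ β a T ρ {r r'} → r ≤ r' → Err β a T ρ r ≤ Err β a T ρ r'
  Err-mono β a T ρ le = +-monoˡ-≤ (a * (β * ρ)) (*-monoʳ-≤ (a + T) le)

  -- 48 = 8 + 24 + 16: the edge to the net costs 8 ρ, the estimate has additive error 24 ρ, and the
  -- 8 ρ by which the estimated distance grows are stretched by at most 1 + T / a ≤ 2.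
  segment-error : ∀ {a T p m q ρ w} → T ≤ a → a * w ≤ Err 24 a T ρ (m + 8 * ρ) →
                  a * (p + (8 * ρ + (w + q))) ≤ Err 48 a T ρ (p + (m + q))
  segment-error {a} {T} {p} {m} {q} {ρ} {w} T≤a le with m≤n⇒∃[o]m+o≡n T≤a
  ... | e , refl = ≤-trans (≤-reflexive (expand (T + e) p q ρ w))
        (≤-trans (+-monoʳ-≤ ((T + e) * (p + 8 * ρ + q)) le) (≤-by (T * p + T * q + 8 * e * ρ) (rest T e p m q ρ)))
    where
    expand : ∀ a p q ρ w → a * (p + (8 * ρ + (w + q))) ≡ a * (p + 8 * ρ + q) + a * w
    expand = solve-∀
    rest : ∀ T e p m q ρ → (T + e + T) * (p + (m + q)) + (T + e) * (48 * ρ) ≡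
           (T + e) * (p + 8 * ρ + q) + ((T + e + T) * (m + 8 * ρ) + (T + e) * (24 * ρ)) + (T * p + T * q + 8 * e * ρ)
    rest = solve-∀

  one-error : ∀ {a t ρ r w} → a * w ≤ Err 48 a (slack t) ρ r → a * w ≤ Err 24 a (slack (suc t)) (2 * ρ) r
  one-error {a} {t} {ρ} {r} {w} le = ≤-trans le (+-mono-≤ (*-monoˡ-≤ r (+-monoʳ-≤ a (slack-mono t))) (≤-reflexive (cong (a *_) (*-assoc 24 2 ρ))))

  -- Three detours cost 144 ρ, and the next scale allows 24 (2 ρ) = 48 ρ. The remaining 96 a ρ is at
  -- most 192 times the length of the path, by the assumption that the path is long.
  three-errors : ∀ {a t r₁ r₂ r₃ ρ w₁ w₂ w₃} → a * ρ ≤ 2 * (r₁ + (r₂ + r₃)) →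
                 a * w₁ ≤ Err 48 a (slack t) ρ r₁ → a * w₂ ≤ Err 48 a (slack t) ρ r₂ → a * w₃ ≤ Err 48 a (slack t) ρ r₃ →
                 a * (w₁ + (w₂ + w₃)) ≤ Err 24 a (slack (suc t)) (2 * ρ) (r₁ + (r₂ + r₃))
  three-errors {a} {t} {r₁} {r₂} {r₃} {ρ} {w₁} {w₂} {w₃} big e₁ e₂ e₃ = begin
    a * (w₁ + (w₂ + w₃))                                                    ≡⟨ expand a w₁ w₂ w₃ ⟩
    a * w₁ + (a * w₂ + a * w₃)                                              ≤⟨ +-mono-≤ e₁ (+-mono-≤ e₂ e₃) ⟩
    ((a + T) * r₁ + a * (48 * ρ)) + (((a + T) * r₂ + a * (48 * ρ)) + ((a + T) * r₃ + a * (48 * ρ)))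
                                                                            ≡⟨ collect a T r₁ r₂ r₃ ρ ⟩
    (a + T) * (r₁ + (r₂ + r₃)) + a * (48 * ρ) + 96 * (a * ρ)                ≤⟨ +-monoʳ-≤ ((a + T) * (r₁ + (r₂ + r₃)) + a * (48 * ρ)) (*-monoʳ-≤ 96 big) ⟩
    (a + T) * (r₁ + (r₂ + r₃)) + a * (48 * ρ) + 96 * (2 * (r₁ + (r₂ + r₃))) ≡⟨ final a T (r₁ + (r₂ + r₃)) ρ ⟩
    (a + (192 + T)) * (r₁ + (r₂ + r₃)) + a * (24 * (2 * ρ))                 ≡⟨ cong (λ T → (a + T) * (r₁ + (r₂ + r₃)) + a * (24 * (2 * ρ))) (sym (*-suc 192 t)) ⟩
    (a + slack (suc t)) * (r₁ + (r₂ + r₃)) + a * (24 * (2 * ρ))             ∎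
    where
    open ≤-Reasoning
    T : ℕ
    T = 192 * t
    expand : ∀ a w₁ w₂ w₃ → a * (w₁ + (w₂ + w₃)) ≡ a * w₁ + (a * w₂ + a * w₃)
    expand = solve-∀
    collect : ∀ a T r₁ r₂ r₃ ρ → ((a + T) * r₁ + a * (48 * ρ)) + (((a + T) * r₂ + a * (48 * ρ)) + ((a + T) * r₃ + a * (48 * ρ)))
              ≡ (a + T) * (r₁ + (r₂ + r₃)) + a * (48 * ρ) + 96 * (a * ρ)
    collect = solve-∀
    final : ∀ a T r ρ → (a + T) * r + a * (48 * ρ) + 96 * (2 * r) ≡ (a + (192 + T)) * r + a * (24 * (2 * ρ))
    final = solve-∀

-- Accuracy of the distances to the net

module Accuracy (k z a : ℕ) (A : Virt.N k z → Virt.N k z → Bool) (A-sym : ∀ u v → A u v ≡ A v u) (4≤z : 4 ≤ z) where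

  open Net k z a A public
  open Correct A-sym public
  open Sizes 4≤z public

  start-∈ : ∀ {s x c w} → (c , w) ∈ start s x → s ! x ≡ true × c ≡ x × w ≡ mkW 0
  start-∈ {s} {x} p with s ! x
  start-∈ (here refl) | true = refl , refl , refl

  ∈-start : ∀ {s x} → s ! x ≡ true → (x , mkW 0) ∈ start s x
  ∈-start {s} {x} e = subst (λ b → (x , mkW 0) ∈ (if b then (x , mkW 0) ∷ [] else [])) (sym e) (here refl)

  fromTab-∈ : ∀ {tb y w} → (y , w) ∈ fromTab tb → tb ! y ≡ just w
  fromTab-∈ {tb} p with ∈-cM⁻ (λ y → Maybe.maybe (λ w → (y , w) ∷ []) [] (tb ! y)) allN p
  ... | y , _ , q with tb ! y in eq
  fromTab-∈ p | y , _ , here refl | just w = eq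

  ∈-fromTab : ∀ {tb y w} → tb ! y ≡ just w → (y , w) ∈ fromTab tb
  ∈-fromTab {tb} {y} {w} e = ∈-cM⁺ (λ y → Maybe.maybe (λ w → (y , w) ∷ []) [] (tb ! y)) allN (∈-allN y)
    (subst (λ u → (y , w) ∈ Maybe.maybe (λ w → (y , w) ∷ []) [] u) (sym e) (here refl))

  module Hops (rl : N → List It) (s : Tab Bool) (self : ∀ x → (x , mkW 0) ∈ rl x)
              (few : length (filter (λ x → s ! x Data.Bool.≟ true) allN) < K) where

    module P (i : ℕ) = Product (λ x y → findW y (rl x)) (hops rl s i) everything

    record EdgeW (x y : N) (b : ℕ) : Set where
      constructor edgeOf
      field
        weight : Wt
        found : findW y (rl x) ≡ just weight
        bounded : toℕ weight ≤ b

    edgeW : ∀ {x y w b} → (y , w) ∈ rl x → toℕ w ≤ b → EdgeW x y b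
    edgeW p le = let (w' , e , le') = ∈-findW _ p in edgeOf w' e (≤-trans le' le)

    hops-source : ∀ i {x c w} → (c , w) ∈ hops rl s i x → s ! c ≡ true
    hops-source zero {x} p = let (e , e' , _) = start-∈ {s} {x} p in subst (λ c → s ! c ≡ true) (sym e') e
    hops-source (suc i) p = let (_ , _ , _ , _ , q , _) = P.prod-sound i p in hops-source i q

    hops-UK : ∀ i x → UK (hops rl s i x)
    hops-UK zero x with s ! x
    ... | true = [] ∷ []
    ... | false = []
    hops-UK (suc i) x = P.prod-UK i x

    hops-length : ∀ i x → length (hops rl s i x) ≤ length (filter (λ x → s ! x Data.Bool.≟ true) allN)
    hops-length i x = subst (_≤ length (filter (λ x → s ! x Data.Bool.≟ true) allN)) (length-map proj₁ (hops rl s i x))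
      (unique-⊆-length (hops-UK i x) λ {c} p → ∈-filter⁺ (λ x → s ! x Data.Bool.≟ true) (∈-allN c)
        (let (w , q) = ∈-keys⁻ p in hops-source i q))

    -- The sources are fewer than `K`, so that no list of estimates is ever cut off and `prod-full`
    -- always yields its complete case.
    hops-short : ∀ i x → length (hops rl s i x) < K
    hops-short i x = ≤-<-trans (hops-length i x) few

    hops-step : ∀ i {x y c b m} → EdgeW x y b → (c , m) ∈ hops rl s i y →
                ∃ λ m' → (c , m') ∈ hops rl s (suc i) x × toℕ m' ≤ b + toℕ m
    hops-step i {x} {y} {c} {b} {m} (edgeOf w e le) p with P.prod-full i x
    ... | inj₁ e' = ⊥-elim (<-irrefl e' (hops-short (suc i) x))
    ... | inj₂ (_ , full) with full e (subst ((c , m) ∈_) (sym (take-all K (hops rl s i y) (<⇒≤ (hops-short i y)))) p) refl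
    ... | m' , q , le' = m' , q , ≤-trans le' (+-monoˡ-≤ (toℕ m) le)

    hops-walk : ∀ i {x σ w} → s ! σ ≡ true → Walks EdgeW i x σ w → ∃ λ m → (σ , m) ∈ hops rl s i x × toℕ m ≤ w
    hops-walk zero {σ = σ} e nil = mkW 0 , ∈-start {s} e , mkW≤ 0
    -- A walk with fewer steps than allowed is padded with the self loop of weight 0.
    hops-walk (suc i) {x} e nil =
      let (m , p , le) = hops-walk i {x} e nil
          (m' , q , le') = hops-step i {b = 0} (edgeW (self x) (mkW≤ 0)) p
      in m' , q , ≤-trans le' le
    hops-walk (suc i) e (cons {a = b} ed r) =
      let (m , p , le) = hops-walk i e r
          (m' , q , le') = hops-step i ed p
      in m' , q , ≤-trans le' (+-monoʳ-≤ b le)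

    hops-ok : (∀ {x y w} → (y , w) ∈ rl x → Ok x y w) → ∀ i {x c w} → (c , w) ∈ hops rl s i x → Ok x c w
    hops-ok rl-ok zero {x} p = let (_ , e' , e'') = start-∈ {s} {x} p in subst₂ (Ok x) (sym e') (sym e'') (ok-clamp reach-refl)
    hops-ok rl-ok (suc i) p =
      let (y , a , b , e , q , _ , e') = P.prod-sound i p
      in subst (Ok _ _) (sym e') (ok-clamp (reach-++ (rl-ok (findW-∈ _ e)) (hops-ok rl-ok i q)))

  few : 4 ≤ z → ∀ t → length (filter (λ x → net t ! x Data.Bool.≟ true) allN) < K
  few 4≤z t = <-≤-trans (≤-<-trans (sources-length t) (*-monoˡ-< (2 ^ h) {{>-nonZero (m^n>0 2 h)}} {3} {4} ≤-refl))
    (*-monoˡ-≤ (2 ^ h) 4≤z)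

  hopEdges-split : ∀ t {x i} → i ∈ hopEdges (suc t) x → i ∈ base x ⊎ i ∈ M t x ⊎ i ∈ E t x ⊎ i ∈ fromTab (reverse (E t) x) ⊎ i ∈ entryTo (8 * 2 ^ t) (dom t x)
  hopEdges-split t {x} {i} p = Sum.map₂ (Sum.map₂ (Sum.map₂ (∈-++⁻ (fromTab (reverse (E t) x))) ∘ ∈-++⁻ (E t x)) ∘ ∈-++⁻ (M t x))
    (∈-++⁻ (base x) (subst (i ∈_) (hopEdges-suc t x) p))

  hopEdges-join : ∀ t {x i} → i ∈ base x ⊎ i ∈ M t x ⊎ i ∈ E t x ⊎ i ∈ fromTab (reverse (E t) x) ⊎ i ∈ entryTo (8 * 2 ^ t) (dom t x) → i ∈ hopEdges (suc t) x
  hopEdges-join t {x} {i} q = subst (i ∈_) (sym (hopEdges-suc t x)) (go q)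
    where
    go : _ → i ∈ (base x ++ (M t x ++ (E t x ++ (fromTab (reverse (E t) x) ++ entryTo (8 * 2 ^ t) (dom t x)))))
    go (inj₁ p) = ∈-++⁺ˡ p
    go (inj₂ (inj₁ p)) = ∈-++⁺ʳ (base x) (∈-++⁺ˡ p)
    go (inj₂ (inj₂ (inj₁ p))) = ∈-++⁺ʳ (base x) (∈-++⁺ʳ (M t x) (∈-++⁺ˡ p))
    go (inj₂ (inj₂ (inj₂ (inj₁ p)))) = ∈-++⁺ʳ (base x) (∈-++⁺ʳ (M t x) (∈-++⁺ʳ (E t x) (∈-++⁺ˡ p)))
    go (inj₂ (inj₂ (inj₂ (inj₂ p)))) = ∈-++⁺ʳ (base x) (∈-++⁺ʳ (M t x) (∈-++⁺ʳ (E t x) (∈-++⁺ʳ (fromTab (reverse (E t) x)) p)))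

  hopEdges-base : ∀ t {x i} → i ∈ base x → i ∈ hopEdges t x
  hopEdges-base zero {x} {i} p = subst (i ∈_) (sym (hopEdges-zero x)) p
  hopEdges-base (suc t) p = hopEdges-join t (inj₁ p)

  module H (t : ℕ) = Hops (hopEdges t) (net t) (λ x → hopEdges-base t (here refl)) (few 4≤z t)

  hopEdges-edge : ∀ t {x y} → A x y ≡ true → H.EdgeW t x y 1
  hopEdges-edge t {x} {y} e = H.edgeW t {x} {y} (hopEdges-base t (there (∈-nbrs e))) (mkW≤ 1)

  hopEdges-ball : ∀ t {x y w b} → (y , w) ∈ M t x → toℕ w ≤ b → H.EdgeW (suc t) x y b
  hopEdges-ball t {x} {y} p le = H.edgeW (suc t) {x} {y} (hopEdges-join t (inj₂ (inj₁ p))) le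

  hopEdges-back : ∀ t {x σ w b} → (σ , w) ∈ E t x → toℕ w ≤ b → H.EdgeW (suc t) σ x b
  hopEdges-back t {x} {σ} p le =
    let (w' , e , le') = ∈-findW (E t x) p
    in H.edgeW (suc t) {σ} {x} (hopEdges-join t (inj₂ (inj₂ (inj₂ (inj₁
         (∈-fromTab {reverse (E t) σ} (trans (tab-! (λ y → findW σ (E t y)) x) e))))))) (≤-trans le' le)

  hopEdges-dom : ∀ t {x σ} → dom t x ≡ just σ → H.EdgeW (suc t) x σ (8 * 2 ^ t)
  hopEdges-dom t {x} {σ} e = H.edgeW (suc t) {x} {σ} (hopEdges-join t (inj₂ (inj₂ (inj₂ (inj₂ (∈-entryTo e)))))) (mkW≤ (8 * 2 ^ t))

  E-walk : ∀ t {x σ w} → Source t σ → Walks (H.EdgeW t) hopCount x σ w → ∃ λ m → (σ , m) ∈ E t x × toℕ m ≤ w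
  E-walk t {x} {σ} {w} src p = subst (λ l → ∃ λ m → (σ , m) ∈ l x × toℕ m ≤ w) (sym (E-def t)) (H.hops-walk t hopCount src p)

  E-length : ∀ t x → length (E t x) ≤ length (filter (λ x → net t ! x Data.Bool.≟ true) allN)
  E-length t x = subst (λ l → length (l x) ≤ length (filter (λ x → net t ! x Data.Bool.≟ true) allN)) (sym (E-def t)) (H.hops-length t hopCount x)

  hopEdges-ok : ∀ t {x y w} → (y , w) ∈ hopEdges t x → Ok x y w
  E-ok : ∀ t {x y w} → (y , w) ∈ E t x → Ok x y w
  hopEdges-ok zero {x} {y} {w} p = proj₁ (base-ok (subst ((y , w) ∈_) (hopEdges-zero x) p))
  hopEdges-ok (suc t) {x} {y} {w} p = [ proj₁ ∘ base-ok , [ proj₁ ∘ M-ok t , [ E-ok t , [ back , domed ]′ ]′ ]′ ]′ (hopEdges-split t p)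
    where
    back : (y , w) ∈ fromTab (reverse (E t) x) → Ok x y w
    back q = reach-sym (E-ok t (findW-∈ (E t y) (trans (sym (tab-! (λ y → findW x (E t y)) y)) (fromTab-∈ {reverse (E t) x} q))))
    domed : (y , w) ∈ entryTo (8 * 2 ^ t) (dom t x) → Ok x y w
    domed q = let (e , e') = entryTo-∈ q in subst (Ok x y) (sym e') (ok-clamp (dom-reach t {x} {y} e))
  E-ok t {x} {y} {w} p = H.hops-ok t (hopEdges-ok t) hopCount (subst (λ l → (y , w) ∈ l x) (E-def t) p)

  -- The hop count is the same at every scale, so accuracy is claimed only up to distance a * 2 ^ t,
  -- a range that doubles with the scale.
  Acc : ℕ → Set
  Acc t = ∀ {x σ r} → Source t σ → Reach r x σ → r ≤ a * 2 ^ t →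
          ∃ λ w → (σ , w) ∈ E t x × a * toℕ w ≤ Err 24 a (slack t) (2 ^ t) r

  Light? : ∀ t x → Light t x ⊎ Heavy t x
  Light? t x with length (M t x) <? K
  ... | yes p = inj₁ p
  ... | no p = inj₂ (≮⇒≥ p)

  module Segment (t : ℕ) (acc : Acc t) (T≤a : slack t ≤ a) where

    ρ = 2 ^ t
    W = Walks (H.EdgeW (suc t))

    path-start : ∀ {P x y d} → Path P x y (suc d) → P x
    path-start (cons p _ _) = p

    light-edge : ∀ {x y d} → Light t x → d ≤ ρ → Path Always x y d → H.EdgeW (suc t) x y d
    light-edge {x} {y} {d} li le p = let (w , w∈ , w≤) = M-exact t li le (path-reach p) in hopEdges-ball t {x} {y} w∈ w≤

    light-run : ∀ m {x y d} → Path (Light t) x y d → d ≤ m * ρ → W m x y d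
    light-run zero nil _ = nil
    light-run (suc m) {d = zero} nil _ = nil
    light-run (suc m) {x} {y} {suc d} p le = answer (suc d ≤? ρ)
      where
      answer : Dec (suc d ≤ ρ) → W (suc m) x y (suc d)
      answer (yes d≤ρ) = walks-mono (s≤s z≤n) (one (light-edge (path-start p) d≤ρ (forget p)))
      answer (no d≰ρ) =
        let ρ≤ = <⇒≤ (≰⇒> d≰ρ)
            (u , q , r) = split ρ (subst (Path (Light t) x y) (sym (m+[n∸m]≡n ρ≤)) p)
        in subst (W (suc m) x y) (m+[n∸m]≡n ρ≤) (cons (light-edge {x} {u} (path-start p) ≤-refl (forget q))
             (light-run m r (m≤n+o⇒m∸n≤o (suc d) ρ le)))

    before-run : ∀ m {x u p} → Before (Light t) x u p → p ≤ m * ρ → W (m + 1) x u p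
    before-run m (inj₁ (refl , refl)) le = nil
    before-run m (inj₂ (u' , p' , refl , r , _ , e)) le = subst (W (m + 1) _ _) (+-comm p' 1)
      (walks-++ (light-run m r (≤-trans (n≤1+n p') le)) (one (hopEdges-edge (suc t) e)))

    after-run : ∀ m {u y q} → After (Light t) u y q → q ≤ m * ρ → W (suc m) u y q
    after-run m (inj₁ (refl , refl)) le = nil
    after-run m (inj₂ (u' , q' , refl , e , r , _)) le = cons (hopEdges-edge (suc t) e) (light-run m r (≤-trans (n≤1+n q') le))

    -- The walk follows the light prefix by jumps of length ρ, goes from the first heavy vertex to
    -- its net node, from there straight to the last heavy vertex, and on along the light suffix.
    -- This makes a + 1 hops, two hops for the detour, and a + 1 hops. The 8 ρ in the hypothesis
    -- keep the distance from the net node within the range of `Acc`.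
    segment : ∀ {x y d} → Path Always x y d → d + 8 * ρ ≤ a * ρ →
              ∃ λ w → W (2 * a + 4) x y w × a * w ≤ Err 48 a (slack t) ρ d
    segment {x} {y} {d} path le = [ all-light , mixed ]′ (scan (λ {x} _ → Light? t x) path tt)
      where
      d≤ : d ≤ a * ρ
      d≤ = ≤-trans (m≤m+n d (8 * ρ)) le
      Goal = ∃ λ w → W (2 * a + 4) x y w × a * w ≤ Err 48 a (slack t) ρ d
      all-light : Path (Light t) x y d × Light t y → Goal
      all-light (p , _) = d , walks-mono (≤-trans (m≤m+n a (a + 0)) (m≤m+n (2 * a) 4)) (light-run a p d≤) , exact-error ≤-refl
      count : ∀ a → (a + 1) + suc (suc (suc a)) ≡ 2 * a + 4
      count = solve-∀
      mixed : Sections (Light t) (Heavy t) x y d → Goal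
      mixed (sections f l p m q total bef hf mid hl aft) =
        let (σ , e , src) = dom-heavy t hf
            (w , w∈ , w≤) = acc {l} {σ} {m + 8 * ρ} src (reach-++ (reach-sym (path-reach mid)) (dom-reach t {f} {σ} e)) m≤
            wt : ℕ
            wt = p + (8 * ρ + (toℕ w + q))
            walk : W (a + 1 + suc (suc (suc a))) x y wt
            walk = walks-++ {i = a + 1} {j = suc (suc (suc a))} (before-run a bef p≤)
                     (cons {y = σ} (hopEdges-dom t {f} {σ} e) (cons {y = l} (hopEdges-back t {l} {σ} w∈ ≤-refl) (after-run a aft q≤)))
        in wt , subst (λ j → W j x y wt) (count a) walk ,
           subst (λ d → a * wt ≤ Err 48 a (slack t) ρ d) total (segment-error {a} {slack t} {p} {m} {q} {ρ} {toℕ w} T≤a w≤)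
        where
        m≤ : m + 8 * ρ ≤ a * ρ
        m≤ = ≤-trans (+-monoˡ-≤ (8 * ρ) (≤-trans (m≤m+n m q) (≤-trans (m≤n+m (m + q) p) (≤-reflexive total)))) le
        p≤ : p ≤ a * ρ
        p≤ = ≤-trans (m≤m+n p (m + q)) (≤-trans (≤-reflexive total) d≤)
        q≤ : q ≤ a * ρ
        q≤ = ≤-trans (m≤n+m q m) (≤-trans (m≤n+m (m + q) p) (≤-trans (≤-reflexive total) d≤))

    acc-suc : 24 ≤ a → Acc (suc t)
    acc-suc 24≤a {x} {σ} {r} src (d , d≤r , path) r≤ = answer (d ≤? L)
      where
      -- The greatest length that `segment` accepts. As a ≥ 24 gives 16 ρ ≤ L, the range 2 a ρ = 2 L
      -- + 16 ρ of the next scale is covered by three such segments.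
      L = (a ∸ 8) * ρ
      aρ : a * ρ ≡ L + 8 * ρ
      aρ = trans (cong (_* ρ) (sym (m∸n+n≡m (≤-trans (m≤m+n 8 16) 24≤a)))) (*-distribʳ-+ ρ (a ∸ 8) 8)
      L-fits : ∀ {d} → d ≤ L → d + 8 * ρ ≤ a * ρ
      L-fits le = ≤-trans (+-monoˡ-≤ (8 * ρ) le) (≤-reflexive (sym aρ))
      16≤ : 16 ≤ a ∸ 8
      16≤ = ∸-monoˡ-≤ 8 24≤a
      2a≤3L : a * (2 * ρ) ≤ L + (L + L)
      2a≤3L = begin
        a * (2 * ρ)                 ≡⟨ l₁ a ρ ⟩
        2 * (a * ρ)                 ≡⟨ cong (2 *_) aρ ⟩
        2 * (L + 8 * ρ)             ≡⟨ l₂ L ρ ⟩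
        L + (L + 16 * ρ)            ≤⟨ +-monoʳ-≤ L (+-monoʳ-≤ L (*-monoˡ-≤ ρ 16≤)) ⟩
        L + (L + L)                 ∎
        where
        open ≤-Reasoning
        l₁ : ∀ a ρ → a * (2 * ρ) ≡ 2 * (a * ρ)
        l₁ = solve-∀
        l₂ : ∀ L ρ → 2 * (L + 8 * ρ) ≡ L + (L + 16 * ρ)
        l₂ = solve-∀
      aρ≤2L : a * ρ ≤ 2 * L
      aρ≤2L = begin
        a * ρ       ≡⟨ aρ ⟩
        L + 8 * ρ   ≤⟨ +-monoʳ-≤ L (*-monoˡ-≤ ρ (≤-trans (m≤m+n 8 8) 16≤)) ⟩
        L + L       ≡⟨ cong (L +_) (sym (+-identityʳ L)) ⟩
        2 * L       ∎
        where open ≤-Reasoning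
      Goal = ∃ λ w → (σ , w) ∈ E (suc t) x × a * toℕ w ≤ Err 24 a (slack (suc t)) (2 ^ suc t) r
      done : ∀ {j w} → j ≤ hopCount → W j x σ w → a * w ≤ Err 24 a (slack (suc t)) (2 * ρ) d → Goal
      done {j} {w} j≤ wk le =
        let (m , m∈ , m≤) = E-walk (suc t) src (walks-mono j≤ wk)
        in m , m∈ , ≤-trans (*-monoʳ-≤ a m≤) (≤-trans le (Err-mono 24 a (slack (suc t)) (2 * ρ) d≤r))
      answer : Dec (d ≤ L) → Goal
      answer (yes d≤L) =
        let (w , wk , le) = segment path (L-fits d≤L)
        in done (≤-trans (+-mono-≤ (*-monoˡ-≤ a (m≤m+n 2 4)) (m≤m+n 4 8)) ≤-refl) wk
             (one-error {a} {t} {ρ} {d} {w} le)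
      answer (no d≰L) =
        let L<d = ≰⇒> d≰L
            (u , _ , p₁ , p₂₃) = split-at {Always} L (<⇒≤ L<d) tt path
            r' = d ∸ L
            (v , _ , p₂ , p₃) = split-at {Always} (r' ⊓ L) (m⊓n≤m r' L) tt p₂₃
            (w₁ , k₁ , e₁) = segment p₁ (L-fits ≤-refl)
            (w₂ , k₂ , e₂) = segment p₂ (L-fits (m⊓n≤n r' L))
            (w₃ , k₃ , e₃) = segment p₃ (L-fits (third r' L (m≤n+o⇒m∸n≤o d L (≤-trans d≤r (≤-trans r≤ 2a≤3L)))))
            total : L + ((r' ⊓ L) + (r' ∸ (r' ⊓ L))) ≡ d
            total = trans (cong (L +_) (m+[n∸m]≡n (m⊓n≤m r' L))) (m+[n∸m]≡n (<⇒≤ L<d))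
        in done (≤-reflexive (hop-count a)) (walks-++ k₁ (walks-++ k₂ k₃))
             (subst (λ d → a * (w₁ + (w₂ + w₃)) ≤ Err 24 a (slack (suc t)) (2 * ρ) d) total
               (three-errors {a} {t} {L} {r' ⊓ L} {r' ∸ (r' ⊓ L)} {ρ} {w₁} {w₂} {w₃}
                  (≤-trans aρ≤2L (*-monoʳ-≤ 2 (≤-trans (<⇒≤ L<d) (≤-reflexive (sym total))))) e₁ e₂ e₃))
        where
        third : ∀ r L → r ≤ L + L → r ∸ (r ⊓ L) ≤ L
        third r L le with ≤-total r L
        ... | inj₁ q = ≤-trans (≤-reflexive (trans (cong (r ∸_) (m≤n⇒m⊓n≡m q)) (n∸n≡0 r))) z≤n
        ... | inj₂ q = ≤-trans (≤-reflexive (cong (r ∸_) (m≥n⇒m⊓n≡n q))) (m≤n+o⇒m∸n≤o r L le)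
        hop-count : ∀ a → (2 * a + 4) + ((2 * a + 4) + (2 * a + 4)) ≡ 6 * a + 12
        hop-count = solve-∀

  acc-zero : Acc 0
  acc-zero {x} {σ} {r} src (d , d≤r , path) r≤ =
    let (m , m∈ , m≤) = E-walk 0 src (walks-mono d≤ (run path))
    in m , m∈ , exact-error (≤-trans m≤ d≤r)
    where
    run : ∀ {x y d} → Path Always x y d → Walks (H.EdgeW 0) d x y d
    run nil = nil
    run (cons _ e p) = cons (hopEdges-edge 0 e) (run p)
    d≤ : d ≤ hopCount
    d≤ = ≤-trans d≤r (≤-trans r≤ (≤-trans (≤-reflexive (*-identityʳ a)) (≤-trans (m≤m+n a (5 * a)) (m≤m+n (6 * a) 12))))

  accuracy : ∀ t → 24 ≤ a → slack t ≤ a → Acc t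
  accuracy zero _ _ = acc-zero
  accuracy (suc t) 24≤a T≤a = Segment.acc-suc t (accuracy t 24≤a T≤a') T≤a' 24≤a
    where T≤a' = ≤-trans (slack-mono t) T≤a

-- Stretch of the emulator.  Y is the inverse of the loss accepted at each level, R the radius of the
-- clusters, b the additive error and δ the exploration distance.

module Radii (Y : ℕ) where

  mutual
    R b : ℕ → ℕ
    R zero = 0
    R (suc i) = R i + 2 * (Y * b i + 2 * R i)
    b zero = 1
    -- Prefix and suffix contribute b i + (1 + 4 R i) each, the second term being the edge that
    -- joins them to the middle section. The middle section contributes 4 R (i + 1).
    b (suc i) = 2 * b i + 4 * R (suc i) + 8 * R i + 2

  -- A section of length up to Y * b i must stay within the exploration distance after both its ends
  -- have moved to centers at distance up to `R i`.
  δ : ℕ → ℕ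
  δ i = Y * b i + 2 * R i

  1≤b : ∀ i → 1 ≤ b i
  1≤b zero = ≤-refl
  1≤b (suc i) = ≤-trans (s≤s z≤n) (m≤n+m 2 (2 * b i + 4 * R (suc i) + 8 * R i))

  R-step : ∀ i → R i ≤ R (suc i)
  R-step i = m≤m+n (R i) (2 * δ i)

  R-mono : ∀ {i j} → i ≤ j → R i ≤ R j
  R-mono {i} {j} le with m≤n⇒∃[o]m+o≡n le
  ... | o , refl = go o
    where
    go : ∀ o → R i ≤ R (i + o)
    go zero = ≤-reflexive (cong R (sym (+-identityʳ i)))
    go (suc o) = ≤-trans (go o) (≤-trans (R-step (i + o)) (≤-reflexive (cong R (sym (+-suc i o)))))

  b-step : ∀ i → b i ≤ b (suc i)
  b-step i = ≤-trans (m≤m+n (b i) (b i + 0)) (≤-trans (m≤m+n (2 * b i) (4 * R (suc i))) (≤-trans (m≤m+n (2 * b i + 4 * R (suc i)) (8 * R i)) (m≤m+n (2 * b i + 4 * R (suc i) + 8 * R i) 2)))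

module Weighted {V : Set} (A : V → V → Bool) (Edge : V → V → ℕ → Set) where

  open Paths A public

  HR : V → V → ℕ → Set
  HR x y w = ∃ λ j → Walks Edge j x y w

  hr-refl : ∀ {x} → HR x x 0
  hr-refl = 0 , nil

  hr-++ : ∀ {x y u v w} → HR x y v → HR y u w → HR x u (v + w)
  hr-++ (i , p) (j , q) = i + j , walks-++ p q

  hr-sym : (∀ {x y w} → Edge x y w → Edge y x w) → ∀ {x y w} → HR x y w → HR y x w
  hr-sym flip (_ , nil) = hr-refl
  hr-sym flip {x} {y} (_ , cons {a = a} {b} e p) = subst (HR y x) (+-comm b a) (hr-++ (hr-sym flip (_ , p)) (1 , one (flip e)))

  hr-edge : ∀ {x y w} → Edge x y w → HR x y w
  hr-edge e = 1 , one e

  Bounded : ℕ → ℕ → ℕ → V → V → ℕ → Set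
  Bounded Y c β x y d = ∃ λ w → HR x y w × Y * w ≤ c * d + Y * β

  -- A path is cut into blocks of length Λ ≥ Y * β; their additive errors become multiplicative.
  blocks : ∀ {Pr : V → Set} {Y c β Λ} → 1 ≤ Λ → Y * β ≤ Λ →
           (∀ {x y d} → Path Pr x y d → Pr y → d ≤ Λ → Bounded Y c β x y d) →
           ∀ {x y d} → Path Pr x y d → Pr y → Bounded Y (suc c) β x y d
  blocks {Pr} {Y} {c} {β} {Λ} 1≤Λ βΛ block {d = d} p py = go d ≤-refl p py
    where
    short : ∀ {x y d} → Path Pr x y d → Pr y → d ≤ Λ → Bounded Y (suc c) β x y d
    short {d = d} p py le = let (w , h , e) = block p py le in w , h , ≤-trans e (+-monoˡ-≤ (Y * β) (m≤n+m (c * d) d))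
    go : ∀ f {x y d} → d ≤ f → Path Pr x y d → Pr y → Bounded Y (suc c) β x y d
    go zero le p py = short p py (≤-trans le z≤n)
    go (suc f) {x} {y} {d} le p py = answer (d ≤? Λ)
      where
      answer : Dec (d ≤ Λ) → Bounded Y (suc c) β x y d
      answer (yes d≤) = short p py d≤
      answer (no d≰) =
        let Λ≤ = <⇒≤ (≰⇒> d≰)
            (u , pu , p₁ , p₂) = split-at Λ Λ≤ py p
            (w₁ , h₁ , e₁) = block p₁ pu ≤-refl
            (w₂ , h₂ , e₂) = go f (≤-trans (∸-monoʳ-≤ d 1≤Λ) (∸-monoˡ-≤ 1 le)) p₂ py
        in w₁ + w₂ , hr-++ h₁ h₂ , (begin
             Y * (w₁ + w₂)                                     ≡⟨ *-distribˡ-+ Y w₁ w₂ ⟩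
             Y * w₁ + Y * w₂                                   ≤⟨ +-mono-≤ e₁ e₂ ⟩
             c * Λ + Y * β + (suc c * (d ∸ Λ) + Y * β)         ≤⟨ +-monoˡ-≤ (suc c * (d ∸ Λ) + Y * β) (+-monoʳ-≤ (c * Λ) βΛ) ⟩
             c * Λ + Λ + (suc c * (d ∸ Λ) + Y * β)             ≡⟨ regroup c Λ (d ∸ Λ) (Y * β) ⟩
             suc c * (Λ + (d ∸ Λ)) + Y * β                     ≡⟨ cong (λ d → suc c * d + Y * β) (m+[n∸m]≡n Λ≤) ⟩
             suc c * d + Y * β                                 ∎)
        where
        open ≤-Reasoning
        regroup : ∀ c Λ d β → c * Λ + Λ + (suc c * d + β) ≡ suc c * (Λ + d) + β
        regroup = solve-∀

module Levels {V : Set} (A : V → V → Bool) (A-sym : ∀ u v → A u v ≡ A v u)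
              (Edge : V → V → ℕ → Set) (Edge-sym : ∀ {x y w} → Edge x y w → Edge y x w) (Y : ℕ) (1≤Y : 1 ≤ Y)
              (P Unpop Pop : ℕ → V → Set)
              (decide : ∀ i {x} → P i x → Unpop i x ⊎ Pop i x)
              (neighbours : ∀ i {x y r} → P i x → Unpop i x → P i y → Paths.Reach A r x y → r ≤ Radii.δ Y i → Edge x y r)
              (pivot : ∀ i {x} → P i x → Pop i x → ∃ λ y → P (suc i) y ×
                       Edge x y (2 * Radii.δ Y i) × Paths.Reach A (2 * Radii.δ Y i) x y)
              (top : ℕ) (last : ∀ {x} → P top x → Unpop top x) where

  open Radii Y
  open Weighted A Edge
  open Symmetric A-sym

  -- A chain of pivots: all centers before the current one were popular. A vertex is `Settled` at
  -- the level where its chain meets an unpopular center.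
  data Center : ℕ → V → V → Set where
    own : ∀ {x} → P 0 x → Center 0 x x
    next : ∀ {i x p q} → Center i x p → Pop i p → P (suc i) q → Edge p q (2 * δ i) →
           Reach (2 * δ i) p q → Center (suc i) x q

  center-P : ∀ {i x p} → Center i x p → P i p
  center-P (own p) = p
  center-P (next _ _ p _ _) = p

  center-base : ∀ {i x p} → Center i x p → P 0 x
  center-base (own p) = p
  center-base (next c _ _ _ _) = center-base c

  center-reach : ∀ {i x p} → Center i x p → Reach (R i) x p
  center-reach (own _) = reach-refl
  center-reach (next c _ _ _ r) = reach-++ (center-reach c) r

  center-to : ∀ {i x p} → Center i x p → HR x p (R i)
  center-to (own _) = hr-refl
  center-to (next c _ _ e _) = hr-++ (center-to c) (hr-edge e)

  center-from : ∀ {i x p} → Center i x p → HR p x (R i)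
  center-from c = hr-sym Edge-sym (center-to c)

  Settled : ℕ → V → Set
  Settled i x = ∃ λ p → Center i x p × Unpop i p

  Below : ℕ → V → Set
  Below j x = ∃ λ i → i ≤ j × Settled i x

  climb : ∀ i {x} → P 0 x → (∃ λ p → Center i x p) ⊎ (∃ λ i' → i' < i × Settled i' x)
  climb zero px = inj₁ (_ , own px)
  climb (suc i) px with climb i px
  ... | inj₂ (i' , lt , s) = inj₂ (i' , ≤-trans lt (n≤1+n i) , s)
  ... | inj₁ (p , c) with decide i (center-P c)
  ... | inj₁ u = inj₂ (i , ≤-refl , p , c , u)
  ... | inj₂ q = let (y , py , e , r) = pivot i (center-P c) q in inj₁ (y , next c q py e r)

  descend : ∀ {i i' x p} → i' ≤ i → Center i x p → ∃ λ p' → Center i' x p'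
  descend {zero} z≤n c = _ , c
  descend {suc i} {i'} le c with i' ≟ suc i
  descend le c | yes refl = _ , c
  descend le (next c _ _ _ _) | no ne = descend (≤-pred (≤∧≢⇒< le ne)) c

  all-below : ∀ {x} → P 0 x → Below top x
  all-below px with climb top px
  ... | inj₁ (p , c) = top , ≤-refl , p , c , last (center-P c)
  ... | inj₂ (i , lt , s) = i , <⇒≤ lt , s

  below-P : ∀ {j x} → Below j x → P 0 x
  below-P (_ , _ , _ , c , _) = center-base c

  1≤Yb : ∀ i → 1 ≤ Y * b i
  1≤Yb i = *-mono-≤ 1≤Y (1≤b i)

  -- One unpopular center is enough, because an unpopular center lists all centers of its level
  -- within `δ i`, including popular ones, and edges are used in both directions.
  through : ∀ {i x y p q m} → Center i x p → Center i y q → Reach m x y → R i + (m + R i) ≤ δ i →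
            (Unpop i p ⊎ Unpop i q) → HR x y (R i + (R i + (m + R i) + R i))
  through {i} {m = m} cx cy r le u = hr-++ (center-to cx) (hr-++ (hr-edge (middle u)) (center-from cy))
    where
    pq = reach-++ (reach-sym (center-reach cx)) (reach-++ r (center-reach cy))
    middle : _ → Edge _ _ (R i + (m + R i))
    middle (inj₁ up) = neighbours i (center-P cx) up (center-P cy) pq le
    middle (inj₂ uq) = Edge-sym (neighbours i (center-P cy) uq (center-P cx) (reach-sym pq) le)

  -- The edge is replaced at the lower of the levels where its two ends settle: the other end still
  -- has a center there. So the cost depends on the level of one end only, even if the other one
  -- settles far above `j`.
  edge-cost : ∀ {j x y} → A x y ≡ true → Below j x → P 0 y → ∃ λ w → HR x y w × w ≤ 1 + 4 * R j
  edge-cost {j} {x} {y} e (i , i≤j , p , cx , up) py = [ same , lower ]′ (climb i py)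
    where
    fits : ∀ i → R i + (1 + R i) ≤ δ i
    fits i = ≤-trans (≤-reflexive (lemma (R i))) (+-monoˡ-≤ (2 * R i) (1≤Yb i))
      where lemma : ∀ r → r + (1 + r) ≡ 1 + 2 * r
            lemma = solve-∀
    total : ∀ {i} → i ≤ j → R i + (R i + (1 + R i) + R i) ≤ 1 + 4 * R j
    total {i} le = ≤-trans (≤-reflexive (lemma (R i))) (+-monoʳ-≤ 1 (*-monoʳ-≤ 4 (R-mono le)))
      where lemma : ∀ r → r + (r + (1 + r) + r) ≡ 1 + 4 * r
            lemma = solve-∀
    Goal = ∃ λ w → HR x y w × w ≤ 1 + 4 * R j
    same : (∃ λ q → Center i y q) → Goal
    same (q , cy) = _ , through cx cy (path-reach (edge e)) (fits i) (inj₁ up) , total i≤j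
    lower : (∃ λ i' → i' < i × Settled i' y) → Goal
    lower (i' , lt , q , cy , uq) = let (_ , cx') = descend (<⇒≤ lt) cx in
      _ , through cx' cy (path-reach (edge e)) (fits i') (inj₂ uq) , total (≤-trans (<⇒≤ lt) i≤j)

  Segments : ℕ → Set
  Segments j = ∀ {x y d} → Path (Below j) x y d → Below j y → Bounded Y (Y + j) (b j) x y d

  segments-zero : Segments 0
  segments-zero p py = let (w , h , e) = go p py in w , h , ≤-trans (≤-reflexive (cong (Y *_) e))
      (≤-trans (≤-reflexive (cong (_* _) (sym (+-identityʳ Y)))) (m≤m+n _ (Y * 1)))
    where
    start : ∀ {x y d} → Path (Below 0) x y d → Below 0 y → Below 0 x
    start nil py = py
    start (cons px _ _) _ = px
    go : ∀ {x y d} → Path (Below 0) x y d → Below 0 y → ∃ λ w → HR x y w × w ≡ d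
    go nil _ = 0 , hr-refl , refl
    go (cons (.0 , z≤n , p , own px , up) e r) py with go r py
    ... | w , h , refl with neighbours 0 px up (below-P (start r py)) (path-reach (edge e)) (≤-trans (1≤Yb 0) (m≤m+n (Y * b 0) 0))
    ... | e' = suc w , hr-++ (hr-edge e') h , refl

  add-cost : ∀ {Y c w w' p β γ} → Y * w ≤ c * p + Y * β → w' ≤ γ → Y * (w + w') ≤ c * suc p + Y * (β + γ)
  add-cost {Y} {c} {w} {w'} {p} {β} {γ} le le' = ≤-trans (≤-reflexive (*-distribˡ-+ Y w w'))
    (≤-trans (+-mono-≤ le (*-monoʳ-≤ Y le')) (≤-by c (lemma Y c p β γ)))
    where lemma : ∀ Y c p β γ → c * suc p + Y * (β + γ) ≡ c * p + Y * β + Y * γ + c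
          lemma = solve-∀

  before-cost : ∀ {j x f p} → Segments j → Before (Below j) x f p → P 0 f →
                ∃ λ w → HR x f w × Y * w ≤ (Y + j) * p + Y * (b j + (1 + 4 * R j))
  before-cost seg (inj₁ (refl , refl)) _ = 0 , hr-refl , ≤-trans (≤-reflexive (*-zeroʳ Y)) z≤n
  before-cost {j} seg (inj₂ (u , p' , refl , r , bu , e)) pf =
    let (w , h , le) = seg r bu
        (w' , h' , le') = edge-cost e bu pf
    in w + w' , hr-++ h h' , add-cost {Y} {Y + j} {w} {w'} {p'} {b j} le le'

  after-cost : ∀ {j l y q} → Segments j → After (Below j) l y q → P 0 l →
               ∃ λ w → HR l y w × Y * w ≤ (Y + j) * q + Y * (b j + (1 + 4 * R j))
  after-cost seg (inj₁ (refl , refl)) _ = 0 , hr-refl , ≤-trans (≤-reflexive (*-zeroʳ Y)) z≤n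
  after-cost {j} seg (inj₂ (u , q' , refl , e , r , by)) pl =
    let (w , h , le) = seg r by
        (w' , h' , le') = edge-cost (trans (A-sym u _) e) (start r by) pl
    in w + w' , subst (HR _ _) (+-comm w' w) (hr-++ (hr-sym Edge-sym h') h) , add-cost {Y} {Y + j} {w} {w'} {q'} {b j} le le'
    where
    start : ∀ {x y d} → Path (Below j) x y d → Below j y → Below j x
    start nil py = py
    start (cons px _ _) _ = px

  -- The path is cut into blocks of length Y * b (j + 1). In a block, the first and the last vertex
  -- settled at level j + 1 have centers within `δ`, joined by one edge, and prefix and suffix fall
  -- to the induction. The additive error per block is a fraction 1 / Y of its length, whence one
  -- more unit in the coefficient.
  segments-suc : ∀ j → Segments j → Segments (suc j)
  segments-suc j seg {x} {y} {d} p py = subst (λ c → Bounded Y c (b (suc j)) x y d) (sym (+-suc Y j))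
      (blocks {Below (suc j)} {Y} {Y + j} {b (suc j)} {Y * b (suc j)} (1≤Yb (suc j)) ≤-refl block p py)
    where
    classify : ∀ {x} → Below (suc j) x → Below j x ⊎ Settled (suc j) x
    classify (i , le , s) with i ≟ suc j
    ... | yes refl = inj₂ s
    ... | no ne = inj₁ (i , ≤-pred (≤∧≢⇒< le ne) , s)
    block : ∀ {x y d} → Path (Below (suc j)) x y d → Below (suc j) y → d ≤ Y * b (suc j) →
            Bounded Y (Y + j) (b (suc j)) x y d
    block {x} {y} {d} p py d≤ = [ low , mixed ]′ (scan classify p py)
      where
      low : Path (Below j) x y d × Below j y → Bounded Y (Y + j) (b (suc j)) x y d
      low (q , qy) = let (w , h , le) = seg q qy in w , h , ≤-trans le (+-monoʳ-≤ ((Y + j) * d) (*-monoʳ-≤ Y (b-step j)))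
      mixed : Sections (Below j) (Settled (suc j)) x y d → Bounded Y (Y + j) (b (suc j)) x y d
      mixed (sections f l p m q total bef (_ , cf , uf) mid (_ , cl , ul) aft) =
        let (w₁ , h₁ , e₁) = before-cost seg bef (center-base cf)
            (w₃ , h₃ , e₃) = after-cost seg aft (center-base cl)
            ρ = R (suc j)
            h₂ = through cf cl (path-reach mid) fits (inj₁ uf)
        in w₁ + (ρ + (ρ + (m + ρ) + ρ) + w₃) , hr-++ h₁ (hr-++ h₂ h₃) , (begin
          Y * (w₁ + (ρ + (ρ + (m + ρ) + ρ) + w₃))                ≡⟨ expand Y w₁ w₃ ρ m ⟩
          Y * w₁ + Y * w₃ + (Y * m + Y * (4 * ρ))                ≤⟨ +-mono-≤ (+-mono-≤ e₁ e₃) (+-monoˡ-≤ (Y * (4 * ρ)) (*-monoˡ-≤ m (m≤m+n Y j))) ⟩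
          (Y + j) * p + Y * (b j + (1 + 4 * R j)) + ((Y + j) * q + Y * (b j + (1 + 4 * R j))) + ((Y + j) * m + Y * (4 * ρ))
                                                                 ≡⟨ collect Y (Y + j) p q m (b j) (R j) ρ ⟩
          (Y + j) * (p + (m + q)) + Y * b (suc j)                ≡⟨ cong (λ d → (Y + j) * d + Y * b (suc j)) total ⟩
          (Y + j) * d + Y * b (suc j)                            ∎)
        where
        open ≤-Reasoning
        m≤ : m ≤ Y * b (suc j)
        m≤ = ≤-trans (m≤m+n m q) (≤-trans (m≤n+m (m + q) p) (≤-trans (≤-reflexive total) d≤))
        fits : R (suc j) + (m + R (suc j)) ≤ δ (suc j)
        fits = ≤-trans (≤-reflexive (lemma (R (suc j)) m)) (+-monoˡ-≤ (2 * R (suc j)) m≤)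
          where lemma : ∀ r m → r + (m + r) ≡ m + 2 * r
                lemma = solve-∀
        expand : ∀ Y w₁ w₃ ρ m → Y * (w₁ + (ρ + (ρ + (m + ρ) + ρ) + w₃)) ≡ Y * w₁ + Y * w₃ + (Y * m + Y * (4 * ρ))
        expand = solve-∀
        collect : ∀ Y c p q m b r ρ → c * p + Y * (b + (1 + 4 * r)) + (c * q + Y * (b + (1 + 4 * r))) + (c * m + Y * (4 * ρ))
                  ≡ c * (p + (m + q)) + Y * (2 * b + 4 * ρ + 8 * r + 2)
        collect = solve-∀

  segments : ∀ j → Segments j
  segments zero = segments-zero
  segments (suc j) = segments-suc j (segments j)

  -- Paths through heavy vertices are shortcut through the hubs.

  module Hubs (e l ρ a : ℕ) (1≤e : 1 ≤ e) (Y≡ : Y ≡ 2 * e * l) (top≤l : top ≤ l) (b≤ρ : b top ≤ ρ) (1≤ρ : 1 ≤ ρ)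
              (Heavy Hub : V → Set) (classify : ∀ x → P 0 x ⊎ Heavy x)
              (hub : ∀ x → Heavy x ⊎ (∃ λ y → Heavy y × A x y ≡ true) →
                     ∃ λ σ → Hub σ × Edge x σ (9 * ρ) × Reach (9 * ρ) x σ)
              (hubs : ∀ {σ σ' r} → Hub σ → Hub σ' → Reach r σ σ' → r ≤ a * ρ →
                      ∃ λ w → Edge σ σ' w × 2 * e * w ≤ (2 * e + 1) * r + 2 * e * (24 * ρ))
              (Λ-fits : 160 * e * ρ + 18 * ρ ≤ a * ρ) where

    light-path : ∀ {x y d} → Path (P 0) x y d → P 0 y → ∃ λ w → HR x y w × 2 * e * w ≤ (2 * e + 1) * d + 2 * e * ρ
    light-path {x} {y} {d} p py =
      let (w , h , le) = segments top (weaken p) (all-below py)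
      in w , h , *-cancelˡ-≤ l {{>-nonZero 1≤l}} (begin
        l * (2 * e * w)                                   ≡⟨ reorder l (2 * e) w ⟩
        2 * e * l * w                                     ≡⟨ cong (_* w) (sym Y≡) ⟩
        Y * w                                             ≤⟨ le ⟩
        (Y + top) * d + Y * b top                         ≤⟨ +-mono-≤ (*-monoˡ-≤ d (+-monoʳ-≤ Y top≤l)) (*-monoʳ-≤ Y b≤ρ) ⟩
        (Y + l) * d + Y * ρ                               ≡⟨ cong (λ Y → (Y + l) * d + Y * ρ) Y≡ ⟩
        (2 * e * l + l) * d + 2 * e * l * ρ               ≡⟨ factor l (2 * e) d ρ ⟩
        l * ((2 * e + 1) * d + 2 * e * ρ)                 ∎)
      where
      open ≤-Reasoning
      positive : ∀ l → Y ≡ 2 * e * l → 1 ≤ l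
      positive zero eq = ⊥-elim (<⇒≱ 1≤Y (≤-reflexive (trans eq (*-zeroʳ (2 * e)))))
      positive (suc _) _ = s≤s z≤n
      1≤l = positive l Y≡
      weaken : ∀ {x y d} → Path (P 0) x y d → Path (Below top) x y d
      weaken nil = nil
      weaken (cons px e r) = cons (all-below px) e (weaken r)
      reorder : ∀ l e w → l * (e * w) ≡ e * l * w
      reorder = solve-∀
      factor : ∀ l e d ρ → (e * l + l) * d + e * l * ρ ≡ l * ((e + 1) * d + e * ρ)
      factor = solve-∀

    opaque
      -- The additive errors are ρ at each end, 18 ρ for the two edges to hubs, 24 ρ between the
      -- hubs, and 18 ρ (1 + 1 / (2 e)) for the longer distance between them. For e ≥ 1 these are at
      -- most 71 ρ, rounded up to 80 ρ.
      hub-bound : ∀ {e ρ p m q w₁ w₂ w₃} → 1 ≤ e → 2 * e * w₁ ≤ (2 * e + 1) * p + 2 * e * ρ →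
                  2 * e * w₂ ≤ (2 * e + 1) * (m + 18 * ρ) + 2 * e * (24 * ρ) →
                  2 * e * w₃ ≤ (2 * e + 1) * q + 2 * e * ρ →
                  2 * e * (w₁ + (9 * ρ + (w₂ + (9 * ρ + w₃)))) ≤ (2 * e + 1) * (p + (m + q)) + 2 * e * (80 * ρ)
      hub-bound {e} {ρ} {p} {m} {q} {w₁} {w₂} {w₃} 1≤e e₁ e₂ e₃ with m≤n⇒∃[o]m+o≡n 1≤e
      ... | f , refl = begin
        2 * e * (w₁ + (9 * ρ + (w₂ + (9 * ρ + w₃))))                 ≡⟨ expand e ρ w₁ w₂ w₃ ⟩
        2 * e * w₁ + (2 * e * w₂ + 2 * e * w₃) + 36 * e * ρ          ≤⟨ +-monoˡ-≤ (36 * e * ρ) (+-mono-≤ e₁ (+-mono-≤ e₂ e₃)) ⟩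
        (2 * e + 1) * p + 2 * e * ρ + ((2 * e + 1) * (m + 18 * ρ) + 2 * e * (24 * ρ) + ((2 * e + 1) * q + 2 * e * ρ)) + 36 * e * ρ
                                                                     ≤⟨ ≤-by (18 * (f * ρ) + 18 * e * ρ) (rest f ρ p m q) ⟩
        (2 * e + 1) * (p + (m + q)) + 2 * e * (80 * ρ)               ∎
        where
        open ≤-Reasoning
        expand : ∀ e ρ w₁ w₂ w₃ → 2 * e * (w₁ + (9 * ρ + (w₂ + (9 * ρ + w₃)))) ≡ 2 * e * w₁ + (2 * e * w₂ + 2 * e * w₃) + 36 * e * ρ
        expand = solve-∀
        rest : ∀ f ρ p m q → (2 * (1 + f) + 1) * (p + (m + q)) + 2 * (1 + f) * (80 * ρ) ≡
               (2 * (1 + f) + 1) * p + 2 * (1 + f) * ρ + ((2 * (1 + f) + 1) * (m + 18 * ρ) + 2 * (1 + f) * (24 * ρ) +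
               ((2 * (1 + f) + 1) * q + 2 * (1 + f) * ρ)) + 36 * (1 + f) * ρ + (18 * (f * ρ) + 18 * (1 + f) * ρ)
        rest = solve-∀

    Access : V → Set
    Access x = Heavy x ⊎ (∃ λ y → Heavy y × A x y ≡ true)

    -- The emulator need not contain the edge from a light vertex to a heavy neighbour. The shortcut
    -- therefore starts at the `door`, the last light vertex before the first heavy one, for which
    -- `hub` supplies a hub as well.
    record Reaching (x f : V) (p : ℕ) : Set where
      constructor reaching
      field
        {door} : V
        {p₀ m₀} : ℕ
        total : p₀ + m₀ ≡ p
        access : Access door
        inside : ∃ λ w → HR x door w × 2 * e * w ≤ (2 * e + 1) * p₀ + 2 * e * ρ
        path : Path Always door f m₀

    record Leaving (l y : V) (q : ℕ) : Set where
      constructor leaving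
      field
        {door} : V
        {q₀ m₀} : ℕ
        total : m₀ + q₀ ≡ q
        access : Access door
        inside : ∃ λ w → HR door y w × 2 * e * w ≤ (2 * e + 1) * q₀ + 2 * e * ρ
        path : Path Always l door m₀

    free : ∀ {x} → ∃ λ w → HR x x w × 2 * e * w ≤ (2 * e + 1) * 0 + 2 * e * ρ
    free = 0 , hr-refl , ≤-trans (≤-reflexive (*-zeroʳ (2 * e))) z≤n

    reach-first : ∀ {x f p} → Heavy f → Before (P 0) x f p → Reaching x f p
    reach-first hf (inj₁ (refl , refl)) = reaching refl (inj₁ hf) free nil
    reach-first hf (inj₂ (u , p' , refl , r , pu , e')) = reaching (+-comm p' 1) (inj₂ (_ , hf , e')) (light-path r pu) (edge e')

    leave-last : ∀ {l y q} → Heavy l → After (P 0) l y q → Leaving l y q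
    leave-last hl (inj₁ (refl , refl)) = leaving refl (inj₁ hl) free nil
    leave-last {l} hl (inj₂ (u , q' , refl , e' , r , py)) =
      leaving refl (inj₂ (_ , hl , trans (A-sym u l) e')) (light-path r py) (edge e')

    hub-block : ∀ {x y d} → Path Always x y d → d ≤ 160 * e * ρ → Bounded (2 * e) (2 * e + 1) (80 * ρ) x y d
    hub-block {x} {y} {d} path d≤ = [ light , mixed ]′ (scan {Always} {P 0} {Heavy} (λ {x} _ → classify x) path tt)
      where
      light : Path (P 0) x y d × P 0 y → Bounded (2 * e) (2 * e + 1) (80 * ρ) x y d
      light (p , py) = let (w , h , le) = light-path p py in
        w , h , ≤-trans le (+-monoʳ-≤ ((2 * e + 1) * d) (*-monoʳ-≤ (2 * e) (m≤m+n ρ (79 * ρ))))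
      mixed : Sections (P 0) Heavy x y d → Bounded (2 * e) (2 * e + 1) (80 * ρ) x y d
      mixed (sections f l p m q total bef hf mid hl aft) = finish (reach-first hf bef) (leave-last hl aft)
        where
        finish : Reaching x f p → Leaving l y q → Bounded (2 * e) (2 * e + 1) (80 * ρ) x y d
        finish (reaching {u} {p₀} {m₁} refl au (w₁ , h₁ , e₁) pu) (leaving {v} {q₀} {m₃} refl av (w₃ , h₃ , e₃) pv) =
          let (σ , src , uσ , ruσ) = hub u au
              (σ' , src' , vσ' , rvσ') = hub v av
              between = path-++ pu (path-++ mid pv)
              (w₂ , eσ , le₂) = hubs src src' (subst (λ r → Reach r σ σ') (far ρ (m₁ + (m + m₃)))
                (reach-++ (reach-sym ruσ) (reach-++ (path-reach between) rvσ'))) fits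
          in w₁ + (9 * ρ + (w₂ + (9 * ρ + w₃))) , hr-++ h₁ (hr-++ (hr-edge uσ) (hr-++ (hr-edge eσ) (hr-++ (hr-edge (Edge-sym vσ')) h₃))) ,
             subst (λ d → 2 * e * (w₁ + (9 * ρ + (w₂ + (9 * ρ + w₃)))) ≤ (2 * e + 1) * d + 2 * e * (80 * ρ)) whole
               (hub-bound {e} {ρ} {p₀} {m₁ + (m + m₃)} {q₀} {w₁} {w₂} {w₃} 1≤e e₁ le₂ e₃)
          where
          far : ∀ ρ m → 9 * ρ + (m + 9 * ρ) ≡ m + 18 * ρ
          far = solve-∀
          whole : p₀ + (m₁ + (m + m₃) + q₀) ≡ d
          whole = trans (lemma p₀ m₁ m m₃ q₀) total
            where lemma : ∀ p₀ m₁ m m₃ q₀ → p₀ + (m₁ + (m + m₃) + q₀) ≡ p₀ + m₁ + (m + (m₃ + q₀))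
                  lemma = solve-∀
          fits : m₁ + (m + m₃) + 18 * ρ ≤ a * ρ
          fits = ≤-trans (+-monoˡ-≤ (18 * ρ) (≤-trans (m≤m+n (m₁ + (m + m₃)) q₀)
            (≤-trans (m≤n+m (m₁ + (m + m₃) + q₀) p₀) (≤-trans (≤-reflexive whole) d≤)))) Λ-fits

    stretch : ∀ {x y d} → Path Always x y d → Bounded (2 * e) (suc (2 * e + 1)) (80 * ρ) x y d
    stretch p = blocks {Always} {2 * e} {2 * e + 1} {80 * ρ} {160 * e * ρ}
      (*-mono-≤ (*-mono-≤ {1} {160} (s≤s z≤n) 1≤e) 1≤ρ)
      (≤-reflexive (lemma e ρ)) (λ p _ → hub-block p) p tt
      where lemma : ∀ e ρ → 2 * e * (80 * ρ) ≡ 160 * e * ρ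
            lemma = solve-∀

-- The length of the lists at level i. It starts at 16 entries per node, which the slots can hold
-- when z ≥ 16, and squaring it is compensated by the loss of centers, see `size`.
κ : ℕ → ℕ
κ zero = 16
κ (suc i) = κ i * κ i

if-cases : ∀ {X : Set} b {l l' : List X} {e} → e ∈ (if b then l else l') → (b ≡ true × e ∈ l) ⊎ (b ≡ false × e ∈ l')
if-cases true p = inj₁ (refl , p)
if-cases false p = inj₂ (refl , p)

∈-if-true : ∀ {X : Set} {b} {l l' : List X} {e} → b ≡ true → e ∈ l → e ∈ (if b then l else l')
∈-if-true refl p = p

∈-if-false : ∀ {X : Set} {b} {l l' : List X} {e} → b ≡ false → e ∈ l' → e ∈ (if b then l else l')
∈-if-false refl p = p

does-false : ∀ {X : Set} (d : Dec X) → ¬ X → does d ≡ false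
does-false (yes p) n = ⊥-elim (n p)
does-false (no _) _ = refl

toList : ∀ {X : Set} → Maybe X → List X
toList nothing = []
toList (just x) = x ∷ []

-- These functions do not depend on the graph: every node evaluates them on tables known to all.

module Clusters (k z Y : ℕ) where

  open Lookup k z
  open Radii Y
  open DecMem _≟N_ using (_∈?_)

  active : Tab Bool → List N
  active P = filter (λ x → P ! x Data.Bool.≟ true) allN

  within? : ∀ i (P : Tab Bool) (e : It) → Dec (P ! proj₁ e ≡ true × toℕ (proj₂ e) ≤ δ i)
  within? i P (c , w) = (P ! c Data.Bool.≟ true) ×-dec (toℕ w ≤? δ i)

  near : ℕ → Tab Bool → List It → List It
  near i P l = take (κ i) (filter (within? i P) l)

  noGroup : N → Vec Bool 0
  noGroup _ = []

  module Whole (i : ℕ) (P : Tab Bool) = Group _≟ᵇ_ noGroup (active P) (κ i)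

  collected : ℕ → Tab Bool → (N → List It) → Tab (List It)
  collected i P L = tab (Whole.gather i P (λ x → near i P (L x)) [])

  nearList : Tab (List It) → N → List It
  nearList g x = norm (g ! x)

  popular? : ∀ i g x → Dec (κ i ≤ length (nearList g x))
  popular? i g x = κ i ≤? length (nearList g x)

  pops : ℕ → Tab Bool → Tab (List It) → List N
  pops i P g = filter (popular? i g) (active P)

  module Gr (g : Tab (List It)) = Greedy _≟N_ (λ x → keys (nearList g x))

  centers : ℕ → Tab Bool → Tab (List It) → List N
  centers i P g = Gr.greedy g (pops i P g)

  nextP : ℕ → Tab Bool → Tab (List It) → Tab Bool
  nextP i P g = tab (λ x → does (x ∈? centers i P g))

  pivotOf : ℕ → Tab Bool → Tab (List It) → N → Maybe N
  pivotOf i P g x = List.head (filter (Gr.meets? g x) (centers i P g))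

  out : ℕ → Tab Bool → Tab (List It) → N → List It
  out i P g x = if P ! x
    then (if does (popular? i g x) then entryTo (2 * δ i) (pivotOf i P g x) else nearList g x) else []

  hubCandidates : Tab (Maybe N) → Tab Bool → N → List N
  hubCandidates d row x = concatMap (λ y → if does (x ≟N y) ∨ row ! y then toList (d ! y) else []) allN

  assemble : ℕ → Tab (List It) → Tab (List It) → Tab (Maybe N) → Tab (List It)
  assemble w H T d = tab (λ x → H ! x ++ (T ! x ++ entryTo w (d ! x)))

  ∈-active : ∀ {P x} → P ! x ≡ true → x ∈ active P
  ∈-active {P} {x} e = ∈-filter⁺ (λ x → P ! x Data.Bool.≟ true) (∈-allN x) e

  active-∈ : ∀ {P x} → x ∈ active P → P ! x ≡ true
  active-∈ {P} p = proj₂ (∈-filter⁻ (λ x → P ! x Data.Bool.≟ true) {xs = allN} p)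

  nextP⁻ : ∀ {i P g x} → nextP i P g ! x ≡ true → x ∈ centers i P g
  nextP⁻ {i} {P} {g} {x} e = does-true⁻ (x ∈? centers i P g) (trans (sym (tab-! (λ x → does (x ∈? centers i P g)) x)) e)

  nextP⁺ : ∀ {i P g x} → x ∈ centers i P g → nextP i P g ! x ≡ true
  nextP⁺ {i} {P} {g} {x} p = trans (tab-! (λ x → does (x ∈? centers i P g)) x) (does-true (x ∈? centers i P g) p)

  centers-∈ : ∀ {i P g x} → x ∈ centers i P g → P ! x ≡ true × κ i ≤ length (nearList g x)
  centers-∈ {i} {P} {g} p = let (a , b) = ∈-filter⁻ (popular? i g) {xs = active P} (Gr.greedy⊆ g (pops i P g) p) in active-∈ a , b

-- Construction of the emulator

module Build (k z a τ Y m : ℕ) (A : Virt.N k z → Virt.N k z → Bool) where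

  open Net k z a A
  open Clusters k z Y
  open Radii Y

  opaque
    mutual
      centerTab : ℕ → Tab Bool
      centerTab zero = tab (λ x → does (length (M τ x) <? K))
      centerTab (suc i) = nextP i (centerTab i) (listTab i)

      listTab : ℕ → Tab (List It)
      listTab i = collected i (centerTab i) (M τ)

    centerTab-zero : centerTab 0 ≡ tab (λ x → does (length (M τ x) <? K))
    centerTab-zero = refl

    centerTab-suc : ∀ i → centerTab (suc i) ≡ nextP i (centerTab i) (listTab i)
    centerTab-suc i = refl

    listTab-def : ∀ i → listTab i ≡ collected i (centerTab i) (M τ)
    listTab-def i = refl

  edgeTab : ℕ → Tab (List It)
  edgeTab zero = tab (λ _ → [])
  edgeTab (suc i) = tab (λ x → edgeTab i ! x ++ out i (centerTab i) (listTab i) x)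

  module H' = Group _≟ᵇ_ noGroup (active (net τ)) (3 * 2 ^ h)

  ownHub : Tab (Maybe N)
  ownHub = tab (λ x → if heavy τ ! x then dom τ x else nothing)

  hubOf : Tab (Maybe N)
  hubOf = tab (λ x → List.head (hubCandidates ownHub (tab (A x)) x))

  hubEdges : Tab (List It)
  hubEdges = tab (H'.gather (E τ) [])

  F : Tab (List It)
  F = assemble (9 * 2 ^ τ) (edgeTab (suc m)) hubEdges hubOf

-- Correctness of the hierarchy of clusters

module Emulator (k z a τ Y m : ℕ) (A : Virt.N k z → Virt.N k z → Bool) (A-sym : ∀ u v → A u v ≡ A v u) (16≤z : 16 ≤ z) where

  open Accuracy k z a A A-sym (≤-trans (m≤m+n 4 12) 16≤z) public
  open Clusters k z Y public
  open Radii Y public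
  open Build k z a τ Y m A public

  P : ℕ → N → Set
  P i x = centerTab i ! x ≡ true

  near-of : ℕ → N → List It
  near-of i x = near i (centerTab i) (M τ x)

  L : ℕ → N → List It
  L i x = nearList (listTab i) x

  Unpop Pop : ℕ → N → Set
  Unpop i x = length (L i x) < κ i
  Pop i x = κ i ≤ length (L i x)

  P-zero⁻ : ∀ {x} → P 0 x → Light τ x
  P-zero⁻ {x} e = does-true⁻ (length (M τ x) <? K) (trans (sym (tab-! (λ x → does (length (M τ x) <? K)) x)) (trans (cong (λ t → t ! x) (sym centerTab-zero)) e))

  P-zero⁺ : ∀ {x} → Light τ x → P 0 x
  P-zero⁺ {x} p = trans (cong (λ t → t ! x) centerTab-zero) (trans (tab-! (λ x → does (length (M τ x) <? K)) x) (does-true (length (M τ x) <? K) p))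

  P-center : ∀ i {x} → P (suc i) x → x ∈ centers i (centerTab i) (listTab i)
  P-center i {x} e = nextP⁻ {i} {centerTab i} {listTab i} (trans (cong (λ t → t ! x) (sym (centerTab-suc i))) e)

  center-P : ∀ i {x} → x ∈ centers i (centerTab i) (listTab i) → P (suc i) x
  center-P i {x} p = trans (cong (λ t → t ! x) (centerTab-suc i)) (nextP⁺ {i} {centerTab i} {listTab i} p)

  P-down : ∀ i {x} → P (suc i) x → P i x
  P-down i p = proj₁ (centers-∈ {i} {centerTab i} {listTab i} (P-center i p))

  P-light : ∀ i {x} → P i x → Light τ x
  P-light zero p = P-zero⁻ p
  P-light (suc i) p = P-light i (P-down i p)

  listTab-gather : ∀ i x → listTab i ! x ≡ Whole.gather i (centerTab i) (near-of i) [] x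
  listTab-gather i x = trans (cong (λ t → t ! x) (listTab-def i)) (tab-! (Whole.gather i (centerTab i) (near-of i) []) x)

  L-near : ∀ i {x c w} → (c , w) ∈ L i x → (c , w) ∈ near-of i x
  L-near i {x} {c} {w} p = Whole.gather-∈ i (centerTab i) (near-of i) (subst ((c , w) ∈_) (listTab-gather i x) (norm-∈ (listTab i ! x) p))

  near-∈ : ∀ i {x c w} → (c , w) ∈ near-of i x → (c , w) ∈ M τ x × P i c × toℕ w ≤ δ i
  near-∈ i {x} p = ∈-filter⁻ (within? i (centerTab i)) {xs = M τ x} (∈-take⁻ (κ i) (filter (within? i (centerTab i)) (M τ x)) p)

  near-UK : ∀ i x → UK (near-of i x)
  near-UK i x = UK-take (κ i) (UK-filter (within? i (centerTab i)) (M-UK τ x))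

  near-length : ∀ i x → length (near-of i x) ≤ K
  near-length i x = ≤-trans (UK-length (near-UK i x) (λ q → _ , proj₁ (near-∈ i q))) (M-length τ x)

  L-length : ∀ i x → length (L i x) ≤ K
  L-length i x = ≤-trans (UK-length (norm-UK (listTab i ! x)) (λ q → _ , L-near i q)) (near-length i x)

  -- The chosen centers have disjoint lists of at least `κ i` active nodes, so their number falls by
  -- the factor `κ i`, just as the list length grows by it. This invariant lets the lists of every
  -- level be gathered at all nodes.
  size : ∀ i → length (active (centerTab i)) * κ i ≤ length slots
  size zero = ≤-trans (*-mono-≤ (unique-⊆-length (UP.filter⁺ (λ x → centerTab 0 ! x Data.Bool.≟ true) allN-unique) (λ {x} _ → ∈-allN x)) 16≤z)
    (≤-reflexive (trans (cong (_* z) length-allN) (sym length-slots)))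
  size (suc i) = ≤-trans (≤-reflexive (sym (*-assoc (length (active (centerTab (suc i)))) (κ i) (κ i))))
      (≤-trans (*-monoˡ-≤ (κ i) fewer) (size i))
    where
    cs = centers i (centerTab i) (listTab i)
    fewer : length (active (centerTab (suc i))) * κ i ≤ length (active (centerTab i))
    fewer = ≤-trans (*-monoˡ-≤ (κ i) (unique-⊆-length (UP.filter⁺ (λ x → centerTab (suc i) ! x Data.Bool.≟ true) allN-unique)
        (λ {x} p → P-center i (active-∈ p))))
      (disjoint-count (λ x → keys (L i x)) {κ i} {cs} {active (centerTab i)} (Gr.greedy-disjoint (listTab i) (pops i (centerTab i) (listTab i)))
        (λ {x} _ → norm-UK (listTab i ! x))
        (λ {x} p → ≤-trans (proj₂ (centers-∈ {i} {centerTab i} {listTab i} p)) (≤-reflexive (sym (length-map proj₁ (L i x)))))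
        (λ {x} _ q → let (w , r) = ∈-keys⁻ q in ∈-active (proj₁ (proj₂ (near-∈ i (L-near i r))))))

  near-L : ∀ i {x c w} → P i x → (c , w) ∈ near-of i x → ∃ λ w' → (c , w') ∈ L i x × toℕ w' ≤ toℕ w
  near-L i {x} {c} {w} px p = norm-≤ (listTab i ! x) (subst ((c , w) ∈_) (sym (listTab-gather i x))
    (Whole.∈-gather i (centerTab i) (near-of i) (∈-active px) refl
      (≤-trans (*-monoˡ-≤ (κ i) (length-filter (λ x → noGroup x ≟ᵇ []) (active (centerTab i)))) (size i))
      (length-take≤ (κ i) (filter (within? i (centerTab i)) (M τ x))) p))

  -- The ball of a light node is exact up to 2 ^ τ, and cutting it to `κ i` entries has removed
  -- nothing: otherwise `κ i` distinct keys would remain and the center would be popular.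
  complete : ∀ i {x y r} → P i x → Unpop i x → P i y → Reach r x y → r ≤ δ i → δ i ≤ 2 ^ τ →
             ∃ λ w → (y , w) ∈ L i x × toℕ w ≤ r
  complete i {x} {y} {r} px ux py xy r≤ δ≤ =
    let (w , w∈ , w≤) = M-exact τ (P-light i px) (≤-trans r≤ δ≤) xy
        (w' , q , le) = near-L i px (whole (∈-filter⁺ (within? i (centerTab i)) w∈ (py , ≤-trans w≤ r≤)))
    in w' , q , ≤-trans le w≤
    where
    l = filter (within? i (centerTab i)) (M τ x)
    whole : ∀ {e} → e ∈ l → e ∈ near-of i x
    whole p with take-full (κ i) l
    ... | inj₂ (e , _) = subst (_ ∈_) (sym e) p
    ... | inj₁ e = ⊥-elim (<⇒≱ ux (subst (_≤ length (L i x)) e (UK-length (near-UK i x) λ q → let (w' , r , _) = near-L i px q in w' , r)))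

  pivot-sound : ∀ i {x y} → pivotOf i (centerTab i) (listTab i) x ≡ just y →
                y ∈ centers i (centerTab i) (listTab i) × ∃ λ u → u ∈ keys (L i x) × u ∈ keys (L i y)
  pivot-sound i {x} {y} e = answer (filter (Gr.meets? (listTab i) x) cs) refl e
    where
    cs = centers i (centerTab i) (listTab i)
    answer : ∀ l → filter (Gr.meets? (listTab i) x) cs ≡ l → List.head l ≡ just y → y ∈ cs × ∃ λ u → u ∈ keys (L i x) × u ∈ keys (L i y)
    answer (y ∷ l) e refl = ∈-filter⁻ (Gr.meets? (listTab i) x) {xs = cs} (subst (y ∈_) (sym e) (here refl))

  pivot-exists : ∀ i {x} → P i x → Pop i x → ∃ λ y → pivotOf i (centerTab i) (listTab i) x ≡ just y
  pivot-exists i {x} px pop = answer (filter (Gr.meets? (listTab i) x) cs) refl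
    where
    cs = centers i (centerTab i) (listTab i)
    1≤κ : ∀ i → 1 ≤ κ i
    1≤κ zero = s≤s z≤n
    1≤κ (suc i) = *-mono-≤ (1≤κ i) (1≤κ i)
    some : ∀ (l : List It) → 1 ≤ length l → ∃ λ c → c ∈ keys l
    some ((c , w) ∷ l) _ = c , here refl
    answer : ∀ l → filter (Gr.meets? (listTab i) x) cs ≡ l → ∃ λ y → List.head (filter (Gr.meets? (listTab i) x) cs) ≡ just y
    answer (y ∷ l) e = y , cong List.head e
    answer [] e =
      let (c , c∈) = some (L i x) (≤-trans (1≤κ i) pop)
          (y , y∈ , m) = Gr.greedy-maximal (listTab i) (pops i (centerTab i) (listTab i)) (∈-filter⁺ (popular? i (listTab i)) (∈-active px) pop) c∈
      in ⊥-elim (none (subst (y ∈_) e (∈-filter⁺ (Gr.meets? (listTab i) x) y∈ m)))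
      where none : ∀ {y : N} → y ∈ [] → ⊥
            none ()

  L-reach : ∀ i {x c} → c ∈ keys (L i x) → Reach (δ i) x c
  L-reach i p = let (w , q) = ∈-keys⁻ p ; (m , _ , le) = near-∈ i (L-near i q) in reach-mono le (proj₁ (M-ok τ m))

  pivot-reach : ∀ i {x y} → pivotOf i (centerTab i) (listTab i) x ≡ just y → Reach (2 * δ i) x y
  pivot-reach i {x} {y} e = let (_ , u , p , q) = pivot-sound i e in
    reach-mono (+-monoʳ-≤ (δ i) (m≤m+n (δ i) 0)) (reach-++ (L-reach i p) (reach-sym (L-reach i q)))

  out-ok : ∀ i {x y w} → (y , w) ∈ out i (centerTab i) (listTab i) x → Ok x y w
  out-ok i {x} {y} {w} p = [ (λ (_ , q) → [ pivotal ∘ proj₂ , listed ∘ proj₂ ]′ (if-cases (does (popular? i (listTab i) x)) q)) , empty ∘ proj₂ ]′ (if-cases (centerTab i ! x) p)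
    where
    pivotal : (y , w) ∈ entryTo (2 * δ i) (pivotOf i (centerTab i) (listTab i) x) → Ok x y w
    pivotal q = let (e , e') = entryTo-∈ q in subst (Ok x y) (sym e') (ok-clamp (pivot-reach i e))
    listed : (y , w) ∈ L i x → Ok x y w
    listed q = proj₁ (M-ok τ (proj₁ (near-∈ i (L-near i q))))
    empty : (y , w) ∈ [] → Ok x y w
    empty ()

  edgeTab-ok : ∀ i {x y w} → (y , w) ∈ edgeTab i ! x → Ok x y w
  edgeTab-ok zero {x} {y} {w} p = none (subst ((y , w) ∈_) (tab-! (λ _ → []) x) p)
    where none : ∀ {e : It} {X : Set} → e ∈ [] → X
          none ()
  edgeTab-ok (suc i) {x} {y} {w} p = [ edgeTab-ok i , out-ok i ]′ (∈-++⁻ (edgeTab i ! x) (subst ((y , w) ∈_) (tab-! (λ x → edgeTab i ! x ++ out i (centerTab i) (listTab i) x) x) p))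

  out-edgeTab : ∀ {i} m {x e} → i < m → e ∈ out i (centerTab i) (listTab i) x → e ∈ edgeTab m ! x
  out-edgeTab {i} (suc m) {x} {e} lt p = subst (e ∈_) (sym (tab-! (λ x → edgeTab m ! x ++ out m (centerTab m) (listTab m) x) x)) (go (i ≟ m))
    where
    go : Dec (i ≡ m) → e ∈ edgeTab m ! x ++ out m (centerTab m) (listTab m) x
    go (yes refl) = ∈-++⁺ʳ (edgeTab i ! x) p
    go (no ne) = ∈-++⁺ˡ (out-edgeTab m (≤∧≢⇒< (≤-pred lt) ne) p)

  out-unpop : ∀ i {x e} → P i x → Unpop i x → e ∈ L i x → e ∈ out i (centerTab i) (listTab i) x
  out-unpop i {x} px ux p = ∈-if-true px (∈-if-false (does-false (popular? i (listTab i) x) (<⇒≱ ux)) p)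

  out-pop : ∀ i {x y} → P i x → Pop i x → pivotOf i (centerTab i) (listTab i) x ≡ just y → (y , mkW (2 * δ i)) ∈ out i (centerTab i) (listTab i) x
  out-pop i {x} px q e = ∈-if-true px (∈-if-true (does-true (popular? i (listTab i) x) q) (∈-entryTo e))

toList-∈ : ∀ {X : Set} {m : Maybe X} {x} → x ∈ toList m → m ≡ just x
toList-∈ {m = just _} (here refl) = refl

∈-toList : ∀ {X : Set} {m : Maybe X} {x} → m ≡ just x → x ∈ toList m
∈-toList refl = here refl

head-∈ : ∀ {X : Set} {l : List X} {x} → List.head l ≡ just x → x ∈ l
head-∈ {l = _ ∷ _} refl = here refl

∈-head : ∀ {X : Set} {l : List X} {x} → x ∈ l → ∃ λ y → List.head l ≡ just y
∈-head {l = y ∷ _} _ = y , refl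

-- Shortest walks in the emulator

module Shortest (k z : ℕ) where

  open Collect k z

  -- An edge is stored in the list of one of its ends; here it becomes usable from both.
  around : Tab (List It) → N → List It
  around F x = F ! x ++ concatMap (λ y → List.map (λ w → y , w) (concatMap (λ (c , w) → if does (c ≟N x) then w ∷ [] else []) (F ! y))) allN

  best : Tab (List It) → ℕ → N → N → Maybe ℕ
  candidates : Tab (List It) → ℕ → N → N → List ℕ
  best F j x y = minL (candidates F j x y)
  candidates F zero x y = if does (x ≟N y) then 0 ∷ [] else []
  candidates F (suc j) x y = (if does (x ≟N y) then 0 ∷ [] else []) ++
    concatMap (λ (u , w) → List.map (toℕ w +_) (toList (best F j u y))) (around F x)

  record FEdge (F : Tab (List It)) (x y : N) (b : ℕ) : Set where
    constructor fedge
    field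
      weight : Wt
      listed : (y , weight) ∈ F ! x ⊎ (x , weight) ∈ F ! y
      bounded : toℕ weight ≤ b

  fedge-sym : ∀ {F x y b} → FEdge F x y b → FEdge F y x b
  fedge-sym (fedge w p le) = fedge w (Sum.swap p) le

  ∈-around : ∀ {F x y w} → (y , w) ∈ F ! x ⊎ (x , w) ∈ F ! y → (y , w) ∈ around F x
  ∈-around (inj₁ p) = ∈-++⁺ˡ p
  ∈-around {F} {x} {y} {w} (inj₂ p) = ∈-++⁺ʳ (F ! x)
    (∈-cM⁺ (λ y → List.map (λ w → y , w) (concatMap (λ (c , w) → if does (c ≟N x) then w ∷ [] else []) (F ! y))) allN (∈-allN y)
      (∈-map⁺ (λ w → y , w) (∈-cM⁺ (λ (c , w) → if does (c ≟N x) then w ∷ [] else []) (F ! y) p (∈-if (does-true (x ≟N x) refl)))))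

  around-∈ : ∀ {F x y w} → (y , w) ∈ around F x → (y , w) ∈ F ! x ⊎ (x , w) ∈ F ! y
  around-∈ {F} {x} {y} {w} p = Sum.map₂ back (∈-++⁻ (F ! x) p)
    where
    rev : N → List Wt
    rev y = concatMap (λ (c , w) → if does (c ≟N x) then w ∷ [] else []) (F ! y)
    back : (y , w) ∈ concatMap (λ y → List.map (λ w → y , w) (rev y)) allN → (x , w) ∈ F ! y
    back q = let (y' , _ , r) = ∈-cM⁻ (λ y → List.map (λ w → y , w) (rev y)) allN q
                 (w' , r' , e) = ∈-map⁻ (λ w → y' , w) r
                 ((c , w'') , s , t) = ∈-cM⁻ (λ (c , w) → if does (c ≟N x) then w ∷ [] else []) (F ! y') r'
                 (e₁ , e₂) = if-∈ t
             in subst₂ (λ y w → (x , w) ∈ F ! y) (sym (cong proj₁ e)) (trans (sym e₂) (sym (cong proj₂ e)))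
                  (subst (λ c → (c , w'') ∈ F ! y') (does-true⁻ (c ≟N x) e₁) s)

  best-walk : ∀ {F} j {x y w} → WeightedWalks.Walks (FEdge F) j x y w → ∃ λ m → best F j x y ≡ just m × m ≤ w
  best-walk zero {x} WeightedWalks.nil = minL-≤ _ (∈-if (does-true (x ≟N x) refl))
  best-walk (suc j) {x} WeightedWalks.nil = minL-≤ _ (∈-++⁺ˡ (∈-if (does-true (x ≟N x) refl)))
  best-walk {F} (suc j) {x} {y} (WeightedWalks.cons {y = u} {a = a} {b} (fedge w p le) r) =
    let (m , e , m≤) = best-walk {F} j r
        (m' , e' , m'≤) = minL-≤ (candidates F (suc j) x y) (∈-++⁺ʳ (if does (x ≟N y) then 0 ∷ [] else [])
          (∈-cM⁺ (λ (u , w) → List.map (toℕ w +_) (toList (best F j u y))) (around F x) (∈-around {F} p) (∈-map⁺ (toℕ w +_) (∈-toList e))))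
    in m' , e' , ≤-trans m'≤ (+-mono-≤ le m≤)

-- Soundness and stretch of the estimates

module Final (k z a τ Y m : ℕ) (A : Virt.N k z → Virt.N k z → Bool) (A-sym : ∀ u v → A u v ≡ A v u) (16≤z : 16 ≤ z) where

  open Emulator k z a τ Y m A A-sym 16≤z public
  open Shortest k z public
  F-join : ∀ {x i} → i ∈ edgeTab (suc m) ! x ⊎ i ∈ hubEdges ! x ⊎ i ∈ entryTo (9 * 2 ^ τ) (hubOf ! x) → i ∈ F ! x
  F-join {x} {i} p = subst (i ∈_) (sym (tab-! (λ x → edgeTab (suc m) ! x ++ (hubEdges ! x ++ entryTo (9 * 2 ^ τ) (hubOf ! x))) x)) (go p)
    where
    go : _ → i ∈ edgeTab (suc m) ! x ++ (hubEdges ! x ++ entryTo (9 * 2 ^ τ) (hubOf ! x))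
    go (inj₁ q) = ∈-++⁺ˡ q
    go (inj₂ (inj₁ q)) = ∈-++⁺ʳ (edgeTab (suc m) ! x) (∈-++⁺ˡ q)
    go (inj₂ (inj₂ q)) = ∈-++⁺ʳ (edgeTab (suc m) ! x) (∈-++⁺ʳ (hubEdges ! x) q)

  F-split : ∀ {x i} → i ∈ F ! x → i ∈ edgeTab (suc m) ! x ⊎ i ∈ hubEdges ! x ⊎ i ∈ entryTo (9 * 2 ^ τ) (hubOf ! x)
  F-split {x} {i} p = Sum.map₂ (∈-++⁻ (hubEdges ! x)) (∈-++⁻ (edgeTab (suc m) ! x)
    (subst (i ∈_) (tab-! (λ x → edgeTab (suc m) ! x ++ (hubEdges ! x ++ entryTo (9 * 2 ^ τ) (hubOf ! x))) x) p))

  1≤2^ : ∀ t → 1 ≤ 2 ^ t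
  1≤2^ t = m^n>0 2 t

  hubOf⁻ : ∀ {x σ} → hubOf ! x ≡ just σ → Reach (9 * 2 ^ τ) x σ
  hubOf⁻ {x} {σ} e =
    let p = head-∈ (trans (sym (tab-! (λ x → List.head (hubCandidates ownHub (tab (A x)) x)) x)) e)
        (y , _ , q) = ∈-cM⁻ (λ y → if does (x ≟N y) ∨ (tab (A x) ! y) then toList (ownHub ! y) else []) allN p
    in [ uncurry (onward y) , (λ { (_ , ()) }) ]′ (if-cases (does (x ≟N y) ∨ (tab (A x) ! y)) q)
    where
    near-by : ∀ y → (does (x ≟N y) ∨ (tab (A x) ! y)) ≡ true → Reach 1 x y
    near-by y e with x ≟N y
    ... | yes refl = reach-refl
    ... | no _ = path-reach (edge (trans (sym (tab-! (A x) y)) e))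
    own⁻ : ∀ y → ownHub ! y ≡ just σ → dom τ y ≡ just σ
    own⁻ y e = go (heavy τ ! y) (trans (sym (tab-! (λ x → if heavy τ ! x then dom τ x else nothing) y)) e)
      where go : ∀ b → (if b then dom τ y else nothing) ≡ just σ → dom τ y ≡ just σ
            go true e = e
    onward : ∀ y → (does (x ≟N y) ∨ (tab (A x) ! y)) ≡ true → σ ∈ toList (ownHub ! y) → Reach (9 * 2 ^ τ) x σ
    onward y e q = reach-mono (+-monoˡ-≤ (8 * 2 ^ τ) (1≤2^ τ)) (reach-++ (near-by y e) (dom-reach τ {y} {σ} (own⁻ y (toList-∈ q))))

  ownHub⁻ : ∀ {y σ} → ownHub ! y ≡ just σ → Source τ σ
  ownHub⁻ {y} {σ} e = go (heavy τ ! y) refl (trans (sym (tab-! (λ x → if heavy τ ! x then dom τ x else nothing) y)) e)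
    where
    go : ∀ b → heavy τ ! y ≡ b → (if b then dom τ y else nothing) ≡ just σ → Source τ σ
    go true eh e = let (σ' , e' , src) = dom-heavy τ (heavy⁻ {τ} {y} eh) in subst (Source τ) (just-inj (trans (sym e') e)) src
      where just-inj : ∀ {u v : N} → just u ≡ just v → u ≡ v
            just-inj refl = refl

  hub-exists : ∀ x → Heavy τ x ⊎ (∃ λ y → Heavy τ y × A x y ≡ true) → ∃ λ σ → Source τ σ × hubOf ! x ≡ just σ
  hub-exists x p =
    let (y , hy , e) = access p
        (σ , eσ , _) = dom-heavy τ hy
        q = ∈-cM⁺ (λ y → if does (x ≟N y) ∨ (tab (A x) ! y) then toList (ownHub ! y) else []) allN (∈-allN y)
              (∈-if-true e (∈-toList (own y hy eσ)))
        (σ' , e') = ∈-head q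
        (y' , _ , r) = ∈-cM⁻ (λ y → if does (x ≟N y) ∨ (tab (A x) ! y) then toList (ownHub ! y) else []) allN (head-∈ e')
    in σ' , [ (λ (_ , s) → ownHub⁻ (toList-∈ s)) , (λ { (_ , ()) }) ]′ (if-cases (does (x ≟N y') ∨ (tab (A x) ! y')) r) ,
       trans (tab-! (λ x → List.head (hubCandidates ownHub (tab (A x)) x)) x) e'
    where
    own : ∀ y {σ} → Heavy τ y → dom τ y ≡ just σ → ownHub ! y ≡ just σ
    own y hy e = trans (tab-! (λ x → if heavy τ ! x then dom τ x else nothing) y)
      (trans (cong (λ b → if b then dom τ y else nothing) (heavy⁺ {τ} {y} hy)) e)
    ∨-true : ∀ a {b} → b ≡ true → (a ∨ b) ≡ true
    ∨-true true _ = refl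
    ∨-true false e = e
    access : Heavy τ x ⊎ (∃ λ y → Heavy τ y × A x y ≡ true) → ∃ λ y → Heavy τ y × (does (x ≟N y) ∨ (tab (A x) ! y)) ≡ true
    access (inj₁ hx) = x , hx , cong (_∨ (tab (A x) ! x)) (does-true (x ≟N x) refl)
    access (inj₂ (y , hy , e)) = y , hy , ∨-true (does (x ≟N y)) (trans (tab-! (A x) y) e)

  F-ok : ∀ {x y w} → (y , w) ∈ F ! x → Ok x y w
  F-ok {x} {y} {w} p = [ edgeTab-ok (suc m) , [ top , hubbed ]′ ]′ (F-split p)
    where
    top : (y , w) ∈ hubEdges ! x → Ok x y w
    top q = E-ok τ (H'.gather-∈ (E τ) (subst ((y , w) ∈_) (tab-! (H'.gather (E τ) []) x) q))
    hubbed : (y , w) ∈ entryTo (9 * 2 ^ τ) (hubOf ! x) → Ok x y w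
    hubbed q = let (e , e') = entryTo-∈ q in subst (Ok x y) (sym e') (ok-clamp (hubOf⁻ e))

  best-sound : ∀ j {x y d} → best F j x y ≡ just d → Reach d x y
  best-sound j {x} {y} e = go j (minL-∈ (candidates F j x y) e)
    where
    stop : ∀ {x d} → d ∈ (if does (x ≟N y) then 0 ∷ [] else []) → Reach d x y
    stop {x} p = let (e , e') = if-∈ p in subst₂ (λ d y → Reach d x y) (sym e') (does-true⁻ (x ≟N y) e) reach-refl
    go : ∀ j {x d} → d ∈ candidates F j x y → Reach d x y
    go zero p = stop p
    go (suc j) {x} {d} p = [ stop , hop ]′ (∈-++⁻ (if does (x ≟N y) then 0 ∷ [] else []) p)
      where
      hop : d ∈ concatMap (λ (u , w) → List.map (toℕ w +_) (toList (best F j u y))) (around F x) → Reach d x y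
      hop q = let ((u , w) , r , s) = ∈-cM⁻ (λ (u , w) → List.map (toℕ w +_) (toList (best F j u y))) (around F x) q
                  (d' , t , e) = ∈-map⁻ (toℕ w +_) s
                  first = [ F-ok , reach-sym ∘ F-ok ]′ (around-∈ {F} r)
              in subst (λ d → Reach d x y) (sym e) (reach-++ first (go j (minL-∈ (candidates F j u y) (toList-∈ t))))

  module Stretch (e l : ℕ) (1≤e : 1 ≤ e) (1≤Y : 1 ≤ Y) (Y≡ : Y ≡ 2 * e * l) (m≤l : m ≤ l)
                 (δ≤ : δ m ≤ 2 ^ τ) (K<κ : K < κ m) (24≤a : 24 ≤ a) (slack≤ : 2 * e * slack τ ≤ a)
                 (Λ-fits : 160 * e * 2 ^ τ + 18 * 2 ^ τ ≤ a * 2 ^ τ) where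

    fromF : ∀ {x y w b} → (y , w) ∈ F ! x → toℕ w ≤ b → FEdge F x y b
    fromF p le = fedge _ (inj₁ p) le

    δ-mono : ∀ {i j} → i ≤ j → δ i ≤ δ j
    δ-mono {i} le with m≤n⇒∃[o]m+o≡n le
    ... | o , refl = go o
      where
      go : ∀ o → δ i ≤ δ (i + o)
      go zero = ≤-reflexive (cong δ (sym (+-identityʳ i)))
      go (suc o) = ≤-trans (go o) (≤-trans (+-mono-≤ (*-monoʳ-≤ Y (b-step (i + o))) (*-monoʳ-≤ 2 (R-step (i + o))))
        (≤-reflexive (cong δ (sym (+-suc i o)))))

    -- No list is longer than `K` < `κ m`, so nothing is popular at level `m` and no center survives
    -- it. The statements for all levels required by `Levels` thus reduce to the levels that were
    -- built.
    no-more : ∀ i {x} → m < i → P i x → ⊥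
    no-more (suc i) lt p = go (i ≟ m) p
      where
      go : ∀ {x} → Dec (i ≡ m) → P (suc i) x → ⊥
      go (yes refl) p = <⇒≱ K<κ (≤-trans (proj₂ (centers-∈ {i} {centerTab i} {listTab i} (P-center i p))) (L-length i _))
      go (no ne) p = no-more i (≤∧≢⇒< (≤-pred lt) (ne ∘ sym)) (P-down i p)

    decide : ∀ i {x} → P i x → Unpop i x ⊎ Pop i x
    decide i {x} _ with κ i ≤? length (L i x)
    ... | yes p = inj₂ p
    ... | no p = inj₁ (≰⇒> p)

    neighbours : ∀ i {x y r} → P i x → Unpop i x → P i y → Reach r x y → r ≤ δ i → FEdge F x y r
    neighbours i {x} {y} {r} px ux py xy r≤ = go (i ≤? m)
      where
      go : Dec (i ≤ m) → FEdge F x y r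
      go (no p) = ⊥-elim (no-more i (≰⇒> p) px)
      go (yes p) = let (w , q , le) = complete i px ux py xy r≤ (≤-trans (δ-mono p) δ≤) in
        fromF (F-join (inj₁ (out-edgeTab (suc m) (s≤s p) (out-unpop i px ux q)))) le

    pivot : ∀ i {x} → P i x → Pop i x → ∃ λ y → P (suc i) y × FEdge F x y (2 * δ i) × Reach (2 * δ i) x y
    pivot i {x} px q with i ≤? m
    ... | no p = ⊥-elim (no-more i (≰⇒> p) px)
    ... | yes p = let (y , e) = pivot-exists i px q in
      y , center-P i (proj₁ (pivot-sound i e)) ,
      fromF {x} {y} (F-join (inj₁ (out-edgeTab (suc m) (s≤s p) (out-pop i px q e)))) (mkW≤ (2 * δ i)) , pivot-reach i e

    last : ∀ {x} → P m x → Unpop m x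
    last {x} _ = ≤-<-trans (L-length m x) K<κ

    module Lv = Levels A A-sym (FEdge F) fedge-sym Y 1≤Y P Unpop Pop decide neighbours pivot m last

    classify : ∀ x → P 0 x ⊎ Heavy τ x
    classify x = Sum.map₁ P-zero⁺ (Light? τ x)

    hub : ∀ x → Heavy τ x ⊎ (∃ λ y → Heavy τ y × A x y ≡ true) →
          ∃ λ σ → Source τ σ × FEdge F x σ (9 * 2 ^ τ) × Reach (9 * 2 ^ τ) x σ
    hub x p = let (σ , src , e) = hub-exists x p in
      σ , src , fromF {x} {σ} (F-join (inj₂ (inj₂ (∈-entryTo e)))) (mkW≤ (9 * 2 ^ τ)) , hubOf⁻ e

    room : length (active (net τ)) * (3 * 2 ^ h) ≤ length slots
    room = ≤-trans (*-monoˡ-≤ (3 * 2 ^ h) (sources-length τ)) (≤-trans (≤-reflexive (lemma (2 ^ h)))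
      (≤-trans (*-monoʳ-≤ (2 ^ h * 2 ^ h) (≤-trans (m≤m+n 9 7) 16≤z)) (≤-reflexive (sym length-slots))))
      where lemma : ∀ s → 3 * s * (3 * s) ≡ s * s * 9
            lemma = solve-∀

    hubs : ∀ {σ σ' r} → Source τ σ → Source τ σ' → Reach r σ σ' → r ≤ a * 2 ^ τ →
           ∃ λ w → FEdge F σ σ' w × 2 * e * w ≤ (2 * e + 1) * r + 2 * e * (24 * 2 ^ τ)
    hubs {σ} {σ'} {r} src src' p r≤ =
      let (w , w∈ , le) = accuracy τ 24≤a slack≤a src' p r≤
          q = H'.∈-gather (E τ) {[]} (∈-active src) refl
                (≤-trans (*-monoˡ-≤ (3 * 2 ^ h) (length-filter (λ x → noGroup x ≟ᵇ []) (active (net τ)))) room)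
                (≤-trans (E-length τ σ) (sources-length τ)) w∈
      in toℕ w , fromF (F-join (inj₂ (inj₁ (subst ((σ' , w) ∈_) (sym (tab-! (H'.gather (E τ) []) σ)) q)))) ≤-refl ,
         scale (2 ^ τ) (toℕ w) le
      where
      slack≤a : slack τ ≤ a
      slack≤a = ≤-trans (m≤n*m (slack τ) (2 * e) {{>-nonZero (≤-trans 1≤e (m≤m+n e (e + 0)))}}) slack≤
      scale : ∀ ρ w → a * w ≤ Err 24 a (slack τ) ρ r → 2 * e * w ≤ (2 * e + 1) * r + 2 * e * (24 * ρ)
      scale ρ w le = *-cancelˡ-≤ a {{>-nonZero (≤-trans (s≤s z≤n) 24≤a)}} (begin
        a * (2 * e * w)                                              ≡⟨ l₁ a (2 * e) w ⟩
        2 * e * (a * w)                                              ≤⟨ *-monoʳ-≤ (2 * e) (≤-trans le (≤-reflexive (Err-def 24 a (slack τ) ρ r))) ⟩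
        2 * e * ((a + slack τ) * r + a * (24 * ρ))                   ≡⟨ l₂ a (2 * e) (slack τ) r (24 * ρ) ⟩
        2 * e * a * r + 2 * e * slack τ * r + 2 * e * a * (24 * ρ)   ≤⟨ +-monoˡ-≤ (2 * e * a * (24 * ρ)) (+-monoʳ-≤ (2 * e * a * r) (*-monoˡ-≤ r slack≤)) ⟩
        2 * e * a * r + a * r + 2 * e * a * (24 * ρ)                 ≡⟨ l₃ a (2 * e) r (24 * ρ) ⟩
        a * ((2 * e + 1) * r + 2 * e * (24 * ρ))                     ∎)
        where
        open ≤-Reasoning
        l₁ : ∀ a e w → a * (e * w) ≡ e * (a * w)
        l₁ = solve-∀
        l₂ : ∀ a e s r ρ → e * ((a + s) * r + a * ρ) ≡ e * a * r + e * s * r + e * a * ρ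
        l₂ = solve-∀
        l₃ : ∀ a e r ρ → e * a * r + a * r + e * a * ρ ≡ a * ((e + 1) * r + e * ρ)
        l₃ = solve-∀

    b≤ρ : b m ≤ 2 ^ τ
    b≤ρ = ≤-trans (≤-trans (m≤n*m (b m) Y {{>-nonZero 1≤Y}}) (m≤m+n (Y * b m) (2 * R m))) δ≤

    module Hb = Lv.Hubs e l (2 ^ τ) a 1≤e Y≡ m≤l b≤ρ (1≤2^ τ) (Heavy τ) (Source τ) classify hub hubs Λ-fits

    estimate-bound : ∀ {x y d} → Path Always x y d →
                     ∃ λ w → best F D x y ≡ just w × e * w ≤ suc e * d + e * (80 * 2 ^ τ)
    estimate-bound {x} {y} {d} p =
      let (w , (j , wk) , le) = Hb.stretch p
          (w' , w'≤ , wk') = shorten place place-inj wk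
          (w'' , eq , w''≤) = best-walk D wk'
      in w'' , eq , *-cancelˡ-≤ 2 (begin
        2 * (e * w'')                                  ≤⟨ *-monoʳ-≤ 2 (*-monoʳ-≤ e (≤-trans w''≤ w'≤)) ⟩
        2 * (e * w)                                    ≡⟨ sym (*-assoc 2 e w) ⟩
        2 * e * w                                      ≤⟨ le ⟩
        suc (2 * e + 1) * d + 2 * e * (80 * 2 ^ τ)     ≡⟨ lemma e d (80 * 2 ^ τ) ⟩
        2 * (suc e * d + e * (80 * 2 ^ τ))             ∎)
      where
      open ≤-Reasoning
      lemma : ∀ e d β → suc (2 * e + 1) * d + 2 * e * β ≡ 2 * (suc e * d + e * β)
      lemma = solve-∀
      place : N → Fin D
      place a = fromℕ< (idx<D a)
      place-inj : ∀ {u v} → place u ≡ place v → u ≡ v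
      place-inj {u} {v} e = trans (sym (node-idx u)) (trans (cong node (fromℕ<-injective _ _ _ _ e)) (node-idx v))

-- Round complexity of the construction

module Schedule (n k z B c : ℕ) .{{nz : NonZero n}} (n≤D : n ≤ Virt.D k z) (D≤ : Virt.D k z ≤ suc c * n)
                (fits : suc c * (suc c * Virt.msgWidth k z) ≤ B) (1≤z : 1 ≤ z) where

  open Rounds n k z B c n≤D D≤ fits 1≤z public
  open Lookup k z using (findW; everything; selfW; entryTo)
  open DecMem _≟N_ using (_∈?_)

  Input : Set
  Input = N → N → Bool

  bMsg : Bool → Msg
  bMsg b = wMsg (if b then just (mkW 0) else nothing)

  readB : Msg → Bool
  readB m = Maybe.is-just (readW m)

  readB-bMsg : ∀ b → readB (bMsg b) ≡ b
  readB-bMsg true = cong Maybe.is-just (readW-wMsg (just (mkW 0)))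
  readB-bMsg false = cong Maybe.is-just (readW-wMsg nothing)

  nMsg : Maybe N → Msg
  nMsg d = toMsg (List.map (_, mkW 0) (toList d))

  readN : Msg → Maybe N
  readN m = Maybe.map proj₁ (List.head (fromMsg m))

  readN-nMsg : ∀ d → readN (nMsg d) ≡ d
  readN-nMsg nothing = trans (cong (Maybe.map proj₁ ∘ List.head) (from-to z [])) (go z)
    where go : ∀ z → Maybe.map proj₁ (List.head {A = It} (take z [])) ≡ nothing
          go zero = refl
          go (suc _) = refl
  readN-nMsg (just y) = trans (cong (Maybe.map proj₁ ∘ List.head) (from-to z ((y , mkW 0) ∷ []))) (go z 1≤z)
    where go : ∀ z → 1 ≤ z → Maybe.map proj₁ (List.head {A = It} (take z ((y , mkW 0) ∷ []))) ≡ just y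
          go (suc _) _ = refl

  exchangeK : ∀ {T X V} {f : Input → N → X} (send : V → Msg) (read : Msg → V) → (∀ v → read (send v) ≡ v) →
              (m : N → X → N → V) → Know T f → Know (suc T) (λ A a → f A a , tab (λ b → m b (f A b) a))
  exchangeK {f = f} send read inv m K₀ = eqK
    (λ A a → cong (f A a ,_) (tab-cong λ b → trans (cong read (tab-! (λ b → send (m b (f A b) a)) b)) (inv (m b (f A b) a))))
    (mapK (λ _ (s , t) → s , tab (λ b → read (t ! b))) (commK (λ b s a → send (m b s a)) K₀))

  castK : ∀ {T T' X} {f : Input → N → X} → T ≡ T' → Know T f → Know T' f
  castK refl K₀ = K₀

  -- Ten rounds: one to tell every node who touches it, six for the product that finds conflicts,
  -- two to gather the conflict lists, one to announce the chosen nodes.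
  ruleK : ∀ {T G L j} {g : Input → G} {l : Input → N → L} (grp : N → Vec Bool j) (ρ : Wt) (Q : G → Tab Bool) (M : L → List It) →
          Know T (λ A a → g A , l A a) →
          Know (10 + T) (λ A v → Ruling.next k z grp ρ (Q (g A)) (λ x → M (l A x)) ,
            (l A v , Ruling.dominators k z grp ρ (Q (g A)) (λ x → M (l A x)) (grp v)
                       (Ruling.lists k z grp ρ (Q (g A)) (λ x → M (l A x)) (grp v))))
  ruleK {G = G} {L} {g = g} {l} grp ρ Q M K₀ =
    -- The gathered table already holds what the choice takes from the balls, so the family of balls
    -- is filled with an empty placeholder.
    mapK (λ v (((γ , (s , _)) , t) , nx) → nx , (s , Ruling.dominators k z grp ρ (Q γ) (λ _ → []) (grp v) t))
      (exchangeK bMsg readB readB-bMsg (λ v ((γ , _) , t) _ → Ruling.isNext k z grp ρ (Q γ) (λ _ → []) v t)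
        (gatherK {g = g} {l = λ A v → l A v , R.Λ A v} _≟ᵇ_ grp (λ γ → Ruling.active k z grp ρ (Q γ) (λ _ → [])) (λ _ → 2 ^ k) (λ _ _ s → proj₂ s)
          (mapK (λ _ (((γ , s) , _) , p) → γ , (s , take (2 ^ k) p))
            (prodK (λ x ((γ , s) , _) y → if touch (Q γ) s x y then just ρ else nothing)
              (λ _ (_ , V) → Offers.offered k z grp ρ V)
              (λ x c → does (grp x ≟ᵇ grp c))
              (exchangeK bMsg readB readB-bMsg (λ x (γ , s) y → touch (Q γ) s x y) K₀)))))
    where
    module R (A : Input) = Ruling k z grp ρ (Q (g A)) (λ x → M (l A x))
    touch : Tab Bool → L → N → N → Bool
    touch q s x y = q ! x ∧ does (y ∈? keys (M s))

  module Scales (a : ℕ) where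

    module E (A : Input) = Net k z a A

    Local : Set
    Local = Tab Bool × List It × List It

    local : ℕ → Input → N → Local
    local t A x = tab (A x) , E.M A t x , E.hopEdges A t x

    rowBase : N → Tab Bool → List It
    rowBase x r = (x , mkW 0) ∷ concatMap (λ c → if r ! c then (c , mkW 1) ∷ [] else []) allN

    rowBase-eq : ∀ A x → rowBase x (tab (A x)) ≡ E.base A x
    rowBase-eq A x = cong ((x , mkW 0) ∷_) (trans
      (concatMap-cong (λ c → cong (λ b → if b then (c , mkW 1) ∷ [] else []) (tab-! (A x) c)) allN)
      (sym (E.nbrs-def A x)))

    localK₀ : Know 0 (local 0)
    localK₀ = eqK (λ A x → cong₂ (λ l l' → tab (A x) , l , l') (cong trunc (rowBase-eq A x)) (trans (rowBase-eq A x) (sym (E.hopEdges-zero A x))))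
      (mapK (λ x r → r , trunc (rowBase x r) , rowBase x r) initK)

    steps : ℕ
    steps = 6 * a + 12

    hopsK : ∀ {T t} i → Know T (λ A x → E.net A t , (local t A x , E.dom A t x)) →
            Know (i * 6 + T) (λ A x → (E.net A t , (local t A x , E.dom A t x)) , E.hops A (E.hopEdges A t) (E.net A t) i x)
    hopsK {t = t} zero K₀ = mapK (λ x (s , l) → (s , l) , (if s ! x then (x , mkW 0) ∷ [] else [])) K₀
    hopsK {t = t} (suc i) K₀ = mapK (λ _ (((s , l) , _) , p) → (s , l) , p)
      (prodK (λ _ ((_ , ((_ , _ , rl) , _)) , _) y → findW y rl) (λ _ (_ , h) → h) everything (hopsK i K₀))

    heavyK : ∀ {T} t → Know T (local t) → Know (suc T) (λ A x → E.heavy A t , local t A x)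
    heavyK t K₀ = mapK (λ _ (l , h) → h , l)
      (exchangeK bMsg readB readB-bMsg (λ _ (_ , m , _) _ → does (K ≤? length m)) K₀)

    domK : ∀ {T} t → Know T (local t) → Know (21 + T) (λ A x → E.net A t , (local t A x , E.dom A t x))
    domK t K₀ = eqK (λ A x → cong (λ d → E.net A t , (local t A x , d)) (sym (E.dom-def A t x)))
      (mapK (λ x (s , ((l , d₁) , d₂)) → s , (l , Maybe.maybe (λ y → d₂ ! y) nothing (d₁ ! x)))
        (ruleK {g = λ A → E.R₁.next A t}
               {l = λ A v → local t A v , E.R₁.dominators A t (E.grp₁ A v) (E.R₁.lists A t (E.grp₁ A v))}
               (λ _ → []) (mkW 0) id (λ l → proj₁ (proj₂ (proj₁ l)))
          (ruleK {g = λ A → E.heavy A t} {l = local t} (λ (u , _) → Vec.take k u) (mkW 0) id (λ l → proj₁ (proj₂ l)) (heavyK t K₀))))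

    scaleK : ∀ {T} t → Know T (local t) →
             Know (6 * steps + (21 + T)) (λ A x → (E.net A t , (local t A x , E.dom A t x)) , E.E A t x)
    scaleK {T} t K₀ = castK (cong (_+ (21 + T)) (*-comm steps 6))
      (eqK {f = λ A x → known A x , E.hops A (E.hopEdges A t) (E.net A t) steps x} {f' = λ A x → known A x , E.E A t x} (λ A x → pair-eq (known A x) (cong (λ e → e x) (sym (E.E-def A t))))
        (hopsK steps (domK t K₀)))
      where
      known : Input → N → Tab Bool × (Local × Maybe N)
      known A x = E.net A t , (local t A x , E.dom A t x)
      pair-eq : ∀ {X : Set} (s : X) {u v : List It} → u ≡ v → (s , u) ≡ (s , v)
      pair-eq s refl = refl

    -- Seven further rounds: one to reverse the estimates, six to square the balls.
    nextK : ∀ {T} t → Know T (local t) → Know (7 + (6 * steps + (21 + T))) (local (suc t))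
    nextK t K₀ = eqK (λ A x → cong (λ rl → tab (A x) , E.M A (suc t) x , rl)
        (trans (cong (_++ (E.M A t x ++ (E.E A t x ++ (E.fromTab A (E.reverse A (E.E A t) x) ++ entryTo (8 * 2 ^ t) (E.dom A t x))))) (rowBase-eq A x)) (sym (E.hopEdges-suc A t x))))
      (mapK (λ x (((((_ , ((r , m , _) , d)) , e) , rev)) , m') → r , m' ,
          (rowBase x r ++ (m ++ (e ++ (E.fromTab (λ _ _ → false) rev ++ entryTo (8 * 2 ^ t) d)))))
        (prodK (λ x (((_ , ((_ , m , _) , _)) , _) , _) → selfW x m) (λ _ (((_ , ((_ , m , _) , _)) , _) , _) → m) everything
          (exchangeK wMsg readW readW-wMsg (λ y (_ , e) x → findW x e) (scaleK t K₀))))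

    localK : ∀ t → Know (t * (28 + 6 * steps)) (local t)
    localK zero = localK₀
    localK (suc t) = castK (lemma (6 * steps) (t * (28 + 6 * steps))) (nextK t (localK t))
      where lemma : ∀ h T → 7 + (h + (21 + T)) ≡ 28 + h + T
            lemma = solve-∀

  module Phases (a τ Y m : ℕ) where

    open Scales a
    open Clusters k z Y
    module U (A : Input) = Build k z a τ Y m A

    Rest : Set
    Rest = Tab Bool × List It × Maybe N × List It

    own : Input → N → Maybe N
    own A x = if E.heavy A τ ! x then E.dom A τ x else nothing

    rest : Input → N → Rest
    rest A x = tab (A x) , E.M A τ x , own A x , E.E A τ x

    phaseRounds : ℕ → ℕ
    phaseRounds i = i * 2 + (1 + (6 * steps + (21 + τ * (28 + 6 * steps))))

    -- The part of the knowledge that is identical at all nodes. Having no node as argument, it can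
    -- determine the relay assignment in `gatherK`.
    glob : ℕ → Input → Tab Bool × Tab Bool × Tab (List It)
    glob i A = E.net A τ , U.centerTab A i , U.edgeTab A i

    startK : Know (phaseRounds 0) (λ A x → glob 0 A , rest A x)
    startK = eqK eq (mapK (λ _ ((s , l) , p) → (s , p , tab (λ _ → [])) , l)
        (exchangeK bMsg readB readB-bMsg (λ _ (_ , (_ , l , _)) _ → does (length l <? K))
          (mapK (λ x ((s , ((r , l , _) , d)) , e) → s , (r , l , (if does (K ≤? length l) then d else nothing) , e)) (scaleK τ (localK τ)))))
      where
      eq : ∀ A x → _≡_ {A = (Tab Bool × Tab Bool × Tab (List It)) × Rest}
           ((E.net A τ , tab (λ y → does (length (E.M A τ y) <? K)) , tab (λ _ → [])) ,
            (tab (A x) , E.M A τ x , (if does (K ≤? length (E.M A τ x)) then E.dom A τ x else nothing) , E.E A τ x))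
           (glob 0 A , rest A x)
      eq A x = cong₂ {A = Tab Bool} {B = Bool} (λ p b → (E.net A τ , p , tab (λ _ → [])) , (tab (A x) , E.M A τ x , (if b then E.dom A τ x else nothing) , E.E A τ x))
        (sym (U.centerTab-zero A)) (sym (tab-! (λ x → does (K ≤? length (E.M A τ x))) x))

    phaseK : ∀ i → Know (phaseRounds i) (λ A x → glob i A , rest A x)
    phaseK zero = startK
    phaseK (suc i) = eqK eq (mapK (λ _ (((s , p , H) , l) , t) → (s , nextP i p t , tab (λ x → H ! x ++ out i p t x)) , l)
        (gatherK {g = glob i} {l = rest} _≟ᵇ_ noGroup (λ (_ , p , _) → active p) (λ _ → κ i)
          (λ _ (_ , p , _) (_ , l , _) → near i p l) (phaseK i)))
      where
      eq : ∀ A x → _≡_ {A = (Tab Bool × Tab Bool × Tab (List It)) × Rest}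
           ((E.net A τ , nextP i (U.centerTab A i) (collected i (U.centerTab A i) (E.M A τ)) ,
              tab (λ x → U.edgeTab A i ! x ++ out i (U.centerTab A i) (collected i (U.centerTab A i) (E.M A τ)) x)) , rest A x)
           (glob (suc i) A , rest A x)
      eq A x = trans (cong {A = Tab (List It)} (λ t → (E.net A τ , nextP i (U.centerTab A i) t , tab (λ x → U.edgeTab A i ! x ++ out i (U.centerTab A i) t x)) , rest A x) (sym (U.listTab-def A i)))
        (cong {A = Tab Bool} (λ p → (E.net A τ , p , U.edgeTab A (suc i)) , rest A x) (sym (U.centerTab-suc A i)))

    -- The last four rounds announce the hubs of heavy nodes, then the hubs of all nodes, and gather
    -- the distances within the net. After that every node knows the emulator and computes locally.
    estimateK : Know (4 + phaseRounds (suc m)) (λ A x → tab (λ y → Shortest.best k z (U.F A) D x y))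
    estimateK = mapK (λ x (((_ , _ , H) , (_ , d)) , t) → tab (λ y → Shortest.best k z (assemble (9 * 2 ^ τ) H t d) D x y))
      (gatherK {g = glob (suc m)} {l = λ A x → rest A x , U.hubOf A} _≟ᵇ_ noGroup (λ (s , _) → active s) (λ _ → 3 * 2 ^ h)
        (λ _ _ ((_ , _ , _ , e) , _) → e)
        (mapK (λ _ (((g , l) , _) , d) → g , (l , d))
          (exchangeK nMsg readN readN-nMsg (λ x ((_ , (r , _)) , d) _ → List.head (hubCandidates d r x))
            (exchangeK nMsg readN readN-nMsg (λ _ (_ , (_ , _ , d , _)) _ → d) (phaseK (suc m))))))

-- Binary logarithms

lg-half : ∀ {n} → 2 ≤ n → lg n ≡ suc (lg ⌈ n /2⌉)
lg-half {n} 2≤n = trans (sym (m+[n∸m]≡n {1} 1≤lg)) (cong suc (sym (⌈log₂⌈n/2⌉⌉≡⌈log₂n⌉∸1 n)))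
  where
  1≤lg : 1 ≤ lg n
  1≤lg = ⌈log₂⌉-mono-≤ {2} {n} 2≤n

n≤2*half : ∀ n → n ≤ 2 * ⌈ n /2⌉
n≤2*half zero = z≤n
n≤2*half (suc zero) = s≤s z≤n
n≤2*half (suc (suc n)) = ≤-trans (s≤s (s≤s (n≤2*half n))) (≤-reflexive (lemma ⌈ n /2⌉))
  where lemma : ∀ m → suc (suc (2 * m)) ≡ 2 * suc m
        lemma = solve-∀

2*half≤ : ∀ n → 2 * ⌈ n /2⌉ ≤ suc n
2*half≤ zero = z≤n
2*half≤ (suc zero) = ≤-refl
2*half≤ (suc (suc n)) = ≤-trans (≤-reflexive (sym (lemma ⌈ n /2⌉))) (s≤s (s≤s (2*half≤ n)))
  where lemma : ∀ m → suc (suc (2 * m)) ≡ 2 * suc m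
        lemma = solve-∀

half< : ∀ {n} → 2 ≤ n → ⌈ n /2⌉ < n
half< {suc (suc n)} _ = s≤s (s≤s (⌈n/2⌉≤n n))
half< {suc zero} (s≤s ())

n≤2^lg : ∀ n → n ≤ 2 ^ lg n
n≤2^lg = <-rec (λ n → n ≤ 2 ^ lg n) induct
  where
  induct : ∀ n → (∀ {m} → m < n → m ≤ 2 ^ lg m) → n ≤ 2 ^ lg n
  induct n ih with 2 ≤? n
  ... | no p = ≤-trans (≤-pred (≰⇒> p)) (m^n>0 2 (lg n))
  ... | yes p = ≤-trans (n≤2*half n) (≤-trans (*-monoʳ-≤ 2 (ih (half< p))) (≤-reflexive (cong (2 ^_) (sym (lg-half p)))))

-- Halving rounds up, so the bound 2 * n alone does not survive the induction, whereas 2 * (n - 1)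
-- does. The term 2 ∸ n accounts for n = 1.
2^lg≤ : ∀ n → 1 ≤ n → 2 ^ lg n + 2 ≤ 2 * n + (2 ∸ n)
2^lg≤ = <-rec (λ n → 1 ≤ n → 2 ^ lg n + 2 ≤ 2 * n + (2 ∸ n)) induct
  where
  induct : ∀ n → (∀ {m} → m < n → 1 ≤ m → 2 ^ lg m + 2 ≤ 2 * m + (2 ∸ m)) → 1 ≤ n → 2 ^ lg n + 2 ≤ 2 * n + (2 ∸ n)
  induct (suc zero) ih _ = ≤-refl
  induct (suc (suc zero)) ih _ = ≤-refl
  induct n@(suc (suc (suc m))) ih _ = begin
    2 ^ lg n + 2                            ≡⟨ cong (λ l → 2 ^ l + 2) (lg-half {n} (s≤s (s≤s z≤n))) ⟩
    2 * 2 ^ lg j + 2                        ≤⟨ +-cancelʳ-≤ 2 _ _ (≤-trans (≤-reflexive (l₁ (2 ^ lg j))) (≤-trans (*-monoʳ-≤ 2 (≤-trans (ih (half< {n} (s≤s (s≤s z≤n))) (s≤s z≤n)) (≤-reflexive (trans (cong (2 * j +_) (m≤n⇒m∸n≡0 2≤j)) (+-identityʳ (2 * j)))))) (≤-trans (*-monoʳ-≤ 2 (2*half≤ n)) (≤-reflexive (l₂ n))))) ⟩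
    2 * n                                   ≡⟨ sym (+-identityʳ (2 * n)) ⟩
    2 * n + 0                               ∎
    where
    open ≤-Reasoning
    j = ⌈ n /2⌉
    2≤j : 2 ≤ j
    2≤j = s≤s (s≤s z≤n)
    l₁ : ∀ x → 2 * x + 2 + 2 ≡ 2 * (x + 2)
    l₁ = solve-∀
    l₂ : ∀ n → 2 * suc n ≡ 2 * n + 2
    l₂ = solve-∀

2^lg≤2n : ∀ {n} → 1 ≤ n → 2 ^ lg n ≤ 2 * n
2^lg≤2n {suc zero} _ = s≤s z≤n
2^lg≤2n {n@(suc (suc m))} le = ≤-trans (m≤m+n _ 2) (≤-trans (2^lg≤ n le) (≤-reflexive (trans (cong (2 * n +_) (m≤n⇒m∸n≡0 {2} {n} (s≤s (s≤s z≤n)))) (+-identityʳ (2 * n)))))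

-- Size of the radii

module RadiiBound (Y : ℕ) (1≤Y : 1 ≤ Y) where

  open Radii Y

  -- The factor 40 comes from `b`: with u bounding both quantities, the recursion gives at most 8 Y
  -- u + 32 u ≤ 40 Y u.
  both : ∀ i → R i ≤ (40 * Y) ^ i × b i ≤ (40 * Y) ^ i
  both zero = z≤n , ≤-refl
  both (suc i) = let (r , b') = both i in R-bound r b' , b-bound r b'
    where
    u = (40 * Y) ^ i
    open ≤-Reasoning
    R-le : R i ≤ u → b i ≤ u → R (suc i) ≤ u + 2 * (Y * u + 2 * u)
    R-le r b' = +-mono-≤ r (*-monoʳ-≤ 2 (+-mono-≤ (*-monoʳ-≤ Y b') (*-monoʳ-≤ 2 r)))
    u≤Yu : u ≤ Y * u
    u≤Yu = m≤n*m u Y {{>-nonZero 1≤Y}}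
    R-bound : R i ≤ u → b i ≤ u → R (suc i) ≤ 40 * Y * u
    R-bound r b' = begin
      R (suc i)                 ≤⟨ R-le r b' ⟩
      u + 2 * (Y * u + 2 * u)   ≡⟨ l₁ u (Y * u) ⟩
      2 * (Y * u) + 5 * u       ≤⟨ +-monoʳ-≤ (2 * (Y * u)) (*-monoʳ-≤ 5 u≤Yu) ⟩
      2 * (Y * u) + 5 * (Y * u) ≤⟨ m≤m+n _ (33 * (Y * u)) ⟩
      2 * (Y * u) + 5 * (Y * u) + 33 * (Y * u) ≡⟨ l₂ Y u ⟩
      40 * Y * u                ∎
      where
      l₁ : ∀ u v → u + 2 * (v + 2 * u) ≡ 2 * v + 5 * u
      l₁ = solve-∀
      l₂ : ∀ Y u → 2 * (Y * u) + 5 * (Y * u) + 33 * (Y * u) ≡ 40 * Y * u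
      l₂ = solve-∀
    1≤u : 1 ≤ u
    1≤u = m^n>0 (40 * Y) {{>-nonZero (*-mono-≤ {1} {40} (s≤s z≤n) 1≤Y)}} i
    b-bound : R i ≤ u → b i ≤ u → b (suc i) ≤ 40 * Y * u
    b-bound r b' = begin
      2 * b i + 4 * R (suc i) + 8 * R i + 2              ≤⟨ +-mono-≤ (+-mono-≤ (+-mono-≤ (*-monoʳ-≤ 2 b') (*-monoʳ-≤ 4 (R-le r b'))) (*-monoʳ-≤ 8 r)) (*-monoʳ-≤ 2 1≤u) ⟩
      2 * u + 4 * (u + 2 * (Y * u + 2 * u)) + 8 * u + 2 * u ≡⟨ l₁ u (Y * u) ⟩
      8 * (Y * u) + 32 * u                               ≤⟨ +-monoʳ-≤ (8 * (Y * u)) (*-monoʳ-≤ 32 u≤Yu) ⟩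
      8 * (Y * u) + 32 * (Y * u)                         ≡⟨ l₂ Y u ⟩
      40 * Y * u                                         ∎
      where
      l₁ : ∀ u v → 2 * u + 4 * (u + 2 * (v + 2 * u)) + 8 * u + 2 * u ≡ 8 * v + 32 * u
      l₁ = solve-∀
      l₂ : ∀ Y u → 8 * (Y * u) + 32 * (Y * u) ≡ 40 * Y * u
      l₂ = solve-∀

  δ-bound : ∀ i → δ i ≤ (40 * Y) ^ suc i
  δ-bound i = let (r , b') = both i ; u = (40 * Y) ^ i in begin
    Y * b i + 2 * R i              ≤⟨ +-mono-≤ (*-monoʳ-≤ Y b') (*-monoʳ-≤ 2 r) ⟩
    Y * u + 2 * u                  ≤⟨ +-monoʳ-≤ (Y * u) (*-monoʳ-≤ 2 (m≤n*m u Y {{>-nonZero 1≤Y}})) ⟩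
    Y * u + 2 * (Y * u)            ≤⟨ m≤m+n _ (37 * (Y * u)) ⟩
    Y * u + 2 * (Y * u) + 37 * (Y * u) ≡⟨ lemma Y u ⟩
    40 * Y * u                     ∎
    where
    open ≤-Reasoning
    lemma : ∀ Y u → Y * u + 2 * (Y * u) + 37 * (Y * u) ≡ 40 * Y * u
    lemma = solve-∀

κ-power : ∀ i → κ i ≡ 2 ^ (4 * 2 ^ i)
κ-power zero = refl
κ-power (suc i) = trans (cong₂ _*_ (κ-power i) (κ-power i)) (trans (sym (^-distribˡ-+-* 2 (4 * 2 ^ i) (4 * 2 ^ i)))
  (cong (2 ^_) (lemma (2 ^ i))))
  where lemma : ∀ x → 4 * x + 4 * x ≡ 4 * (2 * x)
        lemma = solve-∀

-- Transfer of the estimates to the vertices of the graph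

roundsFor : ℕ → ℕ → ℕ → ℕ
roundsFor a τ m = 4 + (suc m * 2 + (1 + (6 * (6 * a + 12) + (21 + τ * (28 + 6 * (6 * a + 12))))))

module Run (n k z B c e l m a τ Y : ℕ) .{{nz : NonZero n}} (n≤D : n ≤ Virt.D k z) (D≤ : Virt.D k z ≤ suc c * n)
           (fits : suc c * (suc c * Virt.msgWidth k z) ≤ B) (16≤z : 16 ≤ z) (1≤e : 1 ≤ e) (1≤Y : 1 ≤ Y)
           (Y≡ : Y ≡ 2 * e * l) (m≤l : m ≤ l) (δ≤ : Radii.δ Y m ≤ 2 ^ τ) (K<κ : Sparse.K k z < κ m)
           (24≤a : 24 ≤ a) (slack≤ : 2 * e * slack τ ≤ a) (Λ-fits : 160 * e * 2 ^ τ + 18 * 2 ^ τ ≤ a * 2 ^ τ) where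

  open Schedule n k z B c n≤D D≤ fits (≤-trans (s≤s z≤n) 16≤z)

  open Phases a τ Y m using (estimateK)

  rounds : ℕ
  rounds = roundsFor a τ m

  module _ (G : Graph n) where

    Adj-sym : ∀ u v → Adj G u v ≡ Adj G v u
    Adj-sym u v with idx u <? n | idx v <? n
    ... | yes p | yes q = Graph.sym G (fromℕ< p) (fromℕ< q)
    ... | yes _ | no _ = refl
    ... | no _ | yes _ = refl
    ... | no _ | no _ = refl

    emb-injective : ∀ {u v} → emb u ≡ emb v → u ≡ v
    emb-injective {u} {v} eq = toℕ-injective (trans (sym (idx-emb u)) (trans (cong idx eq) (idx-emb v)))

    from-idx : ∀ u (p : idx (emb u) < n) → fromℕ< p ≡ u
    from-idx u p = toℕ-injective (trans (toℕ-fromℕ< p) (idx-emb u))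

    Adj-emb : ∀ u v → Adj G (emb u) (emb v) ≡ adj G u v
    Adj-emb u v with idx (emb u) <? n | idx (emb v) <? n
    ... | yes p | yes q = cong₂ (adj G) (from-idx u p) (from-idx v q)
    ... | yes _ | no q = ⊥-elim (q (subst (_< n) (sym (idx-emb v)) (toℕ<n v)))
    ... | no p | _ = ⊥-elim (p (subst (_< n) (sym (idx-emb u)) (toℕ<n u)))

    Adj-image : ∀ x y → Adj G x y ≡ true → ∃ λ w → y ≡ emb w
    Adj-image x y eq with idx x <? n | idx y <? n
    Adj-image x y eq | yes p | yes q = fromℕ< q , trans (sym (node-idx y)) (cong node (sym (toℕ-fromℕ< q)))

    module Pt = Paths (Adj G)

    toPath : ∀ {u v d} → Walk G u v d → Pt.Path Pt.Always (emb u) (emb v) d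
    toPath Walk.here = Pt.nil
    toPath (Walk.step {u} {w} eq p) = Pt.cons tt (trans (Adj-emb u w) eq) (toPath p)

    fromPath : ∀ {x y d} → Pt.Path Pt.Always x y d → ∀ {u v} → x ≡ emb u → y ≡ emb v → Walk G u v d
    fromPath Pt.nil {u} {v} eq eq' = subst (λ v → Walk G u v 0) (emb-injective (trans (sym eq) eq')) Walk.here
    fromPath (Pt.cons {x} {y} _ eq p) {u} {v} refl eq' =
      let (w , ew) = Adj-image x y eq in
      Walk.step (trans (sym (Adj-emb u w)) (trans (cong (Adj G (emb u)) (sym ew)) eq)) (fromPath p ew eq')

  algorithm : Σ (CCAlgorithm n B) λ Al → ∀ G u v →
    (∀ d → Walk G u v d → ∃ λ w → estimate Al rounds G u v ≡ just w × e * w ≤ suc e * d + e * (80 * 2 ^ τ)) ×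
    (∀ w → estimate Al rounds G u v ≡ just w → ∃ λ d → d ≤ w × Walk G u v d)
  algorithm = proj₁ finished , λ G u v → complete G u v , sound G u v
    where
    module B' (A : Input) = Build k z a τ Y m A
    finished : Σ (CCAlgorithm n B) λ Al → ∀ G u v → estimate Al rounds G u v ≡
               tab (λ y → Shortest.best k z (B'.F (Adj G)) D (emb u) y) ! emb v
    finished = finish estimateK
    module Fin' (G : Graph n) = Final k z a τ Y m (Adj G) (Adj-sym G) 16≤z
    module St (G : Graph n) = Fin'.Stretch G e l 1≤e 1≤Y Y≡ m≤l δ≤ K<κ 24≤a slack≤ Λ-fits
    value : ∀ G u v → estimate (proj₁ finished) rounds G u v ≡ Shortest.best k z (Fin'.F G) D (emb u) (emb v)
    value G u v = trans (proj₂ finished G u v) (tab-! (λ y → Shortest.best k z (Fin'.F G) D (emb u) y) (emb v))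
    complete : ∀ G u v d → Walk G u v d → ∃ λ w → estimate (proj₁ finished) rounds G u v ≡ just w × e * w ≤ suc e * d + e * (80 * 2 ^ τ)
    complete G u v d p = let (w , eq , le) = St.estimate-bound G (toPath G p) in w , trans (value G u v) eq , le
    sound : ∀ G u v w → estimate (proj₁ finished) rounds G u v ≡ just w → ∃ λ d → d ≤ w × Walk G u v d
    sound G u v w eq = let (d , le , p) = Fin'.best-sound G D (trans (sym (value G u v)) eq) in d , le , fromPath G p refl refl

opaque
  roundFactor : ℕ
  roundFactor = 14000

  2*roundFactor : 2 * roundFactor ≡ 28000
  2*roundFactor = refl

-- Choice of the parameters

module Choice (e m : ℕ) (1≤e : 1 ≤ e) where

  L Y X τ β : ℕ
  L = suc m
  Y = 2 * e * L
  X = (40 * Y) ^ L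
  τ = lg X
  β = 80 * 2 ^ τ

  opaque
    -- 384 = 2 * 192 keeps the slack accumulated over τ scales at a relative error of 1 / (2 e).
    -- Taking τ + 1 instead of τ leaves room for blocks of length 160 e ρ with 18 ρ for the hubs,
    -- since 160 e + 18 ≤ 384 e.
    a : ℕ
    a = 384 * (e * suc τ)

    slack-fits : 2 * e * slack τ ≤ a
    slack-fits = ≤-trans (≤-reflexive (cong (2 * e *_) (slack-def τ))) (≤-trans (≤-reflexive (lemma e τ)) (*-monoʳ-≤ 384 (*-monoʳ-≤ e (n≤1+n τ))))
      where lemma : ∀ e τ → 2 * e * (192 * τ) ≡ 384 * (e * τ)
            lemma = solve-∀

    24≤a : 24 ≤ a
    24≤a = ≤-trans (≤ᵇ⇒≤ 24 (384 * 1) tt) (*-monoʳ-≤ 384 (≤-trans 1≤e (m≤m*n e (suc τ))))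

    Λ-fits : 160 * e * 2 ^ τ + 18 * 2 ^ τ ≤ a * 2 ^ τ
    Λ-fits = ≤-trans (≤-reflexive (sym (*-distribʳ-+ (2 ^ τ) (160 * e) 18))) (*-monoˡ-≤ (2 ^ τ)
      (≤-trans (+-monoʳ-≤ (160 * e) (≤-trans (*-monoʳ-≤ 18 1≤e) (*-monoˡ-≤ e (≤ᵇ⇒≤ 18 224 tt))))
        (≤-trans (≤-reflexive (lemma e)) (*-monoʳ-≤ 384 (m≤m*n e (suc τ))))))
      where lemma : ∀ e → 160 * e + 224 * e ≡ 384 * e
            lemma = solve-∀

  1≤Y : 1 ≤ Y
  1≤Y = *-mono-≤ {1} {2 * e} {1} {L} (*-mono-≤ {1} {2} (s≤s z≤n) 1≤e) (s≤s z≤n)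

  δ-fits : Radii.δ Y m ≤ 2 ^ τ
  δ-fits = ≤-trans (RadiiBound.δ-bound Y 1≤Y m) (n≤2^lg X)

  1≤X : 1 ≤ X
  1≤X = m^n>0 (40 * Y) {{>-nonZero (*-mono-≤ {1} {40} (s≤s z≤n) 1≤Y)}} L

  β-bound : β ≤ (12800 * (e * L)) ^ L
  β-bound = begin
    80 * 2 ^ τ                    ≤⟨ *-monoʳ-≤ 80 (2^lg≤2n 1≤X) ⟩
    80 * (2 * X)                  ≡⟨ sym (*-assoc 80 2 X) ⟩
    160 * X                       ≤⟨ *-monoˡ-≤ X (m≤m*n 160 (160 ^ m) {{>-nonZero (m^n>0 160 m)}}) ⟩
    160 ^ L * (40 * Y) ^ L        ≡⟨ sym (^-distribʳ-* L 160 (40 * Y)) ⟩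
    (160 * (40 * Y)) ^ L          ≡⟨ cong (_^ L) (lemma e L) ⟩
    (12800 * (e * L)) ^ L         ∎
    where
    open ≤-Reasoning
    ^-distribʳ-* : ∀ i x y → (x * y) ^ i ≡ x ^ i * y ^ i
    ^-distribʳ-* zero x y = refl
    ^-distribʳ-* (suc i) x y = trans (cong (x * y *_) (^-distribʳ-* i x y)) (shuffle x y (x ^ i) (y ^ i))
      where shuffle : ∀ x y u v → x * y * (u * v) ≡ x * u * (y * v)
            shuffle = solve-∀
    lemma : ∀ e L → 160 * (40 * (2 * e * L)) ≡ 12800 * (e * L)
    lemma = solve-∀

  τ<lgβ : suc τ ≤ lg β
  τ<lgβ = ≤-trans (≤-reflexive (sym (⌈log₂2^n⌉≡n (suc τ)))) (⌈log₂⌉-mono-≤ {2 ^ suc τ} {β} (*-monoˡ-≤ (2 ^ τ) {2} {80} (≤ᵇ⇒≤ 2 80 tt)))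

  L≤τ : L ≤ τ
  L≤τ = ≤-trans (≤-reflexive (sym (⌈log₂2^n⌉≡n L))) (⌈log₂⌉-mono-≤ {2 ^ L} {X} (^-monoˡ-≤ L (*-mono-≤ {2} {40} {1} {Y} (s≤s (s≤s z≤n)) 1≤Y)))

  opaque
    unfolding a roundFactor

    rounds-bound : roundsFor a τ m ≤ roundFactor * (e * lg β ^ 2)
    rounds-bound = ≤-trans (≤-trans bound (≤-reflexive (cong (λ s → 14000 * (e * s)) (sym (square (suc τ)))))) (*-monoʳ-≤ 14000 (*-monoʳ-≤ e (^-monoˡ-≤ 2 τ<lgβ)))
      where
      square : ∀ x → x ^ 2 ≡ x * x
      square x = cong (x *_) (*-identityʳ x)
      t q : ℕ
      t = suc τ
      q = e * (t * t)
      t≤q : t ≤ q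
      t≤q = ≤-trans (m≤m*n t t) (m≤n*m (t * t) e {{>-nonZero 1≤e}})
      -- The dominant coefficient is 13824 = 6 * 6 * 384: six rounds for each of the 6 a hops, at
      -- each of τ + 1 scales.
      expand : ∀ m τ e t → 4 + ((1 + m) * 2 + (1 + (6 * (6 * (384 * (e * t)) + 12) + (21 + τ * (28 + 6 * (6 * (384 * (e * t)) + 12))))))
               ≡ 100 + 2 * m + 100 * τ + 13824 * (e * (t * (1 + τ)))
      expand = solve-∀
      bound : roundsFor (384 * (e * suc τ)) τ m ≤ 14000 * q
      bound = begin
        roundsFor (384 * (e * suc τ)) τ m                ≡⟨ expand m τ e (suc τ) ⟩
        100 + 2 * m + 100 * τ + 13824 * q                ≤⟨ +-monoˡ-≤ (13824 * q) (+-monoˡ-≤ (100 * τ) {100 + 2 * m} {100 + 2 * τ} (+-monoʳ-≤ 100 {2 * m} {2 * τ} (*-monoʳ-≤ 2 (≤-trans (n≤1+n m) L≤τ)))) ⟩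
        100 + 2 * τ + 100 * τ + 13824 * q                ≤⟨ +-monoˡ-≤ (13824 * q) (≤-by {100 + 2 * τ + 100 * τ} {102 * suc τ} 2 (collect τ)) ⟩
        102 * t + 13824 * q                              ≤⟨ +-monoˡ-≤ (13824 * q) (*-monoʳ-≤ 102 t≤q) ⟩
        102 * q + 13824 * q                              ≤⟨ ≤-by {102 * q + 13824 * q} {14000 * q} (74 * q) (final q) ⟩
        14000 * q                                        ∎
        where
        open ≤-Reasoning
        collect : ∀ τ → 102 * suc τ ≡ 100 + 2 * τ + 100 * τ + 2
        collect = solve-∀
        final : ∀ q → 14000 * q ≡ 102 * q + 13824 * q + 74 * q
        final = solve-∀

-- Natural numbers as rationals

ℕ→ℚᵘ : ∀ n → ℚ.toℚᵘ (ℕ→ℚ n) ℚᵘ.≃ ℚᵘ.mkℚᵘ (ℤ.+ n) 0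
ℕ→ℚᵘ n = ℚP.toℚᵘ-fromℚᵘ (ℚᵘ.mkℚᵘ (ℤ.+ n) 0)

ℕ→ℚ-+ : ∀ m n → ℕ→ℚ (m + n) ≡ ℕ→ℚ m ℚ.+ ℕ→ℚ n
ℕ→ℚ-+ m n = ℚP.toℚᵘ-injective (begin
  ℚ.toℚᵘ (ℕ→ℚ (m + n))                              ≈⟨ ℕ→ℚᵘ (m + n) ⟩
  ℚᵘ.mkℚᵘ (ℤ.+ (m + n)) 0                           ≈⟨ ℚᵘ.*≡* (cong (ℤ._* ℤ.+ 1) (trans (ℤP.pos-+ m n) (sym (cong₂ ℤ._+_ (ℤP.*-identityʳ (ℤ.+ m)) (ℤP.*-identityʳ (ℤ.+ n)))))) ⟩
  ℚᵘ.mkℚᵘ (ℤ.+ m) 0 ℚᵘ.+ ℚᵘ.mkℚᵘ (ℤ.+ n) 0          ≈⟨ ℚᵘP.+-cong (ℕ→ℚᵘ m) (ℕ→ℚᵘ n) ⟨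
  ℚ.toℚᵘ (ℕ→ℚ m) ℚᵘ.+ ℚ.toℚᵘ (ℕ→ℚ n)                ≈⟨ ℚP.toℚᵘ-homo-+ (ℕ→ℚ m) (ℕ→ℚ n) ⟨
  ℚ.toℚᵘ (ℕ→ℚ m ℚ.+ ℕ→ℚ n)                          ∎)
  where open import Relation.Binary.Reasoning.Setoid ℚᵘP.≃-setoid

ℕ→ℚ-* : ∀ m n → ℕ→ℚ (m * n) ≡ ℕ→ℚ m ℚ.* ℕ→ℚ n
ℕ→ℚ-* m n = ℚP.toℚᵘ-injective (begin
  ℚ.toℚᵘ (ℕ→ℚ (m * n))                              ≈⟨ ℕ→ℚᵘ (m * n) ⟩
  ℚᵘ.mkℚᵘ (ℤ.+ (m * n)) 0                           ≈⟨ ℚᵘ.*≡* (cong (ℤ._* ℤ.+ 1) (ℤP.pos-* m n)) ⟩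
  ℚᵘ.mkℚᵘ (ℤ.+ m) 0 ℚᵘ.* ℚᵘ.mkℚᵘ (ℤ.+ n) 0          ≈⟨ ℚᵘP.*-cong (ℕ→ℚᵘ m) (ℕ→ℚᵘ n) ⟨
  ℚ.toℚᵘ (ℕ→ℚ m) ℚᵘ.* ℚ.toℚᵘ (ℕ→ℚ n)                ≈⟨ ℚP.toℚᵘ-homo-* (ℕ→ℚ m) (ℕ→ℚ n) ⟨
  ℚ.toℚᵘ (ℕ→ℚ m ℚ.* ℕ→ℚ n)                          ∎)
  where open import Relation.Binary.Reasoning.Setoid ℚᵘP.≃-setoid

ℕ→ℚ-mono : ∀ {m n} → m ≤ n → ℕ→ℚ m ℚ.≤ ℕ→ℚ n
ℕ→ℚ-mono {m} {n} le = ℚP.toℚᵘ-cancel-≤ (ℚᵘP.≤-trans (ℚᵘP.≤-reflexive (ℕ→ℚᵘ m))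
  (ℚᵘP.≤-trans (ℚᵘ.*≤* (ℤP.*-monoʳ-≤-nonNeg (ℤ.+ 1) (ℤ.+≤+ le))) (ℚᵘP.≤-reflexive (ℚᵘP.≃-sym (ℕ→ℚᵘ n)))))

0≤ℕ→ℚ : ∀ n → 0ℚ ℚ.≤ ℕ→ℚ n
0≤ℕ→ℚ n = ℕ→ℚ-mono {0} {n} z≤n

*-monoˡ : ∀ {p q r} → 0ℚ ℚ.≤ r → p ℚ.≤ q → r ℚ.* p ℚ.≤ r ℚ.* q
*-monoˡ {r = r} 0≤r le = ℚP.*-monoˡ-≤-nonNeg r {{ℚ.nonNegative 0≤r}} le

*-monoʳ : ∀ {p q r} → 0ℚ ℚ.≤ r → p ℚ.≤ q → p ℚ.* r ℚ.≤ q ℚ.* r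
*-monoʳ {r = r} 0≤r le = ℚP.*-monoʳ-≤-nonNeg r {{ℚ.nonNegative 0≤r}} le

*-nonNeg : ∀ {p q} → 0ℚ ℚ.≤ p → 0ℚ ℚ.≤ q → 0ℚ ℚ.≤ p ℚ.* q
*-nonNeg {p} {q} 0≤p 0≤q = ℚP.≤-trans (ℚP.≤-reflexive (sym (ℚP.*-zeroʳ p))) (*-monoˡ 0≤p 0≤q)

^ℚ-nonNeg : ∀ {p} i → 0ℚ ℚ.≤ p → 0ℚ ℚ.≤ p ^ℚ i
^ℚ-nonNeg zero _ = 0≤ℕ→ℚ 1
^ℚ-nonNeg (suc i) 0≤p = *-nonNeg 0≤p (^ℚ-nonNeg i 0≤p)

Inverse : ℚ → ℕ → Set
Inverse ε e = 1 ≤ e × 1ℚ ℚ.≤ ℕ→ℚ e ℚ.* ε × ε ℚ.* ℕ→ℚ e ℚ.≤ ℕ→ℚ 2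

-- With e = floor (1 / ε) + 1 and ε < 1 one has 1 ≤ e ε ≤ 1 + ε ≤ 2. The lower bound turns stretch 1
-- + 1 / e into 1 + ε; the upper one bounds β and the rounds in terms of ε.
inverse : ∀ ε → 0ℚ ℚ.< ε → ε ℚ.< 1ℚ → ∃ λ e → Inverse ε e
inverse ε@(mkℚ (ℤ.+ zero) d-1 _) 0<ε _ = ⊥-elim (ℤP.<-irrefl refl (subst₂ ℤ._<_ refl refl (ℚP.drop-*<* 0<ε)))
inverse ε@(mkℚ ℤ.-[1+ x ] d-1 _) 0<ε _ with ℚP.drop-*<* 0<ε
... | ()
inverse ε@(mkℚ (ℤ.+ suc p-1) d-1 _) _ ε<1 = e , s≤s z≤n , lower , upper
  where
  p q e : ℕ
  p = suc p-1
  q = suc d-1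
  e = suc (q / p)
  p<q : p < q
  p<q = ℤP.drop‿+<+ (subst₂ ℤ._<_ (ℤP.*-identityʳ (ℤ.+ p)) (ℤP.*-identityˡ (ℤ.+ q)) (ℚP.drop-*<* ε<1))
  q≤ : q ≤ e * p
  q≤ = ≤-trans (≤-reflexive (m≡m%n+[m/n]*n q p)) (+-monoˡ-≤ (q / p * p) (<⇒≤ (m%n<n q p)))
  ≤2q : p * e ≤ 2 * q
  ≤2q = ≤-trans (≤-reflexive (*-comm p e)) (≤-trans (+-mono-≤ (<⇒≤ p<q) (m/n*n≤m q p)) (≤-reflexive (cong (q +_) (sym (+-identityʳ q)))))
  lower : 1ℚ ℚ.≤ ℕ→ℚ e ℚ.* ε
  lower = ℚP.toℚᵘ-cancel-≤ (ℚᵘP.≤-trans (ℚᵘ.*≤* le) (ℚᵘP.≤-reflexive (ℚᵘP.≃-trans (ℚᵘP.*-congʳ {ℚ.toℚᵘ ε} (ℚᵘP.≃-sym (ℕ→ℚᵘ e))) (ℚᵘP.≃-sym (ℚP.toℚᵘ-homo-* (ℕ→ℚ e) ε)))))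
    where
    le : ℤ.+ 1 ℤ.* ℤ.+ (1 * q) ℤ.≤ (ℤ.+ e ℤ.* ℤ.+ p) ℤ.* ℤ.+ 1
    le = subst₂ ℤ._≤_ (sym (trans (ℤP.*-identityˡ _) (cong ℤ.+_ (*-identityˡ q)))) (sym (trans (ℤP.*-identityʳ _) (sym (ℤP.pos-* e p)))) (ℤ.+≤+ q≤)
  upper : ε ℚ.* ℕ→ℚ e ℚ.≤ ℕ→ℚ 2
  upper = ℚP.toℚᵘ-cancel-≤ (ℚᵘP.≤-trans (ℚᵘP.≤-reflexive (ℚᵘP.≃-trans (ℚP.toℚᵘ-homo-* ε (ℕ→ℚ e)) (ℚᵘP.*-congˡ {ℚ.toℚᵘ ε} (ℕ→ℚᵘ e)))) (ℚᵘP.≤-trans (ℚᵘ.*≤* le) (ℚᵘP.≤-reflexive (ℚᵘP.≃-sym (ℕ→ℚᵘ 2)))))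
    where
    le : (ℤ.+ p ℤ.* ℤ.+ e) ℤ.* ℤ.+ 1 ℤ.≤ ℤ.+ 2 ℤ.* ℤ.+ (q * 1)
    le = subst₂ ℤ._≤_ (sym (trans (ℤP.*-identityʳ _) (sym (ℤP.pos-* p e)))) (trans (ℤP.pos-* 2 q) (cong (λ q → ℤ.+ 2 ℤ.* ℤ.+ q) (sym (*-identityʳ q)))) (ℤ.+≤+ ≤2q)

module _ (ε : ℚ) (e : ℕ) (0≤ε : 0ℚ ℚ.≤ ε) (inv : Inverse ε e) where

  open +-*-Solver
  open ℚP.≤-Reasoning

  private
    E = ℕ→ℚ e

  -- Each of the `i` factors `M * e` of the bound is paired with one factor ε, and e ε ≤ 2 leaves at
  -- most 2 M.
  power-bound : ∀ i β M C → β ≤ (M * e) ^ i → 2 * M ≤ C → ℕ→ℚ β ℚ.* (ε ^ℚ i) ℚ.≤ ℕ→ℚ C ^ℚ i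
  power-bound i β M C β≤ 2M≤C = ℚP.≤-trans (*-monoʳ (^ℚ-nonNeg i 0≤ε) (ℕ→ℚ-mono β≤)) (go i)
    where
    base-bound : ℕ→ℚ (M * e) ℚ.* ε ℚ.≤ ℕ→ℚ C
    base-bound = begin
      ℕ→ℚ (M * e) ℚ.* ε           ≡⟨ cong (ℚ._* ε) (ℕ→ℚ-* M e) ⟩
      ℕ→ℚ M ℚ.* E ℚ.* ε           ≡⟨ solve 3 (λ m e x → m :* e :* x := m :* (x :* e)) refl (ℕ→ℚ M) E ε ⟩
      ℕ→ℚ M ℚ.* (ε ℚ.* E)         ≤⟨ *-monoˡ (0≤ℕ→ℚ M) (proj₂ (proj₂ inv)) ⟩
      ℕ→ℚ M ℚ.* ℕ→ℚ 2             ≡⟨ sym (ℕ→ℚ-* M 2) ⟩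
      ℕ→ℚ (M * 2)                 ≤⟨ ℕ→ℚ-mono (≤-trans (≤-reflexive (*-comm M 2)) 2M≤C) ⟩
      ℕ→ℚ C                       ∎
    go : ∀ i → ℕ→ℚ ((M * e) ^ i) ℚ.* (ε ^ℚ i) ℚ.≤ ℕ→ℚ C ^ℚ i
    go zero = ℚP.≤-refl
    go (suc i) = begin
      ℕ→ℚ (M * e * (M * e) ^ i) ℚ.* (ε ℚ.* (ε ^ℚ i))                    ≡⟨ cong (ℚ._* (ε ℚ.* (ε ^ℚ i))) (ℕ→ℚ-* (M * e) ((M * e) ^ i)) ⟩
      ℕ→ℚ (M * e) ℚ.* ℕ→ℚ ((M * e) ^ i) ℚ.* (ε ℚ.* (ε ^ℚ i))            ≡⟨ solve 4 (λ a b c d → a :* b :* (c :* d) := (a :* c) :* (b :* d)) refl (ℕ→ℚ (M * e)) (ℕ→ℚ ((M * e) ^ i)) ε (ε ^ℚ i) ⟩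
      (ℕ→ℚ (M * e) ℚ.* ε) ℚ.* (ℕ→ℚ ((M * e) ^ i) ℚ.* (ε ^ℚ i))          ≤⟨ *-monoʳ (*-nonNeg (0≤ℕ→ℚ ((M * e) ^ i)) (^ℚ-nonNeg i 0≤ε)) base-bound ⟩
      ℕ→ℚ C ℚ.* (ℕ→ℚ ((M * e) ^ i) ℚ.* (ε ^ℚ i))                        ≤⟨ *-monoˡ (0≤ℕ→ℚ C) (go i) ⟩
      ℕ→ℚ C ℚ.* (ℕ→ℚ C ^ℚ i)                                            ∎

  round-bound : ∀ R g x M C → R ≤ M * (e * g) → 2 * M ≤ C → ε ℚ.* ℕ→ℚ R ℚ.≤ ℕ→ℚ C ℚ.* (ℕ→ℚ g ℚ.+ ε ℚ.* ℕ→ℚ x)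
  round-bound R g x M C R≤ 2M≤C = begin
    ε ℚ.* ℕ→ℚ R                                    ≤⟨ *-monoˡ 0≤ε (ℕ→ℚ-mono R≤) ⟩
    ε ℚ.* ℕ→ℚ (M * (e * g))                        ≡⟨ cong (ε ℚ.*_) (trans (ℕ→ℚ-* M (e * g)) (cong (ℕ→ℚ M ℚ.*_) (ℕ→ℚ-* e g))) ⟩
    ε ℚ.* (ℕ→ℚ M ℚ.* (E ℚ.* ℕ→ℚ g))                ≡⟨ solve 4 (λ x m e g → x :* (m :* (e :* g)) := m :* g :* (x :* e)) refl ε (ℕ→ℚ M) E (ℕ→ℚ g) ⟩
    ℕ→ℚ M ℚ.* ℕ→ℚ g ℚ.* (ε ℚ.* E)                  ≤⟨ *-monoˡ (*-nonNeg (0≤ℕ→ℚ M) (0≤ℕ→ℚ g)) (proj₂ (proj₂ inv)) ⟩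
    ℕ→ℚ M ℚ.* ℕ→ℚ g ℚ.* ℕ→ℚ 2                      ≡⟨ solve 3 (λ m g t → m :* g :* t := t :* m :* g) refl (ℕ→ℚ M) (ℕ→ℚ g) (ℕ→ℚ 2) ⟩
    ℕ→ℚ 2 ℚ.* ℕ→ℚ M ℚ.* ℕ→ℚ g                      ≡⟨ cong (ℚ._* ℕ→ℚ g) (sym (ℕ→ℚ-* 2 M)) ⟩
    ℕ→ℚ (2 * M) ℚ.* ℕ→ℚ g                          ≤⟨ *-monoʳ (0≤ℕ→ℚ g) (ℕ→ℚ-mono 2M≤C) ⟩
    ℕ→ℚ C ℚ.* ℕ→ℚ g                                ≤⟨ *-monoˡ (0≤ℕ→ℚ C) (ℚP.≤-trans (ℚP.≤-reflexive (sym (ℚP.+-identityʳ (ℕ→ℚ g)))) (ℚP.+-monoʳ-≤ (ℕ→ℚ g) (*-nonNeg 0≤ε (0≤ℕ→ℚ x)))) ⟩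
    ℕ→ℚ C ℚ.* (ℕ→ℚ g ℚ.+ ε ℚ.* ℕ→ℚ x)              ∎

  stretch-bound : ∀ w d β → e * w ≤ suc e * d + e * β → ℕ→ℚ w ℚ.≤ (1ℚ ℚ.+ ε) ℚ.* ℕ→ℚ d ℚ.+ ℕ→ℚ β
  stretch-bound w d β le = ℚP.*-cancelˡ-≤-pos E {{ℚ.positive (ℚP.<-≤-trans (ℚP.positive⁻¹ 1ℚ) (ℕ→ℚ-mono (proj₁ inv)))}} (begin
    E ℚ.* ℕ→ℚ w                                                    ≡⟨ sym (ℕ→ℚ-* e w) ⟩
    ℕ→ℚ (e * w)                                                    ≤⟨ ℕ→ℚ-mono le ⟩
    ℕ→ℚ (d + e * d + e * β)                                        ≡⟨ trans (ℕ→ℚ-+ (d + e * d) (e * β)) (cong₂ ℚ._+_ (trans (ℕ→ℚ-+ d (e * d)) (cong (ℕ→ℚ d ℚ.+_) (ℕ→ℚ-* e d))) (ℕ→ℚ-* e β)) ⟩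
    ℕ→ℚ d ℚ.+ E ℚ.* ℕ→ℚ d ℚ.+ E ℚ.* ℕ→ℚ β                          ≡⟨ cong (λ x → x ℚ.+ E ℚ.* ℕ→ℚ d ℚ.+ E ℚ.* ℕ→ℚ β) (sym (ℚP.*-identityˡ (ℕ→ℚ d))) ⟩
    1ℚ ℚ.* ℕ→ℚ d ℚ.+ E ℚ.* ℕ→ℚ d ℚ.+ E ℚ.* ℕ→ℚ β                   ≤⟨ ℚP.+-monoˡ-≤ (E ℚ.* ℕ→ℚ β) (ℚP.+-monoˡ-≤ (E ℚ.* ℕ→ℚ d) (*-monoʳ (0≤ℕ→ℚ d) (proj₁ (proj₂ inv)))) ⟩
    E ℚ.* ε ℚ.* ℕ→ℚ d ℚ.+ E ℚ.* ℕ→ℚ d ℚ.+ E ℚ.* ℕ→ℚ β              ≡⟨ solve 4 (λ e x d b → e :* x :* d :+ e :* d :+ e :* b := e :* ((con 1ℚ :+ x) :* d :+ b)) refl E ε (ℕ→ℚ d) (ℕ→ℚ β) ⟩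
    E ℚ.* ((1ℚ ℚ.+ ε) ℚ.* ℕ→ℚ d ℚ.+ ℕ→ℚ β)                         ∎)

2^≤⇒≤lg : ∀ i {n} → 2 ^ i ≤ n → i ≤ lg n
2^≤⇒≤lg i {n} le = ≤-trans (≤-reflexive (sym (⌈log₂2^n⌉≡n i))) (⌈log₂⌉-mono-≤ {2 ^ i} {n} le)

-- Parameters as functions of n

module Parameters (n : ℕ) (1≤n : 1 ≤ n) (16≤ℓ : 16 ≤ lg n) where

  -- `k` is ℓ / 4 rounded up, hence the number 2 ^ H of virtual nodes lies between n and 8 * 2 ^ ℓ ≤
  -- 16 n. Each vertex hosts sixteen of them.
  ℓ k H : ℕ
  ℓ = lg n
  k = (ℓ + 3) / 4
  H = (k + k) + (k + k)

  H≡ : H ≡ k * 4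
  H≡ = lemma k
    where lemma : ∀ k → (k + k) + (k + k) ≡ k * 4
          lemma = solve-∀

  H≤ : H ≤ ℓ + 3
  H≤ = ≤-trans (≤-reflexive H≡) (m/n*n≤m (ℓ + 3) 4)

  ℓ≤H : ℓ ≤ H
  ℓ≤H = ≤-trans (+-cancelʳ-≤ 3 ℓ (k * 4) (≤-trans (≤-reflexive (m≡m%n+[m/n]*n (ℓ + 3) 4))
    (≤-trans (+-monoˡ-≤ (k * 4) {(ℓ + 3) % 4} {3} (≤-pred (m%n<n (ℓ + 3) 4))) (≤-reflexive (+-comm 3 (k * 4)))))) (≤-reflexive (sym H≡))

  n≤D : n ≤ 2 ^ H
  n≤D = ≤-trans (n≤2^lg n) (^-monoʳ-≤ 2 ℓ≤H)

  D≤ : 2 ^ H ≤ 16 * n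
  D≤ = ≤-trans (^-monoʳ-≤ 2 H≤) (≤-trans (≤-reflexive (^-distribˡ-+-* 2 ℓ 3)) (≤-trans (*-monoˡ-≤ 8 (2^lg≤2n 1≤n)) (≤-reflexive (lemma n))))
    where lemma : ∀ n → 2 * n * 8 ≡ 16 * n
          lemma = solve-∀

  -- 4096 = 16 * 16 * 16 entries cross a link per round: sixteen for each of the 16 * 16 pairs of
  -- hosted nodes. An entry takes 2 H + 2 ≤ 2 ℓ + 8 ≤ 3 ℓ bits.
  fits : ∀ {C} → 12288 ≤ C → 16 * (16 * (16 * suc (H + suc H))) ≤ C * ℓ
  fits {C} le = begin
    16 * (16 * (16 * suc (H + suc H)))       ≡⟨ l₁ H ⟩
    4096 * (2 * H + 2)                       ≤⟨ *-monoʳ-≤ 4096 (+-monoˡ-≤ 2 (*-monoʳ-≤ 2 H≤)) ⟩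
    4096 * (2 * (ℓ + 3) + 2)                 ≡⟨ cong (4096 *_) (l₂ ℓ) ⟩
    4096 * (2 * ℓ + 8)                       ≤⟨ *-monoʳ-≤ 4096 (+-monoʳ-≤ (2 * ℓ) (≤-trans (m≤m+n 8 8) 16≤ℓ)) ⟩
    4096 * (2 * ℓ + ℓ)                       ≡⟨ l₃ ℓ ⟩
    12288 * ℓ                                ≤⟨ *-monoˡ-≤ ℓ le ⟩
    C * ℓ                                    ∎
    where
    open ≤-Reasoning
    l₁ : ∀ H → 16 * (16 * (16 * suc (H + suc H))) ≡ 4096 * (2 * H + 2)
    l₁ = solve-∀
    l₂ : ∀ ℓ → 2 * (ℓ + 3) + 2 ≡ 2 * ℓ + 8
    l₂ = solve-∀
    l₃ : ∀ ℓ → 4096 * (2 * ℓ + ℓ) ≡ 12288 * ℓ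
    l₃ = solve-∀

  m : ℕ
  m = pred (lglg n)

  L≡ : lglg n ≡ suc m
  L≡ = sym (suc-pred (lglg n) {{>-nonZero (⌈log₂⌉-mono-≤ {2} {ℓ} (≤-trans (m≤m+n 2 14) 16≤ℓ))}})

  -- The exponent on the left is 4 + 2 k, about ℓ / 2. The one on the right is 4 * 2 ^ m = 2 * 2 ^
  -- (m + 1) ≥ 2 ℓ, because m + 1 = `lglg n`. So the levels 0 to m exhaust the hierarchy.
  K<κ : 16 * 2 ^ (k + k) < κ m
  K<κ = subst₂ _<_ (^-distribˡ-+-* 2 4 (k + k)) (sym (κ-power m)) (^-monoʳ-< 2 (s≤s (s≤s z≤n)) exponent)
    where
    ℓ≤ : ℓ ≤ 2 * 2 ^ m
    ℓ≤ = subst (λ L → ℓ ≤ 2 ^ L) L≡ (n≤2^lg ℓ)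
    exponent : 4 + (k + k) < 4 * 2 ^ m
    exponent = *-cancelˡ-< 2 (4 + (k + k)) (4 * 2 ^ m) (begin-strict
      2 * (4 + (k + k))          ≡⟨ l₁ k ⟩
      8 + H                      ≤⟨ +-monoʳ-≤ 8 H≤ ⟩
      8 + (ℓ + 3)                ≡⟨ l₂ ℓ ⟩
      11 + ℓ                     <⟨ +-monoˡ-< ℓ (≤-trans (m≤m+n 12 4) 16≤ℓ) ⟩
      ℓ + ℓ                      ≤⟨ m≤m+n (ℓ + ℓ) (ℓ + ℓ) ⟩
      ℓ + ℓ + (ℓ + ℓ)            ≡⟨ l₃ ℓ ⟩
      4 * ℓ                      ≤⟨ *-monoʳ-≤ 4 ℓ≤ ⟩
      4 * (2 * 2 ^ m)            ≡⟨ l₄ (2 ^ m) ⟩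
      2 * (4 * 2 ^ m)            ∎)
      where
      open ≤-Reasoning
      l₁ : ∀ k → 2 * (4 + (k + k)) ≡ 8 + ((k + k) + (k + k))
      l₁ = solve-∀
      l₂ : ∀ ℓ → 8 + (ℓ + 3) ≡ 11 + ℓ
      l₂ = solve-∀
      l₃ : ∀ ℓ → ℓ + ℓ + (ℓ + ℓ) ≡ 4 * ℓ
      l₃ = solve-∀
      l₄ : ∀ x → 4 * (2 * x) ≡ 2 * (4 * x)
      l₄ = solve-∀

-- The approximation theorem

approximation : ∀ C → 28000 ≤ C → (ε : ℚ) → 0ℚ ℚ.< ε → ε ℚ.< 1ℚ → (n : ℕ) → 1 ≤ n → 16 ≤ lg n →
    Σ ℕ λ β → Σ ℕ λ R → Σ (CCAlgorithm n (C * lg n)) λ A →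
      (ℕ→ℚ β ℚ.* (ε ^ℚ lglg n) ℚ.≤ ℕ→ℚ (C * lglg n) ^ℚ lglg n)
      × (ε ℚ.* ℕ→ℚ R ℚ.≤ ℕ→ℚ C ℚ.* (ℕ→ℚ (lg β ^ 2) ℚ.+ ε ℚ.* ℕ→ℚ (lglg n ^ 4)))
      × SolvesApproxAPSP A R ε β
approximation C 28000≤C ε 0<ε ε<1 n 1≤n 16≤ℓ = β , R , proj₁ alg , β-good , R-good , solves
  where
  module Pa = Parameters n 1≤n 16≤ℓ
  e : ℕ
  e = proj₁ (inverse ε 0<ε ε<1)
  inv : Inverse ε e
  inv = proj₂ (inverse ε 0<ε ε<1)
  module Ch = Choice e Pa.m (proj₁ inv)
  module Ru = Run n Pa.k 16 (C * lg n) 15 e Ch.L Pa.m Ch.a Ch.τ Ch.Y {{>-nonZero 1≤n}} Pa.n≤D Pa.D≤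
    (Pa.fits (≤-trans (≤ᵇ⇒≤ 12288 28000 tt) 28000≤C)) ≤-refl (proj₁ inv) Ch.1≤Y refl (n≤1+n Pa.m) Ch.δ-fits Pa.K<κ Ch.24≤a Ch.slack-fits Ch.Λ-fits
  β R : ℕ
  β = Ch.β
  R = roundsFor Ch.a Ch.τ Pa.m
  alg : Σ (CCAlgorithm n (C * lg n)) λ Al → ∀ G u v →
    (∀ d → Walk G u v d → ∃ λ w → estimate Al R G u v ≡ just w × e * w ≤ suc e * d + e * β) ×
    (∀ w → estimate Al R G u v ≡ just w → ∃ λ d → d ≤ w × Walk G u v d)
  alg = Ru.algorithm
  0≤ε : 0ℚ ℚ.≤ ε
  0≤ε = ℚP.<⇒≤ 0<ε
  β-good : ℕ→ℚ β ℚ.* (ε ^ℚ lglg n) ℚ.≤ ℕ→ℚ (C * lglg n) ^ℚ lglg n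
  β-good = power-bound ε e 0≤ε inv (lglg n) β (12800 * lglg n) (C * lglg n)
    (subst (λ L → β ≤ (12800 * L * e) ^ L) (sym Pa.L≡) (≤-trans Ch.β-bound (≤-reflexive (cong (_^ Ch.L) (lemma e Ch.L)))))
    (≤-trans (≤-reflexive (sym (*-assoc 2 12800 (lglg n)))) (*-monoˡ-≤ (lglg n) (≤-trans (≤ᵇ⇒≤ 25600 28000 tt) 28000≤C)))
    where lemma : ∀ e L → 12800 * (e * L) ≡ 12800 * L * e
          lemma = solve-∀
  R-good : ε ℚ.* ℕ→ℚ R ℚ.≤ ℕ→ℚ C ℚ.* (ℕ→ℚ (lg β ^ 2) ℚ.+ ε ℚ.* ℕ→ℚ (lglg n ^ 4))
  R-good = round-bound ε e 0≤ε inv R (lg β ^ 2) (lglg n ^ 4) roundFactor C Ch.rounds-bound (≤-trans (≤-reflexive 2*roundFactor) 28000≤C)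
  solves : SolvesApproxAPSP (proj₁ alg) R ε β
  solves G u v = near , far
    where
    near : ∀ d → IsDist G u v d → Σ ℕ λ w → estimate (proj₁ alg) R G u v ≡ just w × d ≤ w ×
           ℕ→ℚ w ℚ.≤ (1ℚ ℚ.+ ε) ℚ.* ℕ→ℚ d ℚ.+ ℕ→ℚ β
    near d (p , shortest) =
      let (w , eq , le) = proj₁ (proj₂ alg G u v) d p
          (d' , d'≤w , q) = proj₂ (proj₂ alg G u v) w eq
      in w , eq , ≤-trans (shortest d' q) d'≤w , stretch-bound ε e 0≤ε inv w d β le
    far : ¬ Connected G u v → estimate (proj₁ alg) R G u v ≡ nothing
    far disconnected = go (estimate (proj₁ alg) R G u v) refl
      where
      go : ∀ o → estimate (proj₁ alg) R G u v ≡ o → o ≡ nothing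
      go nothing _ = refl
      go (just w) eq = let (d , _ , p) = proj₂ (proj₂ alg G u v) w eq in ⊥-elim (disconnected (d , p))

theorem3p10 : Σ ℕ λ C → Σ ℕ λ N₀ →
    (ε : ℚ) → 0ℚ ℚ.< ε → ε ℚ.< 1ℚ →
    (n : ℕ) → N₀ ≤ n →
    Σ ℕ λ β → Σ ℕ λ R → Σ (CCAlgorithm n (C * lg n)) λ A →
      (ℕ→ℚ β ℚ.* (ε ^ℚ lglg n) ℚ.≤ ℕ→ℚ (C * lglg n) ^ℚ lglg n)
      × (ε ℚ.* ℕ→ℚ R ℚ.≤ ℕ→ℚ C ℚ.* (ℕ→ℚ (lg β ^ 2) ℚ.+ ε ℚ.* ℕ→ℚ (lglg n ^ 4)))
      × SolvesApproxAPSP A R ε β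
-- 28000 = 2 * `roundFactor`, the 2 coming from e ε ≤ 2. It also exceeds 2 * 12800, needed for β,
-- and 12288, needed for the message length. The threshold 2 ^ 16 ensures `lg n` ≥ 16.
theorem3p10 = 28000 , 2 ^ 16 , λ ε 0<ε ε<1 n large →
  approximation 28000 ≤-refl ε 0<ε ε<1 n (≤-trans (m^n>0 2 16) large) (2^≤⇒≤lg 16 large)
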